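{- For any monoidal signature $\Sigma$, the preordered category $\mathsf{DiscCospan}(\mathbf{Hyp}_\Sigma)$ and the preordered prop $\mathbb{CB}^{\leq}_{\Sigma}$ are isomorphic as preordered cartesian bicategories.
   Context: A monoidal signature $\Sigma$ is a set of symbols each with an arity $n$ and coarity $m$ ($\Sigma_{n,m}$ those with arity $n$, coarity $m$). A $\Sigma$-hypergraph $G$ is a set $G_V$ of vertices and, for each $R\in\Sigma_{n,m}$, a set $G_R$ with source and target functions $s_R:G_R\to(G_V)^n$, $t_R:G_R\to(G_V)^m$; a morphism $f:G\to G'$ is a function $f_V:G_V\to G'_V$ and functions $f_R:G_R\to G'_R$ commuting with sources and targets (componentwise $f_V$). $\mathbf{Hyp}_\Sigma$ is the category of finite $\Sigma$-hypergraphs (all $G_V,G_R$ finite). For a finitely cocomplete category $\mathcal C$, $\mathsf{Cospan}^{\leq}(\mathcal C)$ has the objects of $\mathcal C$, arrows $X\to Y$ isomorphism classes of cospans $X\to A\leftarrow Y$, composition by pushout, monoidal product by coproduct (unit the initial object), and preorder $(X\to A\leftarrow Y)\le(X\to B\leftarrow Y)$ iff there is a cospan morphism $B\to A$ (an arrow commuting with the legs). $\mathsf{DiscCospan}(\mathbf{Hyp}_\Sigma)$ is the full subcategory of $\mathsf{Cospan}^{\leq}(\mathbf{Hyp}_\Sigma)$ on the finite ordinals $n$, viewed as discrete hypergraphs with vertices $\{0,\dots,n-1\}$ and no edges; its monoid on $X$ is $X+X\xrightarrow{[\mathrm{id},\mathrm{id}]}X\xleftarrow{\mathrm{id}}X$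 and $0\to X\xleftarrow{\mathrm{id}}X$, its comonoid the reversed cospans. A preordered cartesian bicategory is a symmetric monoidal category $(\mathcal B,\oplus,I)$ whose hom-sets are preordered with composition and $\oplus$ monotone, such that every object $X$ carries a monoid $\mu_X:X\oplus X\to X$, $\eta_X:I\to X$ and comonoid $\delta_X:X\to X\oplus X$, $\varepsilon_X:X\to I$ forming a special commutative Frobenius bimonoid (associativity, unit, commutativity, their duals, Frobenius law $(\delta_X\oplus\mathrm{id});(\mathrm{id}\oplus\mu_X)=\mu_X;\delta_X=(\mathrm{id}\oplus\delta_X);(\mu_X\oplus\mathrm{id})$, speciality $\delta_X;\mu_X=\mathrm{id}_X$; $;$ is diagrammatic composition), with $\mathrm{id}_X\le\varepsilon_X;\eta_X$, $\eta_X;\varepsilon_X\le\mathrm{id}_I$, $\mathrm{id}_X\le\delta_X;\mu_X$, $\mu_X;\delta_X\le\mathrm{id}_{X\oplus X}$, and every arrow $R:X\to Y$ satisfying $R;\delta_Y\le\delta_X;(R\oplus R)$, $R;\varepsilon_Y\le\varepsilon_X$. Morphisms are monoidal functors preserving the preorders and the monoids and comonoids. GCQ terms over $\Sigma$ with sorts $(n,m)$ are generated by constants $\delta:(1,2)$, $\varepsilon:(1,0)$, $\mu:(2,1)$, $\eta:(0,1)$, $\mathrm{id}_0:(0,0)$, $\mathrm{id}_1:(1,1)$, $\sigma:(2,2)$, symbols $R\in\Sigma_{n,m}$ of sort $(n,m)$, sequential composition $c;d$ ($(n,z),(z,m)\mapsto(n,m)$) and $c\oplus d$ ($(n,m),(p,q)\mapsto(n+p,m+q)$).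 Write $\mathrm{id}_n$ for $n$-fold $\oplus$ of $\mathrm{id}_1$, $\sigma_{n,m}$ for symmetries built from $\sigma$, $\varepsilon_0=\mathrm{id}_0$, $\varepsilon_{n+1}=\varepsilon\oplus\varepsilon_n$, $\delta_0=\mathrm{id}_0$, $\delta_{n+1}=(\delta\oplus\delta_n);(\mathrm{id}_1\oplus\sigma_{1,n}\oplus\mathrm{id}_n)$. Equations (E): strict symmetric monoidal category laws with symmetry generated by $\sigma$; $\delta;(\delta\oplus\mathrm{id}_1)=\delta;(\mathrm{id}_1\oplus\delta)$, $\delta;(\varepsilon\oplus\mathrm{id}_1)=\mathrm{id}_1$, $\delta;\sigma=\delta$; $(\mu\oplus\mathrm{id}_1);\mu=(\mathrm{id}_1\oplus\mu);\mu$, $(\eta\oplus\mathrm{id}_1);\mu=\mathrm{id}_1$, $\sigma;\mu=\mu$; $(\delta\oplus\mathrm{id}_1);(\mathrm{id}_1\oplus\mu)=\mu;\delta=(\mathrm{id}_1\oplus\delta);(\mu\oplus\mathrm{id}_1)$; $\delta;\mu=\mathrm{id}_1$. Inequalities (I): $\mathrm{id}_1\le\varepsilon;\eta$, $\eta;\varepsilon\le\mathrm{id}_0$, $\mathrm{id}_1\le\delta;\mu$, $\mu;\delta\le\mathrm{id}_2$, and for each $R\in\Sigma_{n,m}$: $R;\delta_m\le\delta_n;(R\oplus R)$, $R;\varepsilon_m\le\varepsilon_n$. The preordered prop $\mathbb{CB}^{\leq}_{\Sigma}$ has objects natural numbers, arrows $n\to m$ the GCQ terms of sort $(n,m)$ modulo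 the smallest congruence (for $;$ and $\oplus$) generated by (E), ordered by the smallest precongruence generated by (I).
   Formalization: A finite hypergraph is taken to have finitely many edges in total, not merely each G_R finite; for infinite Σ the literal claim fails by cardinality (2^|Σ| cospans 0→0 against at most |Σ| terms), and for finite Σ the two notions agree. -}

module Defs where

open import Data.Nat using (ℕ; zero; suc; _+_)
open import Data.Nat.Properties using (+-assoc; +-identityʳ)
open import Data.Fin using (Fin; _↑ˡ_; _↑ʳ_; splitAt)
open import Data.Vec using (Vec) renaming (map to vmap)
open import Data.Sum using ([_,_]′)
open import Data.Product using (Σ; _×_; _,_; Σ-syntax)
open import Relation.Binary.PropositionalEquality using (_≡_; refl; cong; sym)
open import Function using (id; _∘_)

-- A monoidal signature is presented as the family Σ_{n,m} of symbols of
-- arity n and coarity m.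
module _ (Sig : ℕ → ℕ → Set) where

  infixr 7 _⊕_
  infixr 5 _⨾_

  data Term : ℕ → ℕ → Set where
    δ   : Term 1 2
    ε   : Term 1 0
    μ   : Term 2 1
    η   : Term 0 1
    id0 : Term 0 0
    id1 : Term 1 1
    σ   : Term 2 2
    gen : ∀ {n m} → Sig n m → Term n m
    _⨾_ : ∀ {n z m} → Term n z → Term z m → Term n m
    _⊕_ : ∀ {n m p q} → Term n m → Term p q → Term (n + p) (m + q)

  cast : ∀ {n m n' m'} → n ≡ n' → m ≡ m' → Term n m → Term n' m'
  cast refl refl c = c

  idₙ : ∀ n → Term n n
  idₙ zero    = id0
  idₙ (suc n) = id1 ⊕ idₙ n

  σ1 : ∀ n → Term (suc n) (n + 1)
  σ1 zero    = id1
  σ1 (suc n) = (σ ⊕ idₙ n) ⨾ (id1 ⊕ σ1 n)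

  σ1' : ∀ n → Term (n + 1) (suc n)
  σ1' zero    = id1
  σ1' (suc n) = (id1 ⊕ σ1' n) ⨾ (σ ⊕ idₙ n)

  σnm : ∀ n m → Term (n + m) (m + n)
  σnm zero    m = cast refl (sym (+-identityʳ m)) (idₙ m)
  σnm (suc n) m = cast refl (+-assoc m 1 n) ((id1 ⊕ σnm n m) ⨾ (σ1 m ⊕ idₙ n))

  δₙ : ∀ n → Term n (n + n)
  δₙ zero    = id0
  δₙ (suc n) = cast refl (cong suc (+-assoc n 1 n))
                 ((δ ⊕ δₙ n) ⨾ (id1 ⊕ σ1 n ⊕ idₙ n))

  εₙ : ∀ n → Term n 0
  εₙ zero    = id0
  εₙ (suc n) = ε ⊕ εₙ n

  μₙ : ∀ n → Term (n + n) n
  μₙ zero    = id0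
  μₙ (suc n) = cast (cong suc (+-assoc n 1 n)) refl
                 ((id1 ⊕ σ1' n ⊕ idₙ n) ⨾ (μ ⊕ μₙ n))

  ηₙ : ∀ n → Term 0 n
  ηₙ zero    = id0
  ηₙ (suc n) = η ⊕ ηₙ n

  -- The congruence generated by (E).  It is stated heterogeneously in the
  -- sorts (so that e.g. associativity of ⊕ needs no transport); all rules
  -- relate terms of (propositionally) equal sorts.

  infix 4 _≈_ _≤ₜ_

  data _≈_ : ∀ {n m n' m'} → Term n m → Term n' m' → Set where
    ≈-refl  : ∀ {n m} {c : Term n m} → c ≈ c
    ≈-sym   : ∀ {n m n' m'} {c : Term n m} {d : Term n' m'} → c ≈ d → d ≈ c
    ≈-trans : ∀ {n m n' m' n'' m''} {c : Term n m} {d : Term n' m'} {e : Term n'' m''}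
              → c ≈ d → d ≈ e → c ≈ e
    ⨾-cong  : ∀ {n z m n' z' m'} {c : Term n z} {c' : Term n' z'} {d : Term z m} {d' : Term z' m'}
              → c ≈ c' → d ≈ d' → (c ⨾ d) ≈ (c' ⨾ d')
    ⊕-cong  : ∀ {n m p q n' m' p' q'} {c : Term n m} {c' : Term n' m'} {d : Term p q} {d' : Term p' q'}
              → c ≈ c' → d ≈ d' → (c ⊕ d) ≈ (c' ⊕ d')
    ⨾-assoc : ∀ {n z w m} (c : Term n z) (d : Term z w) (e : Term w m)
              → ((c ⨾ d) ⨾ e) ≈ (c ⨾ (d ⨾ e))
    ⨾-idˡ   : ∀ {n m} (c : Term n m) → (idₙ n ⨾ c) ≈ c
    ⨾-idʳ   : ∀ {n m} (c : Term n m) → (c ⨾ idₙ m) ≈ c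
    ⊕-assoc : ∀ {n m p q r s} (c : Term n m) (d : Term p q) (e : Term r s)
              → ((c ⊕ d) ⊕ e) ≈ (c ⊕ (d ⊕ e))
    ⊕-idˡ   : ∀ {n m} (c : Term n m) → (id0 ⊕ c) ≈ c
    ⊕-idʳ   : ∀ {n m} (c : Term n m) → (c ⊕ id0) ≈ c
    interchange : ∀ {n z m p w q} (c : Term n z) (d : Term z m) (c' : Term p w) (d' : Term w q)
              → ((c ⨾ d) ⊕ (c' ⨾ d')) ≈ ((c ⊕ c') ⨾ (d ⊕ d'))
    σ-inv   : (σ ⨾ σ) ≈ idₙ 2
    σ-nat   : ∀ {n m p q} (c : Term n m) (d : Term p q)
              → ((c ⊕ d) ⨾ σnm m q) ≈ (σnm n p ⨾ (d ⊕ c))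
    δ-assoc : (δ ⨾ (δ ⊕ id1)) ≈ (δ ⨾ (id1 ⊕ δ))
    δ-unit  : (δ ⨾ (ε ⊕ id1)) ≈ id1
    δ-comm  : (δ ⨾ σ) ≈ δ
    μ-assoc : ((μ ⊕ id1) ⨾ μ) ≈ ((id1 ⊕ μ) ⨾ μ)
    μ-unit  : ((η ⊕ id1) ⨾ μ) ≈ id1
    μ-comm  : (σ ⨾ μ) ≈ μ
    frob₁   : ((δ ⊕ id1) ⨾ (id1 ⊕ μ)) ≈ (μ ⨾ δ)
    frob₂   : (μ ⨾ δ) ≈ ((id1 ⊕ δ) ⨾ (μ ⊕ id1))
    special : (δ ⨾ μ) ≈ id1

  data _≤ₜ_ : ∀ {n m n' m'} → Term n m → Term n' m' → Set where
    ≈⇒≤     : ∀ {n m n' m'} {c : Term n m} {d : Term n' m'} → c ≈ d → c ≤ₜ d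
    ≤-trans : ∀ {n m n' m' n'' m''} {c : Term n m} {d : Term n' m'} {e : Term n'' m''}
              → c ≤ₜ d → d ≤ₜ e → c ≤ₜ e
    ⨾-mono  : ∀ {n z m n' z' m'} {c : Term n z} {c' : Term n' z'} {d : Term z m} {d' : Term z' m'}
              → c ≤ₜ c' → d ≤ₜ d' → (c ⨾ d) ≤ₜ (c' ⨾ d')
    ⊕-mono  : ∀ {n m p q n' m' p' q'} {c : Term n m} {c' : Term n' m'} {d : Term p q} {d' : Term p' q'}
              → c ≤ₜ c' → d ≤ₜ d' → (c ⊕ d) ≤ₜ (c' ⊕ d')
    I-εη    : id1 ≤ₜ (ε ⨾ η)
    I-ηε    : (η ⨾ ε) ≤ₜ id0
    I-δμ    : id1 ≤ₜ (δ ⨾ μ)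
    I-μδ    : (μ ⨾ δ) ≤ₜ idₙ 2
    I-Rδ    : ∀ {n m} (R : Sig n m) → (gen R ⨾ δₙ m) ≤ₜ (δₙ n ⨾ (gen R ⊕ gen R))
    I-Rε    : ∀ {n m} (R : Sig n m) → (gen R ⨾ εₙ m) ≤ₜ εₙ n

  Edge : Set → Set
  Edge V = Σ[ n ∈ ℕ ] Σ[ m ∈ ℕ ] (Sig n m × Vec V n × Vec V m)

  mapEdge : ∀ {V W : Set} → (V → W) → Edge V → Edge W
  mapEdge f (n , m , r , s , t) = n , m , r , vmap f s , vmap f t

  record Hyp : Set where
    field
      nV   : ℕ
      nE   : ℕ
      edge : Fin nE → Edge (Fin nV)
  open Hyp public

  record HypHom (G H : Hyp) : Set where
    field
      fV   : Fin (nV G) → Fin (nV H)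
      fE   : Fin (nE G) → Fin (nE H)
      comm : ∀ e → edge H (fE e) ≡ mapEdge fV (edge G e)
  open HypHom public

  Factors : ∀ {G H K} → HypHom G H → HypHom H K → HypHom G K → Set
  Factors f u a = (∀ v → fV u (fV f v) ≡ fV a v) × (∀ e → fE u (fE f e) ≡ fE a e)

  disc : ℕ → Hyp
  disc k = record { nV = k ; nE = 0 ; edge = λ () }

  _⊎H_ : Hyp → Hyp → Hyp
  G ⊎H H = record
    { nV = nV G + nV H
    ; nE = nE G + nE H
    ; edge = λ k → [ mapEdge (_↑ˡ nV H) ∘ edge G , mapEdge (nV G ↑ʳ_) ∘ edge H ]′ (splitAt (nE G) k)
    }

  -- Cospans between finite ordinals (= discrete hypergraphs); a morphism
  -- from the discrete hypergraph n to G is just a function Fin n → Fin (nV G).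

  record Cospan (n m : ℕ) : Set where
    field
      apex : Hyp
      inl  : Fin n → Fin (nV apex)
      inr  : Fin m → Fin (nV apex)
  open Cospan public

  record CospanMor {n m} (c d : Cospan n m) : Set where
    field
      hom  : HypHom (apex c) (apex d)
      inlC : ∀ k → fV hom (inl c k) ≡ inl d k
      inrC : ∀ k → fV hom (inr c k) ≡ inr d k
  open CospanMor public

  infix 4 _≅C_ _≲_

  -- isomorphism of cospans (arrows of DiscCospan are the iso classes)
  record _≅C_ {n m} (c d : Cospan n m) : Set where
    field
      to    : CospanMor c d
      from  : CospanMor d c
      fromtoV : ∀ v → fV (hom from) (fV (hom to) v) ≡ v
      fromtoE : ∀ e → fE (hom from) (fE (hom to) e) ≡ e
      tofromV : ∀ v → fV (hom to) (fV (hom from) v) ≡ v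
      tofromE : ∀ e → fE (hom to) (fE (hom from) e) ≡ e

  _≲_ : ∀ {n m} → Cospan n m → Cospan n m → Set
  c ≲ d = CospanMor d c

  record IsComposite {n z m} (c : Cospan n z) (d : Cospan z m) (r : Cospan n m) : Set where
    field
      i    : HypHom (apex c) (apex r)
      j    : HypHom (apex d) (apex r)
      glue : ∀ k → fV i (inr c k) ≡ fV j (inl d k)
      legˡ : ∀ k → inl r k ≡ fV i (inl c k)
      legʳ : ∀ k → inr r k ≡ fV j (inr d k)
      univ : ∀ (Q : Hyp) (a : HypHom (apex c) Q) (b : HypHom (apex d) Q)
             → (∀ k → fV a (inr c k) ≡ fV b (inl d k))
             → Σ[ u ∈ HypHom (apex r) Q ] (Factors i u a × Factors j u b)
      uniq : ∀ (Q : Hyp) (u u' : HypHom (apex r) Q)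
             → (∀ v → fV u (fV i v) ≡ fV u' (fV i v)) → (∀ e → fE u (fE i e) ≡ fE u' (fE i e))
             → (∀ v → fV u (fV j v) ≡ fV u' (fV j v)) → (∀ e → fE u (fE j e) ≡ fE u' (fE j e))
             → (∀ v → fV u v ≡ fV u' v) × (∀ e → fE u e ≡ fE u' e)

  infixr 7 _⊞_
  _⊞_ : ∀ {n m p q} → Cospan n m → Cospan p q → Cospan (n + p) (m + q)
  _⊞_ {n} {m} c d = record
    { apex = apex c ⊎H apex d
    ; inl  = λ k → [ (_↑ˡ nV (apex d)) ∘ inl c , (nV (apex c) ↑ʳ_) ∘ inl d ]′ (splitAt n k)
    ; inr  = λ k → [ (_↑ˡ nV (apex d)) ∘ inr c , (nV (apex c) ↑ʳ_) ∘ inr d ]′ (splitAt m k)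
    }

  idC : ∀ n → Cospan n n
  idC n = record { apex = disc n ; inl = id ; inr = id }

  swapC : ∀ n m → Cospan (n + m) (m + n)
  swapC n m = record
    { apex = disc (m + n)
    ; inl  = λ k → [ (m ↑ʳ_) , (_↑ˡ n) ]′ (splitAt n k)
    ; inr  = id
    }

  μC : ∀ n → Cospan (n + n) n
  μC n = record { apex = disc n ; inl = λ k → [ id , id ]′ (splitAt n k) ; inr = id }

  ηC : ∀ n → Cospan 0 n
  ηC n = record { apex = disc n ; inl = λ () ; inr = id }

  δC : ∀ n → Cospan n (n + n)
  δC n = record { apex = disc n ; inl = id ; inr = λ k → [ id , id ]′ (splitAt n k) }

  εC : ∀ n → Cospan n 0
  εC n = record { apex = disc n ; inl = id ; inr = λ () }

  -- An isomorphism of preordered cartesian bicategories (identity on objects)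
  -- between CB≤_Σ (arrows: terms mod ≈, order ≤ₜ) and DiscCospan(Hyp_Σ)
  -- (arrows: cospans mod ≅C, order ≲).

  record CBIso : Set where
    field
      F : ∀ {n m} → Term n m → Cospan n m
      G : ∀ {n m} → Cospan n m → Term n m
      F-cong : ∀ {n m} {c d : Term n m} → c ≈ d → F c ≅C F d
      F-mono : ∀ {n m} {c d : Term n m} → c ≤ₜ d → F c ≲ F d
      G-cong : ∀ {n m} {a b : Cospan n m} → a ≅C b → G a ≈ G b
      G-mono : ∀ {n m} {a b : Cospan n m} → a ≲ b → G a ≤ₜ G b
      GF : ∀ {n m} (c : Term n m) → G (F c) ≈ c
      FG : ∀ {n m} (a : Cospan n m) → F (G a) ≅C a
      F-id   : ∀ n → F (idₙ n) ≅C idC n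
      F-comp : ∀ {n z m} (c : Term n z) (d : Term z m) → IsComposite (F c) (F d) (F (c ⨾ d))
      F-⊕    : ∀ {n m p q} (c : Term n m) (d : Term p q) → F (c ⊕ d) ≅C (F c ⊞ F d)
      F-σ    : ∀ n m → F (σnm n m) ≅C swapC n m
      F-μ : ∀ n → F (μₙ n) ≅C μC n
      F-η : ∀ n → F (ηₙ n) ≅C ηC n
      F-δ : ∀ n → F (δₙ n) ≅C δC n
      F-ε : ∀ n → F (εₙ n) ≅C εC n

{-# OPTIONS --safe #-}
module Submission where

-- A function f : a → b is realised by a term ⟦ f ⟧ built from μ, η and σ, and its converse by a term
-- ⟦ f ⟧° built from δ, ε and σ.  Both assignments are functorial, and Frobenius with speciality gives
-- the Beck-Chevalley law ⟦ f ⟧° ⨾ ⟦ g ⟧ ≈ ⟦ p ⟧ ⨾ ⟦ q ⟧° for pushout squares, by merging one pair of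
-- vertices at a time.  States 0 → v form a commutative monoid under pointwise multiplication, so the
-- edges of a hypergraph on v vertices multiply to a state s independently of their order, and a cospan
-- with legs l and r reads back as ⟦ l ⟧ ⨾ M s ⨾ ⟦ r ⟧°, where M multiplies by s.  Beck-Chevalley turns
-- pushouts of cospans into composites of these normal forms, so every term equals its normal form.
-- The inequalities give s ≤ s ∗ s, s ≤ 1 and ⟦ h ⟧ ⨾ ⟦ h ⟧° ≤ id, which makes reading
-- back antitone in homomorphisms of hypergraphs.

open import Defs hiding (_≈_; _≤ₜ_)
open import Algebra.Bundles using (CommutativeMonoid)
open import Data.Nat using (ℕ; zero; suc; _+_)
open import Data.Nat.Properties using (+-assoc; +-identityʳ)
open import Data.Fin using (Fin; zero; suc; _↑ˡ_; _↑ʳ_; splitAt; toℕ; lift; punchIn) renaming (cast to castᶠ)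
open import Data.Fin.Permutation
  using (Permutation; permutation; _⟨$⟩ʳ_; _⟨$⟩ˡ_; remove; punchIn-permute)
open import Data.Fin.Properties
  using (toℕ-injective; toℕ-cast; toℕ-↑ˡ; toℕ-↑ʳ; cast-is-id;
         splitAt-↑ˡ; splitAt-↑ʳ; splitAt⁻¹-↑ˡ; splitAt⁻¹-↑ʳ)
open import Data.Product using (_×_; _,_; proj₁; proj₂; Σ-syntax)
open import Data.Sum using ([_,_]′; inj₁; inj₂)
open import Data.Vec using (lookup; tabulate)
open import Data.Vec.Properties
  using (lookup-map; lookup∘tabulate; map-∘; map-cong; map-id; tabulate-∘; tabulate-cong; tabulate∘lookup)
open import Function using (id; _∘_; flip)
open import Relation.Binary.PropositionalEquality
  using (_≡_; _≗_; refl; cong; cong₂; sym; trans; subst; subst₂)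

-- Functions between finite ordinals

-- On the side of terms the obstacle is coherence: sorts such as `(n + p) + r` and `n + (p + r)`
-- differ, and symmetries are iterated crossings. The judgements `c ↦ f` and `c ↤ f` reduce this to
-- arithmetic on `Fin`, and each derivation serves twice: it determines `c` up to `≈` (`↦-sound`,
-- `↤-sound`) and its cospan up to isomorphism (`↦-interp`, `↤-interp`). Most laws of converses are
-- images under `op` of laws of functions over `flip Sig`. On the side of cospans the obstacle is
-- that `compose` chooses a coequalizer whose elements have no convenient description. Composites
-- are therefore compared through their universal property; only closed one-vertex cases are
-- evaluated. A symbol becomes a state by bending its inputs round to the outputs, which Frobenius
-- permits and the snake equation undoes. Without inputs it has no position in a composite any more;
-- what remains is its attachment to vertices. Mutual inequality is weaker than `≈`, so invariance
-- of the readback under isomorphism does not follow from monotonicity; bijections get an argument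
-- of their own.

copair : ∀ {a c b} → (Fin a → Fin b) → (Fin c → Fin b) → Fin (a + c) → Fin b
copair {a} f g k = [ f , g ]′ (splitAt a k)

infixr 7 _⊎ᶠ_
_⊎ᶠ_ : ∀ {a b c d} → (Fin a → Fin b) → (Fin c → Fin d) → Fin (a + c) → Fin (b + d)
_⊎ᶠ_ {b = b} {d = d} f g = copair ((_↑ˡ d) ∘ f) ((b ↑ʳ_) ∘ g)

copair-suc : ∀ {a c b} (f : Fin (suc a) → Fin b) (g : Fin c → Fin b) → copair f g ∘ suc ≗ copair (f ∘ suc) g
copair-suc {a} f g k with splitAt a k
... | inj₁ _ = refl
... | inj₂ _ = refl

-- Equational calculus of terms and the canonical term of a function

module Wiring (Sig : ℕ → ℕ → Set) where

  infix 4 _≈_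
  _≈_ : ∀ {n m n' m'} → Term Sig n m → Term Sig n' m' → Set
  _≈_ = Defs._≈_ Sig

  infixr 2 _≈⟨_⟩_ _≈⟨_⟨_
  infix  3 _∎
  _≈⟨_⟩_ : ∀ {n m n' m' n'' m''} (c : Term Sig n m) {d : Term Sig n' m'} {e : Term Sig n'' m''}
         → c ≈ d → d ≈ e → c ≈ e
  c ≈⟨ p ⟩ q = ≈-trans p q

  _≈⟨_⟨_ : ∀ {n m n' m' n'' m''} (c : Term Sig n m) {d : Term Sig n' m'} {e : Term Sig n'' m''}
         → d ≈ c → d ≈ e → c ≈ e
  c ≈⟨ p ⟨ q = ≈-trans (≈-sym p) q

  _∎ : ∀ {n m} (c : Term Sig n m) → c ≈ c
  c ∎ = ≈-refl

  ≡⇒≈ : ∀ {n m} {c d : Term Sig n m} → c ≡ d → c ≈ d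
  ≡⇒≈ refl = ≈-refl

  cast-≈ : ∀ {n m n' m'} (p : n ≡ n') (q : m ≡ m') (c : Term Sig n m) → cast Sig p q c ≈ c
  cast-≈ refl refl c = ≈-refl

  𝟙 : ∀ n → Term Sig n n
  𝟙 = idₙ Sig

  infixr 6 _⨾⟨_
  _⨾⟨_ : ∀ {n z m m'} (c : Term Sig n z) {d : Term Sig z m} {d' : Term Sig z m'} → d ≈ d' → (c ⨾ d) ≈ (c ⨾ d')
  c ⨾⟨ p = ⨾-cong ≈-refl p

  infixr 8 1⊕_
  1⊕_ : ∀ {n m} → Term Sig n m → Term Sig (suc n) (suc m)
  1⊕ c = id1 ⊕ c

  1⊕-cong : ∀ {n m n' m'} {c : Term Sig n m} {d : Term Sig n' m'} → c ≈ d → (1⊕ c) ≈ (1⊕ d)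
  1⊕-cong = ⊕-cong ≈-refl

  pull : ∀ {n z w m} {a : Term Sig n z} {b : Term Sig z w} {c : Term Sig n w} → (a ⨾ b) ≈ c
       → (x : Term Sig w m) → (a ⨾ (b ⨾ x)) ≈ (c ⨾ x)
  pull p x = ≈-trans (≈-sym (⨾-assoc _ _ _)) (⨾-cong p ≈-refl)

  push : ∀ {n z w m} {a : Term Sig n z} {b : Term Sig z w} {c : Term Sig n w} → c ≈ (a ⨾ b)
       → (x : Term Sig w m) → (c ⨾ x) ≈ (a ⨾ (b ⨾ x))
  push p x = ≈-sym (pull (≈-sym p) x)

  extend : ∀ {n z w z' m} {a : Term Sig n z} {b : Term Sig z w} {c : Term Sig n z'} {d : Term Sig z' w}
         → (a ⨾ b) ≈ (c ⨾ d) → (x : Term Sig w m) → (a ⨾ (b ⨾ x)) ≈ (c ⨾ (d ⨾ x))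
  extend p x = ≈-trans (pull p x) (⨾-assoc _ _ _)

  𝟙1 : 𝟙 1 ≈ id1 {Sig}
  𝟙1 = ⊕-idʳ id1

  id1-idˡ : ∀ {m} (c : Term Sig 1 m) → (id1 ⨾ c) ≈ c
  id1-idˡ c = ≈-trans (⨾-cong (≈-sym 𝟙1) ≈-refl) (⨾-idˡ c)

  id1-idʳ : ∀ {n} (c : Term Sig n 1) → (c ⨾ id1) ≈ c
  id1-idʳ c = ≈-trans (⨾-cong ≈-refl (≈-sym 𝟙1)) (⨾-idʳ c)

  1⊕-⨾ : ∀ {n z m} (c : Term Sig n z) (d : Term Sig z m) → (1⊕ (c ⨾ d)) ≈ (1⊕ c ⨾ 1⊕ d)
  1⊕-⨾ c d = ≈-trans (⊕-cong (≈-sym (id1-idˡ id1)) ≈-refl) (interchange id1 id1 c d)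

  ⊕𝟙-⨾ : ∀ {n z m} (c : Term Sig n z) (d : Term Sig z m) (b : ℕ) → ((c ⨾ d) ⊕ 𝟙 b) ≈ ((c ⊕ 𝟙 b) ⨾ (d ⊕ 𝟙 b))
  ⊕𝟙-⨾ c d b = ≈-trans (⊕-cong ≈-refl (≈-sym (⨾-idˡ (𝟙 b)))) (interchange c d (𝟙 b) (𝟙 b))

  𝟙⊕-⨾ : ∀ {n z m} (b : ℕ) (c : Term Sig n z) (d : Term Sig z m) → (𝟙 b ⊕ (c ⨾ d)) ≈ ((𝟙 b ⊕ c) ⨾ (𝟙 b ⊕ d))
  𝟙⊕-⨾ b c d = ≈-trans (⊕-cong (≈-sym (⨾-idˡ (𝟙 b))) ≈-refl) (interchange (𝟙 b) (𝟙 b) c d)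

  𝟙-⊕ : ∀ a b → (𝟙 a ⊕ 𝟙 b) ≈ 𝟙 (a + b)
  𝟙-⊕ zero    b = ⊕-idˡ (𝟙 b)
  𝟙-⊕ (suc a) b = ≈-trans (⊕-assoc id1 (𝟙 a) (𝟙 b)) (1⊕-cong (𝟙-⊕ a b))

  split₁ : ∀ {n m p q} (c : Term Sig n m) (d : Term Sig p q) → ((c ⊕ 𝟙 p) ⨾ (𝟙 m ⊕ d)) ≈ (c ⊕ d)
  split₁ c d = ≈-trans (≈-sym (interchange c (𝟙 _) (𝟙 _) d)) (⊕-cong (⨾-idʳ c) (⨾-idˡ d))

  split₂ : ∀ {n m p q} (c : Term Sig n m) (d : Term Sig p q) → ((𝟙 n ⊕ d) ⨾ (c ⊕ 𝟙 q)) ≈ (c ⊕ d)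
  split₂ c d = ≈-trans (≈-sym (interchange (𝟙 _) c d (𝟙 _))) (⊕-cong (⨾-idˡ c) (⨾-idʳ d))

  ⨾-η⊕ : ∀ {p q} (d : Term Sig p q) → (d ⨾ (η ⊕ 𝟙 q)) ≈ (η ⊕ d)
  ⨾-η⊕ d = ≈-trans (⨾-cong (≈-sym (⊕-idˡ d)) ≈-refl) (split₂ η d)

  infixr 8 _▷_
  -- Recursion on `k` nests the wires as `1⊕ (1⊕ d)`, whereas `𝟙 k ⊕ d` unfolds to
  -- `(id1 ⊕ 𝟙 _) ⊕ d`. For a concrete `k`, `slide` thus produces exactly the shape that the
  -- recursive clauses of `J` and `K` have.
  _▷_ : ∀ k {p q} → Term Sig p q → Term Sig (k + p) (k + q)
  zero  ▷ d = d
  suc k ▷ d = 1⊕ (k ▷ d)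

  ▷-𝟙⊕ : ∀ k {p q} (d : Term Sig p q) → (k ▷ d) ≈ (𝟙 k ⊕ d)
  ▷-𝟙⊕ zero    d = ≈-sym (⊕-idˡ d)
  ▷-𝟙⊕ (suc k) d = ≈-trans (1⊕-cong (▷-𝟙⊕ k d)) (≈-sym (⊕-assoc id1 (𝟙 k) d))

  slide : ∀ {n m p q} (x : Term Sig n m) (d : Term Sig p q) → ((x ⊕ 𝟙 p) ⨾ (m ▷ d)) ≈ ((n ▷ d) ⨾ (x ⊕ 𝟙 q))
  slide {n} {m} x d =
    ≈-trans (⨾-cong ≈-refl (▷-𝟙⊕ m d)) (≈-trans (split₁ x d)
      (≈-sym (≈-trans (⨾-cong (▷-𝟙⊕ n d) ≈-refl) (split₂ x d))))

  -- Symmetries on two and three wires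

  Σσ : ∀ n m → Term Sig (n + m) (m + n)
  Σσ = σnm Sig

  σ1-1 : σ1 Sig 1 ≈ σ {Sig}
  σ1-1 = (σ ⊕ id0) ⨾ (id1 ⊕ id1)  ≈⟨ ⨾-cong (⊕-idʳ σ) (1⊕-cong (≈-sym 𝟙1)) ⟩
         σ ⨾ 𝟙 2                  ≈⟨ ⨾-idʳ σ ⟩
         σ ∎

  Σσ-1m : ∀ m → Σσ 1 m ≈ σ1 Sig m
  Σσ-1m m = Σσ 1 m                                      ≈⟨ cast-≈ refl (+-assoc m 1 0) _ ⟩
            (id1 ⊕ Σσ 0 m) ⨾ (σ1 Sig m ⊕ id0)           ≈⟨ ⨾-cong
                (1⊕-cong (cast-≈ refl (sym (+-identityʳ m)) (𝟙 m))) (⊕-idʳ _) ⟩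
            𝟙 (suc m) ⨾ σ1 Sig m                        ≈⟨ ⨾-idˡ _ ⟩
            σ1 Sig m ∎

  Σσ-11 : Σσ 1 1 ≈ σ {Sig}
  Σσ-11 = ≈-trans (Σσ-1m 1) σ1-1

  Σσ-12 : Σσ 1 2 ≈ ((σ ⊕ id1) ⨾ (id1 ⊕ σ))
  Σσ-12 = ≈-trans (Σσ-1m 2) (⨾-cong (⊕-cong ≈-refl 𝟙1) (1⊕-cong σ1-1))

  Σσ-21 : Σσ 2 1 ≈ ((id1 ⊕ σ) ⨾ (σ ⊕ id1))
  Σσ-21 = ≈-trans (cast-≈ refl (+-assoc 1 1 1) _) (⨾-cong (1⊕-cong Σσ-11) (⊕-cong σ1-1 𝟙1))

  Σσ-01 : Σσ 0 1 ≈ id1 {Sig}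
  Σσ-01 = ≈-trans (cast-≈ refl (sym (+-identityʳ 1)) (𝟙 1)) 𝟙1

  Σσ-10 : Σσ 1 0 ≈ id1 {Sig}
  Σσ-10 = Σσ-1m 0

  -- The relations from here to `δ⊕1-σσ` are all `σ-nat` with a generator and `id1` as arguments,
  -- read through the expansions of `Σσ` on small sorts; `yang-baxter` is the instance where the
  -- generator is `σ` itself.
  η⊕1-σ : ((η ⊕ id1) ⨾ σ) ≈ (id1 {Sig} ⊕ η)
  η⊕1-σ = (η ⊕ id1) ⨾ σ          ≈⟨ ⨾-cong ≈-refl (≈-sym Σσ-11) ⟩
          (η ⊕ id1) ⨾ Σσ 1 1     ≈⟨ σ-nat η id1 ⟩
          Σσ 0 1 ⨾ (id1 ⊕ η)     ≈⟨ ⨾-cong Σσ-01 ≈-refl ⟩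
          id1 ⨾ (id1 ⊕ η)        ≈⟨ id1-idˡ _ ⟩
          id1 ⊕ η ∎

  1⊕η-σ : ((id1 ⊕ η) ⨾ σ) ≈ (η {Sig} ⊕ id1)
  1⊕η-σ = (id1 ⊕ η) ⨾ σ          ≈⟨ ⨾-cong ≈-refl (≈-sym Σσ-11) ⟩
          (id1 ⊕ η) ⨾ Σσ 1 1     ≈⟨ σ-nat id1 η ⟩
          Σσ 1 0 ⨾ (η ⊕ id1)     ≈⟨ ⨾-cong Σσ-10 ≈-refl ⟩
          id1 ⨾ (η ⊕ id1)        ≈⟨ id1-idˡ _ ⟩
          η ⊕ id1 ∎

  yang-baxter : ((σ ⊕ id1) ⨾ ((id1 ⊕ σ) ⨾ (σ ⊕ id1))) ≈ ((id1 {Sig} ⊕ σ) ⨾ ((σ ⊕ id1) ⨾ (id1 ⊕ σ)))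
  yang-baxter =
    (σ ⊕ id1) ⨾ ((id1 ⊕ σ) ⨾ (σ ⊕ id1))  ≈⟨ ⨾-cong ≈-refl (≈-sym Σσ-21) ⟩
    (σ ⊕ id1) ⨾ Σσ 2 1                    ≈⟨ σ-nat σ id1 ⟩
    Σσ 2 1 ⨾ (id1 ⊕ σ)                    ≈⟨ ⨾-cong Σσ-21 ≈-refl ⟩
    ((id1 ⊕ σ) ⨾ (σ ⊕ id1)) ⨾ (id1 ⊕ σ)   ≈⟨ ⨾-assoc _ _ _ ⟩
    (id1 ⊕ σ) ⨾ ((σ ⊕ id1) ⨾ (id1 ⊕ σ)) ∎

  μ⊕1-σ : ((μ ⊕ id1) ⨾ σ) ≈ ((id1 {Sig} ⊕ σ) ⨾ ((σ ⊕ id1) ⨾ (id1 ⊕ μ)))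
  μ⊕1-σ = (μ ⊕ id1) ⨾ σ                          ≈⟨ ⨾-cong ≈-refl (≈-sym Σσ-11) ⟩
          (μ ⊕ id1) ⨾ Σσ 1 1                     ≈⟨ σ-nat μ id1 ⟩
          Σσ 2 1 ⨾ (id1 ⊕ μ)                     ≈⟨ ⨾-cong Σσ-21 ≈-refl ⟩
          ((id1 ⊕ σ) ⨾ (σ ⊕ id1)) ⨾ (id1 ⊕ μ)    ≈⟨ ⨾-assoc _ _ _ ⟩
          (id1 ⊕ σ) ⨾ ((σ ⊕ id1) ⨾ (id1 ⊕ μ)) ∎

  1⊕μ-σ : ((id1 ⊕ μ) ⨾ σ) ≈ ((σ {Sig} ⊕ id1) ⨾ ((id1 ⊕ σ) ⨾ (μ ⊕ id1)))
  1⊕μ-σ = (id1 ⊕ μ) ⨾ σ                          ≈⟨ ⨾-cong ≈-refl (≈-sym Σσ-11) ⟩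
          (id1 ⊕ μ) ⨾ Σσ 1 1                     ≈⟨ σ-nat id1 μ ⟩
          Σσ 1 2 ⨾ (μ ⊕ id1)                     ≈⟨ ⨾-cong Σσ-12 ≈-refl ⟩
          ((σ ⊕ id1) ⨾ (id1 ⊕ σ)) ⨾ (μ ⊕ id1)    ≈⟨ ⨾-assoc _ _ _ ⟩
          (σ ⊕ id1) ⨾ ((id1 ⊕ σ) ⨾ (μ ⊕ id1)) ∎

  δ⊕1-σσ : ((δ ⊕ id1) ⨾ ((id1 ⊕ σ) ⨾ (σ ⊕ id1))) ≈ (σ {Sig} ⨾ (id1 ⊕ δ))
  δ⊕1-σσ = (δ ⊕ id1) ⨾ ((id1 ⊕ σ) ⨾ (σ ⊕ id1))  ≈⟨ ⨾-cong ≈-refl (≈-sym Σσ-21) ⟩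
           (δ ⊕ id1) ⨾ Σσ 2 1                    ≈⟨ σ-nat δ id1 ⟩
           Σσ 1 1 ⨾ (id1 ⊕ δ)                    ≈⟨ ⨾-cong Σσ-11 ≈-refl ⟩
           σ ⨾ (id1 ⊕ δ) ∎

  -- The same relations next to b further wires

  front₃ : ∀ {n z w m b} (x : Term Sig n z) (y : Term Sig z w) (v : Term Sig w m)
         → ((x ⨾ (y ⨾ v)) ⊕ 𝟙 b) ≈ ((x ⊕ 𝟙 b) ⨾ ((y ⊕ 𝟙 b) ⨾ (v ⊕ 𝟙 b)))
  front₃ x y v = ≈-trans (⊕𝟙-⨾ x (y ⨾ v) _) (⨾-cong ≈-refl (⊕𝟙-⨾ y v _))

  tail₁ : ∀ {n m} (x : Term Sig n m) b → ((id1 ⊕ x) ⊕ 𝟙 b) ≈ (1⊕ (x ⊕ 𝟙 b))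
  tail₁ x b = ⊕-assoc id1 x (𝟙 b)

  tail₂ : ∀ {n m} (x : Term Sig n m) b → ((x ⊕ id1) ⊕ 𝟙 b) ≈ (x ⊕ 𝟙 (suc b))
  tail₂ x b = ⊕-assoc x id1 (𝟙 b)

  module _ (b : ℕ) where

    σσ-id : ((σ ⊕ 𝟙 b) ⨾ (σ ⊕ 𝟙 b)) ≈ 𝟙 (suc (suc b))
    σσ-id = ≈-trans (≈-sym (⊕𝟙-⨾ σ σ b)) (≈-trans (⊕-cong σ-inv ≈-refl) (𝟙-⊕ 2 b))

    yang-baxter-⊕ : ((σ ⊕ 𝟙 (suc b)) ⨾ (1⊕ (σ ⊕ 𝟙 b) ⨾ (σ ⊕ 𝟙 (suc b))))
                  ≈ (1⊕ (σ ⊕ 𝟙 b) ⨾ ((σ ⊕ 𝟙 (suc b)) ⨾ 1⊕ (σ ⊕ 𝟙 b)))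
    yang-baxter-⊕ =
      ≈-trans (⨾-cong (≈-sym (tail₂ σ b)) (⨾-cong (≈-sym (tail₁ σ b)) (≈-sym (tail₂ σ b))))
      (≈-trans (≈-sym (front₃ _ _ _)) (≈-trans (⊕-cong yang-baxter ≈-refl) (≈-trans (front₃ _ _ _)
        (⨾-cong (tail₁ σ b) (⨾-cong (tail₂ σ b) (tail₁ σ b))))))

    1⊕μ-σ-⊕ : (1⊕ (μ ⊕ 𝟙 b) ⨾ (σ ⊕ 𝟙 b)) ≈ ((σ ⊕ 𝟙 (suc b)) ⨾ (1⊕ (σ ⊕ 𝟙 b) ⨾ (μ ⊕ 𝟙 (suc b))))
    1⊕μ-σ-⊕ =
      ≈-trans (⨾-cong (≈-sym (tail₁ μ b)) ≈-refl)
      (≈-trans (≈-sym (⊕𝟙-⨾ _ _ b)) (≈-trans (⊕-cong 1⊕μ-σ ≈-refl) (≈-trans (front₃ _ _ _)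
        (⨾-cong (tail₂ σ b) (⨾-cong (tail₁ σ b) (tail₂ μ b))))))

    μ⊕1-σ-⊕ : ((μ ⊕ 𝟙 (suc b)) ⨾ (σ ⊕ 𝟙 b)) ≈ (1⊕ (σ ⊕ 𝟙 b) ⨾ ((σ ⊕ 𝟙 (suc b)) ⨾ 1⊕ (μ ⊕ 𝟙 b)))
    μ⊕1-σ-⊕ =
      ≈-trans (⨾-cong (≈-sym (tail₂ μ b)) ≈-refl)
      (≈-trans (≈-sym (⊕𝟙-⨾ _ _ b)) (≈-trans (⊕-cong μ⊕1-σ ≈-refl) (≈-trans (front₃ _ _ _)
        (⨾-cong (tail₁ σ b) (⨾-cong (tail₂ σ b) (tail₁ μ b))))))

    δ⊕1-σσ-⊕ : ((δ ⊕ 𝟙 (suc b)) ⨾ (1⊕ (σ ⊕ 𝟙 b) ⨾ (σ ⊕ 𝟙 (suc b)))) ≈ ((σ ⊕ 𝟙 b) ⨾ 1⊕ (δ ⊕ 𝟙 b))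
    δ⊕1-σσ-⊕ =
      ≈-trans (⨾-cong (≈-sym (tail₂ δ b)) (⨾-cong (≈-sym (tail₁ σ b)) (≈-sym (tail₂ σ b))))
      (≈-trans (≈-sym (front₃ _ _ _)) (≈-trans (⊕-cong δ⊕1-σσ ≈-refl) (≈-trans (⊕𝟙-⨾ _ _ b)
        (⨾-cong ≈-refl (tail₁ δ b)))))

    μ-assoc-⊕ : (1⊕ (μ ⊕ 𝟙 b) ⨾ (μ ⊕ 𝟙 b)) ≈ ((μ ⊕ 𝟙 (suc b)) ⨾ (μ ⊕ 𝟙 b))
    μ-assoc-⊕ =
      ≈-trans (⨾-cong (≈-sym (tail₁ μ b)) ≈-refl)
      (≈-trans (≈-sym (⊕𝟙-⨾ _ _ b)) (≈-trans (⊕-cong (≈-sym μ-assoc) ≈-refl) (≈-trans (⊕𝟙-⨾ _ _ b)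
        (⨾-cong (tail₂ μ b) ≈-refl))))

    μ-comm-⊕ : ((σ ⊕ 𝟙 b) ⨾ (μ ⊕ 𝟙 b)) ≈ (μ ⊕ 𝟙 b)
    μ-comm-⊕ = ≈-trans (≈-sym (⊕𝟙-⨾ _ _ b)) (⊕-cong μ-comm ≈-refl)

    μ-unit-⊕ : ((η ⊕ 𝟙 (suc b)) ⨾ (μ ⊕ 𝟙 b)) ≈ 𝟙 (suc b)
    μ-unit-⊕ = ≈-trans (⨾-cong (≈-sym (tail₂ η b)) ≈-refl)
               (≈-trans (≈-sym (⊕𝟙-⨾ _ _ b)) (⊕-cong μ-unit ≈-refl))

    η⊕1-σ-⊕ : ((η ⊕ 𝟙 (suc b)) ⨾ (σ ⊕ 𝟙 b)) ≈ (1⊕ (η ⊕ 𝟙 b))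
    η⊕1-σ-⊕ = ≈-trans (⨾-cong (≈-sym (tail₂ η b)) ≈-refl)
               (≈-trans (≈-sym (⊕𝟙-⨾ _ _ b)) (≈-trans (⊕-cong η⊕1-σ ≈-refl) (tail₁ η b)))

    1⊕η-σ-⊕ : (1⊕ (η ⊕ 𝟙 b) ⨾ (σ ⊕ 𝟙 b)) ≈ (η ⊕ 𝟙 (suc b))
    1⊕η-σ-⊕ = ≈-trans (⨾-cong (≈-sym η⊕1-σ-⊕) ≈-refl) (≈-trans (⨾-assoc _ _ _)
                (≈-trans (⨾-cong ≈-refl σσ-id) (⨾-idʳ _)))

  -- J i merges a new first wire into wire i.

  J : ∀ {b} → Fin b → Term Sig (suc b) b
  J {suc b} zero    = μ ⊕ 𝟙 b
  J {suc b} (suc i) = (σ ⊕ 𝟙 b) ⨾ 1⊕ (J i)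

  J-unit : ∀ {b} (i : Fin b) → ((η ⊕ 𝟙 b) ⨾ J i) ≈ 𝟙 b
  J-unit {suc b} zero    = μ-unit-⊕ b
  J-unit {suc b} (suc i) =
    (η ⊕ 𝟙 (suc b)) ⨾ ((σ ⊕ 𝟙 b) ⨾ 1⊕ (J i))   ≈⟨ pull (η⊕1-σ-⊕ b) _ ⟩
    1⊕ (η ⊕ 𝟙 b) ⨾ 1⊕ (J i)                    ≈⟨ 1⊕-⨾ _ _ ⟨
    1⊕ ((η ⊕ 𝟙 b) ⨾ J i)                       ≈⟨ 1⊕-cong (J-unit i) ⟩
    𝟙 (suc b) ∎

  -- Two fresh wires bound for the same wire may be merged with each other beforehand: `μ⊕1-σ-⊕`
  -- lets the merged pair cross wire 0 once instead of twice.
  J-assoc : ∀ {b} (i : Fin b) → (1⊕ (J i) ⨾ J i) ≈ ((μ ⊕ 𝟙 b) ⨾ J i)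
  J-assoc {suc b} zero    = μ-assoc-⊕ b
  J-assoc {suc b} (suc i) =
    1⊕ ((σ ⊕ 𝟙 b) ⨾ 1⊕ (J i)) ⨾ ((σ ⊕ 𝟙 b) ⨾ 1⊕ (J i))
      ≈⟨ push (1⊕-⨾ _ _) _ ⟩
    1⊕ (σ ⊕ 𝟙 b) ⨾ (2 ▷ J i ⨾ ((σ ⊕ 𝟙 b) ⨾ 1⊕ (J i)))
      ≈⟨ _ ⨾⟨ extend (≈-sym (slide σ (J i))) _ ⟩
    1⊕ (σ ⊕ 𝟙 b) ⨾ ((σ ⊕ 𝟙 (suc b)) ⨾ (2 ▷ J i ⨾ 1⊕ (J i)))
      ≈⟨ _ ⨾⟨ (_ ⨾⟨ ≈-trans (≈-sym (1⊕-⨾ _ _)) (≈-trans (1⊕-cong (J-assoc i)) (1⊕-⨾ _ _))) ⟩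
    1⊕ (σ ⊕ 𝟙 b) ⨾ ((σ ⊕ 𝟙 (suc b)) ⨾ (1⊕ (μ ⊕ 𝟙 b) ⨾ 1⊕ (J i)))
      ≈⟨ ≈-trans (_ ⨾⟨ ≈-sym (⨾-assoc _ _ _)) (pull (≈-sym (μ⊕1-σ-⊕ b)) _) ⟩
    ((μ ⊕ 𝟙 (suc b)) ⨾ (σ ⊕ 𝟙 b)) ⨾ 1⊕ (J i)
      ≈⟨ ⨾-assoc _ _ _ ⟩
    (μ ⊕ 𝟙 (suc b)) ⨾ ((σ ⊕ 𝟙 b) ⨾ 1⊕ (J i)) ∎

  private
    J-comm-0s : ∀ {b} (j : Fin b) → (1⊕ (J {suc b} zero) ⨾ J (suc j)) ≈
        ((σ ⊕ 𝟙 (suc b)) ⨾ (1⊕ (J (suc j)) ⨾ J zero))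
    J-comm-0s {b} j =
      1⊕ (μ ⊕ 𝟙 b) ⨾ ((σ ⊕ 𝟙 b) ⨾ 1⊕ (J j))
        ≈⟨ pull (1⊕μ-σ-⊕ b) _ ⟩
      ((σ ⊕ 𝟙 (suc b)) ⨾ (1⊕ (σ ⊕ 𝟙 b) ⨾ (μ ⊕ 𝟙 (suc b)))) ⨾ 1⊕ (J j)
        ≈⟨ ≈-trans (⨾-assoc _ _ _) (_ ⨾⟨ ⨾-assoc _ _ _) ⟩
      (σ ⊕ 𝟙 (suc b)) ⨾ (1⊕ (σ ⊕ 𝟙 b) ⨾ ((μ ⊕ 𝟙 (suc b)) ⨾ 1⊕ (J j)))
        ≈⟨ _ ⨾⟨ (_ ⨾⟨ slide μ (J j)) ⟩
      (σ ⊕ 𝟙 (suc b)) ⨾ (1⊕ (σ ⊕ 𝟙 b) ⨾ (2 ▷ J j ⨾ (μ ⊕ 𝟙 b)))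
        ≈⟨ _ ⨾⟨ pull (≈-sym (1⊕-⨾ _ _)) _ ⟩
      (σ ⊕ 𝟙 (suc b)) ⨾ (1⊕ ((σ ⊕ 𝟙 b) ⨾ 1⊕ (J j)) ⨾ (μ ⊕ 𝟙 b)) ∎

    σσ-cancel : ∀ {b m} (c : Term Sig (suc (suc b)) m) → ((σ ⊕ 𝟙 b) ⨾ ((σ ⊕ 𝟙 b) ⨾ c)) ≈ c
    σσ-cancel c = ≈-trans (pull (σσ-id _) c) (⨾-idˡ c)

  -- At wire 0 this is associativity with commutativity of `μ`; away from it, the two fresh wires
  -- must cross wire 0 in the other order, which is Yang-Baxter. The case of `suc i` and `zero` is
  -- the mirrored one with both sides crossed once more.
  J-comm : ∀ {b} (i j : Fin b) → (1⊕ (J i) ⨾ J j) ≈ ((σ ⊕ 𝟙 b) ⨾ (1⊕ (J j) ⨾ J i))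
  J-comm {suc b} zero zero =
    1⊕ (μ ⊕ 𝟙 b) ⨾ (μ ⊕ 𝟙 b)                         ≈⟨ μ-assoc-⊕ b ⟩
    (μ ⊕ 𝟙 (suc b)) ⨾ (μ ⊕ 𝟙 b)                      ≈⟨ push (≈-sym (μ-comm-⊕ (suc b))) _ ⟩
    (σ ⊕ 𝟙 (suc b)) ⨾ ((μ ⊕ 𝟙 (suc b)) ⨾ (μ ⊕ 𝟙 b))  ≈⟨ _ ⨾⟨ ≈-sym (μ-assoc-⊕ b) ⟩
    (σ ⊕ 𝟙 (suc b)) ⨾ (1⊕ (μ ⊕ 𝟙 b) ⨾ (μ ⊕ 𝟙 b)) ∎
  J-comm {suc b} zero (suc j) = J-comm-0s j
  J-comm {suc b} (suc i) zero = ≈-trans (≈-sym (σσ-cancel _)) (_ ⨾⟨ ≈-sym (J-comm-0s i))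
  J-comm {suc b} (suc i) (suc j) =
    1⊕ ((σ ⊕ 𝟙 b) ⨾ 1⊕ (J i)) ⨾ ((σ ⊕ 𝟙 b) ⨾ 1⊕ (J j))
      ≈⟨ lemma i j ⟩
    1⊕ (σ ⊕ 𝟙 b) ⨾ ((σ ⊕ 𝟙 (suc b)) ⨾ 1⊕ (1⊕ (J i) ⨾ J j))
      ≈⟨ _ ⨾⟨ (_ ⨾⟨ ≈-trans (1⊕-cong (J-comm i j)) (1⊕-⨾ _ _)) ⟩
    1⊕ (σ ⊕ 𝟙 b) ⨾ ((σ ⊕ 𝟙 (suc b)) ⨾ (1⊕ (σ ⊕ 𝟙 b) ⨾ 1⊕ (1⊕ (J j) ⨾ J i)))
      ≈⟨ ≈-trans (_ ⨾⟨ ≈-sym (⨾-assoc _ _ _)) (pull (≈-sym (yang-baxter-⊕ b)) _) ⟩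
    ((σ ⊕ 𝟙 (suc b)) ⨾ (1⊕ (σ ⊕ 𝟙 b) ⨾ (σ ⊕ 𝟙 (suc b)))) ⨾ 1⊕ (1⊕ (J j) ⨾ J i)
      ≈⟨ ≈-trans (⨾-assoc _ _ _) (_ ⨾⟨ ⨾-assoc _ _ _) ⟩
    (σ ⊕ 𝟙 (suc b)) ⨾ (1⊕ (σ ⊕ 𝟙 b) ⨾ ((σ ⊕ 𝟙 (suc b)) ⨾ 1⊕ (1⊕ (J j) ⨾ J i)))
      ≈⟨ _ ⨾⟨ ≈-sym (lemma j i) ⟩
    (σ ⊕ 𝟙 (suc b)) ⨾ (1⊕ ((σ ⊕ 𝟙 b) ⨾ 1⊕ (J j)) ⨾ ((σ ⊕ 𝟙 b) ⨾ 1⊕ (J i))) ∎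
    where
    lemma : ∀ (i j : Fin b) → (1⊕ (J (suc i)) ⨾ J (suc j)) ≈
        (1⊕ (σ ⊕ 𝟙 b) ⨾ ((σ ⊕ 𝟙 (suc b)) ⨾ 1⊕ (1⊕ (J i) ⨾ J j)))
    lemma i j = ≈-trans (push (1⊕-⨾ _ _) _) (_ ⨾⟨ ≈-trans (extend (≈-sym (slide σ (J i))) _)
        (_ ⨾⟨ ≈-sym (1⊕-⨾ _ _)))

  -- ⟦ f ⟧ is the term of the cospan a → b ← b whose legs are f and the identity.

  ⟦_⟧ : ∀ {a b} → (Fin a → Fin b) → Term Sig a b
  ⟦_⟧ {zero}  {b} f = ηₙ Sig b
  ⟦_⟧ {suc a} {b} f = 1⊕ ⟦ f ∘ suc ⟧ ⨾ J (f zero)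

  -- The recursion inspects only values of `f`, so pointwise equal functions give identical terms
  -- without function extensionality. Identity, unlike `≈`, passes through `op` by `cong`, as
  -- `⟦⟧°-cong` requires.
  ⟦⟧-ext : ∀ {a b} {f g : Fin a → Fin b} → f ≗ g → ⟦ f ⟧ ≡ ⟦ g ⟧
  ⟦⟧-ext {zero}  p = refl
  ⟦⟧-ext {suc a} p = cong₂ (λ c i → 1⊕ c ⨾ J i) (⟦⟧-ext (p ∘ suc)) (p zero)

  ⟦⟧-cong : ∀ {a b} {f g : Fin a → Fin b} → f ≗ g → ⟦ f ⟧ ≈ ⟦ g ⟧
  ⟦⟧-cong p = ≡⇒≈ (⟦⟧-ext p)

  -- This is functoriality for a single merge: a wire merged into `i` follows it to `g i`. If `i` is
  -- not the head, the merge coming from the head of `g` is in the way, and `J-comm` exchanges the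
  -- two.
  J-⟦⟧ : ∀ {b c} (i : Fin b) (g : Fin b → Fin c) → (J i ⨾ ⟦ g ⟧) ≈ (1⊕ ⟦ g ⟧ ⨾ J (g i))
  J-⟦⟧ {suc b} {c} zero g =
    (μ ⊕ 𝟙 b) ⨾ (1⊕ ⟦ g ∘ suc ⟧ ⨾ J (g zero))            ≈⟨ extend (slide μ _) _ ⟩
    2 ▷ ⟦ g ∘ suc ⟧ ⨾ ((μ ⊕ 𝟙 c) ⨾ J (g zero))           ≈⟨ _ ⨾⟨ ≈-sym (J-assoc (g zero)) ⟩
    2 ▷ ⟦ g ∘ suc ⟧ ⨾ (1⊕ (J (g zero)) ⨾ J (g zero))     ≈⟨ pull (≈-sym (1⊕-⨾ _ _)) _ ⟩
    1⊕ (1⊕ ⟦ g ∘ suc ⟧ ⨾ J (g zero)) ⨾ J (g zero) ∎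
  J-⟦⟧ {suc b} {c} (suc i) g =
    ((σ ⊕ 𝟙 b) ⨾ 1⊕ (J i)) ⨾ (1⊕ ⟦ g ∘ suc ⟧ ⨾ J (g zero))
      ≈⟨ ≈-trans (⨾-assoc _ _ _) (_ ⨾⟨ pull (≈-trans (≈-sym (1⊕-⨾ _ _))
          (≈-trans (1⊕-cong (J-⟦⟧ i (g ∘ suc))) (1⊕-⨾ _ _))) _) ⟩
    (σ ⊕ 𝟙 b) ⨾ ((2 ▷ ⟦ g ∘ suc ⟧ ⨾ 1⊕ (J (g (suc i)))) ⨾ J (g zero))
      ≈⟨ ≈-trans (_ ⨾⟨ ⨾-assoc _ _ _) (extend (slide σ _) _) ⟩
    2 ▷ ⟦ g ∘ suc ⟧ ⨾ ((σ ⊕ 𝟙 c) ⨾ (1⊕ (J (g (suc i))) ⨾ J (g zero)))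
      ≈⟨ _ ⨾⟨ ≈-sym (J-comm (g zero) (g (suc i))) ⟩
    2 ▷ ⟦ g ∘ suc ⟧ ⨾ (1⊕ (J (g zero)) ⨾ J (g (suc i)))
      ≈⟨ pull (≈-sym (1⊕-⨾ _ _)) _ ⟩
    1⊕ (1⊕ ⟦ g ∘ suc ⟧ ⨾ J (g zero)) ⨾ J (g (suc i)) ∎

  ηₙ-⟦⟧ : ∀ {b c} (g : Fin b → Fin c) → (ηₙ Sig b ⨾ ⟦ g ⟧) ≈ ηₙ Sig c
  ηₙ-⟦⟧ {zero}  g = ⨾-idˡ _
  ηₙ-⟦⟧ {suc b} {c} g =
    (η ⊕ ηₙ Sig b) ⨾ (1⊕ ⟦ g ∘ suc ⟧ ⨾ J (g zero))         ≈⟨ ≈-sym (⨾-assoc _ _ _) ⟩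
    ((η ⊕ ηₙ Sig b) ⨾ 1⊕ ⟦ g ∘ suc ⟧) ⨾ J (g zero)         ≈⟨ ⨾-cong
        (≈-trans (≈-sym (interchange _ _ _ _)) (⊕-cong (id1-idʳ η) (ηₙ-⟦⟧ (g ∘ suc)))) ≈-refl ⟩
    (η ⊕ ηₙ Sig c) ⨾ J (g zero)                            ≈⟨ ⨾-cong (≈-sym (⨾-η⊕ _)) ≈-refl ⟩
    (ηₙ Sig c ⨾ (η ⊕ 𝟙 c)) ⨾ J (g zero)                    ≈⟨ ≈-trans (⨾-assoc _ _ _) (_ ⨾⟨ J-unit (g zero)) ⟩
    ηₙ Sig c ⨾ 𝟙 c                                         ≈⟨ ⨾-idʳ _ ⟩
    ηₙ Sig c ∎

  ⟦⟧-⨾ : ∀ {a b c} (f : Fin a → Fin b) (g : Fin b → Fin c) → (⟦ f ⟧ ⨾ ⟦ g ⟧) ≈ ⟦ g ∘ f ⟧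
  ⟦⟧-⨾ {zero}  f g = ηₙ-⟦⟧ g
  ⟦⟧-⨾ {suc a} f g =
    (1⊕ ⟦ f ∘ suc ⟧ ⨾ J (f zero)) ⨾ ⟦ g ⟧          ≈⟨ ≈-trans (⨾-assoc _ _ _) (_ ⨾⟨ J-⟦⟧ (f zero) g) ⟩
    1⊕ ⟦ f ∘ suc ⟧ ⨾ (1⊕ ⟦ g ⟧ ⨾ J (g (f zero)))   ≈⟨ pull
        (≈-trans (≈-sym (1⊕-⨾ _ _)) (1⊕-cong (⟦⟧-⨾ (f ∘ suc) g))) _ ⟩
    1⊕ ⟦ g ∘ f ∘ suc ⟧ ⨾ J (g (f zero)) ∎

  -- Output 0 is missed by the function, hence fed by `η`. Each `J` of a successor crosses that
  -- wire, and the crossing disappears once `η` is slid through it.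
  ⟦suc⟧ : ∀ {a b} (f : Fin a → Fin b) → ⟦ Fin.suc ∘ f ⟧ ≈ (η ⊕ ⟦ f ⟧)
  ⟦suc⟧ {zero}  {b} f = ≈-refl
  ⟦suc⟧ {suc a} {b} f =
    1⊕ ⟦ Fin.suc ∘ f ∘ suc ⟧ ⨾ ((σ ⊕ 𝟙 b) ⨾ 1⊕ (J (f zero)))
      ≈⟨ ⨾-cong (1⊕-cong (≈-trans (⟦suc⟧ (f ∘ suc)) (≈-sym (⨾-η⊕ _)))) ≈-refl ⟩
    1⊕ (⟦ f ∘ suc ⟧ ⨾ (η ⊕ 𝟙 b)) ⨾ ((σ ⊕ 𝟙 b) ⨾ 1⊕ (J (f zero)))
      ≈⟨ ≈-trans (push (1⊕-⨾ _ _) _) (_ ⨾⟨ pull (1⊕η-σ-⊕ b) _) ⟩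
    1⊕ ⟦ f ∘ suc ⟧ ⨾ ((η ⊕ 𝟙 (suc b)) ⨾ 1⊕ (J (f zero)))
      ≈⟨ ≈-trans (_ ⨾⟨ slide η (J (f zero))) (≈-sym (⨾-assoc _ _ _)) ⟩
    ⟦ f ⟧ ⨾ (η ⊕ 𝟙 b)
      ≈⟨ ⨾-η⊕ ⟦ f ⟧ ⟩
    η ⊕ ⟦ f ⟧ ∎

  ⟦id⟧ : ∀ n → ⟦ id {A = Fin n} ⟧ ≈ 𝟙 n
  ⟦id⟧ zero    = ≈-refl
  ⟦id⟧ (suc n) =
    1⊕ ⟦ Fin.suc ⟧ ⨾ (μ ⊕ 𝟙 n)          ≈⟨ ⨾-cong (1⊕-cong (≈-trans (⟦suc⟧ id) (⊕-cong ≈-refl (⟦id⟧ n)))) ≈-refl ⟩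
    1⊕ (η ⊕ 𝟙 n) ⨾ (μ ⊕ 𝟙 n)        ≈⟨ _ ⨾⟨ ≈-sym (μ-comm-⊕ n) ⟩
    1⊕ (η ⊕ 𝟙 n) ⨾ ((σ ⊕ 𝟙 n) ⨾ (μ ⊕ 𝟙 n))  ≈⟨ pull (1⊕η-σ-⊕ n) _ ⟩
    (η ⊕ 𝟙 (suc n)) ⨾ (μ ⊕ 𝟙 n)     ≈⟨ μ-unit-⊕ n ⟩
    𝟙 (suc n) ∎

  J-⊕ : ∀ {b} (i : Fin b) d → (J i ⊕ 𝟙 d) ≈ J (i ↑ˡ d)
  J-⊕ {suc b} zero    d = ≈-trans (⊕-assoc _ _ _) (⊕-cong ≈-refl (𝟙-⊕ b d))
  J-⊕ {suc b} (suc i) d =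
    ((σ ⊕ 𝟙 b) ⨾ 1⊕ (J i)) ⊕ 𝟙 d               ≈⟨ ⊕𝟙-⨾ _ _ d ⟩
    ((σ ⊕ 𝟙 b) ⊕ 𝟙 d) ⨾ (1⊕ (J i) ⊕ 𝟙 d)       ≈⟨ ⨾-cong (≈-trans (⊕-assoc _ _ _) (⊕-cong ≈-refl (𝟙-⊕ b d)))
        (≈-trans (tail₁ _ d) (1⊕-cong (J-⊕ i d))) ⟩
    (σ ⊕ 𝟙 (b + d)) ⨾ 1⊕ (J (i ↑ˡ d)) ∎

  ⟦↑ʳ⟧ : ∀ b {c d} (g : Fin c → Fin d) → ⟦ (b ↑ʳ_) ∘ g ⟧ ≈ (ηₙ Sig b ⊕ ⟦ g ⟧)
  ⟦↑ʳ⟧ zero    g = ≈-sym (⊕-idˡ _)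
  ⟦↑ʳ⟧ (suc b) g = ≈-trans (⟦suc⟧ ((b ↑ʳ_) ∘ g)) (≈-trans (⊕-cong ≈-refl (⟦↑ʳ⟧ b g)) (≈-sym (⊕-assoc _ _ _)))

  ⟦⟧-⊕ : ∀ {a b c d} (f : Fin a → Fin b) (g : Fin c → Fin d) → (⟦ f ⟧ ⊕ ⟦ g ⟧) ≈ ⟦ f ⊎ᶠ g ⟧
  ⟦⟧-⊕ {zero}  {b} f g = ≈-sym (⟦↑ʳ⟧ b g)
  ⟦⟧-⊕ {suc a} {b} {c} {d} f g =
    (1⊕ ⟦ f ∘ suc ⟧ ⨾ J (f zero)) ⊕ ⟦ g ⟧
      ≈⟨ ≈-trans (⊕-cong ≈-refl (≈-sym (⨾-idʳ _))) (interchange _ _ _ _) ⟩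
    (1⊕ ⟦ f ∘ suc ⟧ ⊕ ⟦ g ⟧) ⨾ (J (f zero) ⊕ 𝟙 d)
      ≈⟨ ⨾-cong (≈-trans (⊕-assoc _ _ _) (1⊕-cong (⟦⟧-⊕ (f ∘ suc) g))) (J-⊕ (f zero) d) ⟩
    1⊕ ⟦ (f ∘ suc) ⊎ᶠ g ⟧ ⨾ J (f zero ↑ˡ d)
      ≈⟨ ⨾-cong (1⊕-cong (⟦⟧-cong (λ k → sym (copair-suc ((_↑ˡ d) ∘ f) ((b ↑ʳ_) ∘ g) k)))) ≈-refl ⟩
    ⟦ f ⊎ᶠ g ⟧ ∎

  ηₙ-⊕ : ∀ b d → (ηₙ Sig b ⊕ ηₙ Sig d) ≈ ηₙ Sig (b + d)
  ηₙ-⊕ zero    d = ⊕-idˡ _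
  ηₙ-⊕ (suc b) d = ≈-trans (⊕-assoc _ _ _) (⊕-cong ≈-refl (ηₙ-⊕ b d))

  ⟦↑ˡ⟧ : ∀ {a b} (f : Fin a → Fin b) d → ⟦ (_↑ˡ d) ∘ f ⟧ ≈ (⟦ f ⟧ ⊕ ηₙ Sig d)
  ⟦↑ˡ⟧ {zero}  {b} f d = ≈-sym (ηₙ-⊕ b d)
  ⟦↑ˡ⟧ {suc a} {b} f d = ≈-sym (
    (1⊕ ⟦ f ∘ suc ⟧ ⨾ J (f zero)) ⊕ ηₙ Sig d
      ≈⟨ ≈-trans (⊕-cong ≈-refl (≈-sym (⨾-idʳ _))) (interchange _ _ _ _) ⟩
    (1⊕ ⟦ f ∘ suc ⟧ ⊕ ηₙ Sig d) ⨾ (J (f zero) ⊕ 𝟙 d)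
      ≈⟨ ⨾-cong (≈-trans (⊕-assoc _ _ _) (1⊕-cong (≈-sym (⟦↑ˡ⟧ (f ∘ suc) d)))) (J-⊕ (f zero) d) ⟩
    ⟦ (_↑ˡ d) ∘ f ⟧ ∎)

-- Copairing on finite sums and the permutations behind the structural terms

copair-↑ˡ : ∀ {a c} {B : Set} (f : Fin a → B) (g : Fin c → B) (i : Fin a) → [ f , g ]′ (splitAt a (i ↑ˡ c)) ≡ f i
copair-↑ˡ {a} {c} f g i = cong [ f , g ]′ (splitAt-↑ˡ a i c)

copair-↑ʳ : ∀ {a c} {B : Set} (f : Fin a → B) (g : Fin c → B) (j : Fin c) → [ f , g ]′ (splitAt a (a ↑ʳ j)) ≡ g j
copair-↑ʳ {a} {c} f g j = cong [ f , g ]′ (splitAt-↑ʳ a c j)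

sum-ext : ∀ {a c} {B : Set} {f g : Fin (a + c) → B} → (∀ i → f (i ↑ˡ c) ≡ g (i ↑ˡ c)) →
    (∀ j → f (a ↑ʳ j) ≡ g (a ↑ʳ j)) → f ≗ g
sum-ext {a} {c} {f = f} {g} p q k with splitAt a k in eq
... | inj₁ i = subst (λ x → f x ≡ g x) (splitAt⁻¹-↑ˡ eq) (p i)
... | inj₂ j = subst (λ x → f x ≡ g x) (splitAt⁻¹-↑ʳ eq) (q j)

copair-∘ : ∀ {a c b d} (h : Fin b → Fin d) (f : Fin a → Fin b) (g : Fin c → Fin b) → h ∘ copair f g ≗ copair
    (h ∘ f) (h ∘ g)
copair-∘ {a} h f g k with splitAt a k
... | inj₁ _ = refl
... | inj₂ _ = refl

copair-⊎ᶠ : ∀ {a c b d e} (f' : Fin b → Fin e) (g' : Fin d → Fin e) (f : Fin a → Fin b) (g : Fin c → Fin d)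
          → copair f' g' ∘ (f ⊎ᶠ g) ≗ copair (f' ∘ f) (g' ∘ g)
copair-⊎ᶠ {a} f' g' f g k with splitAt a k
... | inj₁ i = copair-↑ˡ f' g' (f i)
... | inj₂ j = copair-↑ʳ f' g' (g j)

⊎ᶠ-↑ˡ : ∀ {a b c d} (f : Fin a → Fin b) (g : Fin c → Fin d) i → (f ⊎ᶠ g) (i ↑ˡ c) ≡ f i ↑ˡ d
⊎ᶠ-↑ˡ f g i = copair-↑ˡ _ _ i

⊎ᶠ-↑ʳ : ∀ {a b c d} (f : Fin a → Fin b) (g : Fin c → Fin d) j → (f ⊎ᶠ g) (a ↑ʳ j) ≡ b ↑ʳ g j
⊎ᶠ-↑ʳ {a} {b} {c} {d} f g j = copair-↑ʳ ((_↑ˡ d) ∘ f) ((b ↑ʳ_) ∘ g) j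

⊎ᶠ-cong : ∀ {a b c d} {f f' : Fin a → Fin b} {g g' : Fin c → Fin d} → f ≗ f' → g ≗ g' → f ⊎ᶠ g ≗ f' ⊎ᶠ g'
⊎ᶠ-cong {a} {b} {c} {d} p q k with splitAt a k
... | inj₁ i = cong (_↑ˡ d) (p i)
... | inj₂ j = cong (b ↑ʳ_) (q j)

⊎ᶠ-∘ : ∀ {a b c d e h} (f' : Fin b → Fin e) (g' : Fin d → Fin h) (f : Fin a → Fin b) (g : Fin c → Fin d)
     → (f' ⊎ᶠ g') ∘ (f ⊎ᶠ g) ≗ (f' ∘ f) ⊎ᶠ (g' ∘ g)
⊎ᶠ-∘ f' g' f g = copair-⊎ᶠ _ _ f g

id⊎ᶠid : ∀ a c → id {A = Fin a} ⊎ᶠ id {A = Fin c} ≗ id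
id⊎ᶠid a c = sum-ext {a} {c} (⊎ᶠ-↑ˡ {a} {a} {c} {c} id id) (⊎ᶠ-↑ʳ {a} {a} {c} {c} id id)

fold : ∀ n → Fin (n + n) → Fin n
fold n = copair id id

swap : ∀ n m → Fin (n + m) → Fin (m + n)
swap n m = copair (m ↑ʳ_) (_↑ˡ n)

private
  -- Casts preserve `toℕ`, so every coherence between differently bracketed sums becomes an equation
  -- of natural numbers.
  cast-≡ : ∀ {m n} (eq : m ≡ n) (k : Fin m) {l : Fin n} → toℕ k ≡ toℕ l → castᶠ eq k ≡ l
  cast-≡ eq k p = toℕ-injective (trans (toℕ-cast eq k) p)

swap-1suc : ∀ n → (id {A = Fin 1} ⊎ᶠ swap 1 n) ∘ (swap 1 1 ⊎ᶠ id {A = Fin n}) ≗ swap 1 (suc n)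
swap-1suc n zero          = refl
swap-1suc n (suc zero)    = refl
swap-1suc n (suc (suc k)) = refl

swap-suc1 : ∀ n → (swap 1 1 ⊎ᶠ id {A = Fin n}) ∘ (id {A = Fin 1} ⊎ᶠ swap n 1) ≗ swap (suc n) 1
swap-suc1 n zero    = refl
swap-suc1 n (suc k) = sum-ext {n} {1} {f = λ k → ((swap 1 1 ⊎ᶠ id {A = Fin n}) ∘ (id {A = Fin 1} ⊎ᶠ swap n 1))
    (suc k)} {λ k → swap (suc n) 1 (suc k)}
  (λ i → trans (cong (λ x → (swap 1 1 ⊎ᶠ id {A = Fin n}) (1 ↑ʳ x)) (copair-↑ˡ _ _ i))
               (sym (copair-↑ˡ {suc n} (1 ↑ʳ_) (_↑ˡ suc n) (suc i))))
  (λ { zero → trans (cong (λ x → (swap 1 1 ⊎ᶠ id {A = Fin n}) (1 ↑ʳ x)) (copair-↑ʳ (1 ↑ʳ_) (_↑ˡ n) zero))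
               (sym (copair-↑ʳ {suc n} (1 ↑ʳ_) (_↑ˡ suc n) zero)) }) k

swap-step : ∀ n m → castᶠ (+-assoc m 1 n) ∘ (swap 1 m ⊎ᶠ id {A = Fin n}) ∘ (id {A = Fin 1} ⊎ᶠ swap n m) ≗ swap
    (suc n) m
swap-step n m zero = cast-≡ (+-assoc m 1 n) ((m ↑ʳ zero {0}) ↑ˡ n)
    (trans (toℕ-↑ˡ _ n) (trans (toℕ-↑ʳ m (zero {0})) (sym (toℕ-↑ʳ m (zero {n})))))
swap-step n m (suc k) = sum-ext {n} {m} {f = λ k → lhs (suc k)} {λ k → swap (suc n) m (suc k)}
  (λ i → trans (cong (λ x → g (1 ↑ʳ x)) (copair-↑ˡ _ _ i))
      (trans (cong (castᶠ (+-assoc m 1 n)) (⊎ᶠ-↑ʳ (swap 1 m) id i))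
     (trans (cast-≡ (+-assoc m 1 n) ((m + 1) ↑ʳ i) (trans (toℕ-↑ʳ (m + 1) i)
        (trans (+-assoc m 1 (toℕ i)) (sym (toℕ-↑ʳ m (suc i))))))
      (sym (copair-↑ˡ (m ↑ʳ_) (_↑ˡ suc n) (suc i))))))
  (λ j → trans (cong (λ x → g (1 ↑ʳ x)) (copair-↑ʳ (m ↑ʳ_) (_↑ˡ n) j))
      (trans (cong (castᶠ (+-assoc m 1 n)) (⊎ᶠ-↑ˡ (swap 1 m) (id {A = Fin n}) (suc j)))
     (trans (cast-≡ (+-assoc m 1 n) ((j ↑ˡ 1) ↑ˡ n)
         (trans (toℕ-↑ˡ (j ↑ˡ 1) n) (trans (toℕ-↑ˡ j 1) (sym (toℕ-↑ˡ j (suc n))))))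
      (sym (copair-↑ʳ {suc n} (m ↑ʳ_) (_↑ˡ suc n) j))))) k
  where
  g : Fin (suc m + n) → Fin (m + suc n)
  g = castᶠ (+-assoc m 1 n) ∘ (swap 1 m ⊎ᶠ id {A = Fin n})
  lhs : Fin (suc n + m) → Fin (m + suc n)
  lhs = g ∘ (id {A = Fin 1} ⊎ᶠ swap n m)

-- The recursive clause of `σnm` read from outputs to inputs: its factors appear in the opposite
-- order and the cast acts before them.
swap-stepᵒ : ∀ n m → (id {A = Fin 1} ⊎ᶠ swap m n) ∘ (swap m 1 ⊎ᶠ id {A = Fin n}) ∘ castᶠ (sym (+-assoc m 1 n))
    ≗ swap m (suc n)
swap-stepᵒ n m = sum-ext
  (λ i → trans (cong (h ∘ (swap m 1 ⊎ᶠ id))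
      (cast-≡ (sym (+-assoc m 1 n)) (i ↑ˡ suc n)
      (trans (toℕ-↑ˡ i (suc n)) (sym (trans (toℕ-↑ˡ (i ↑ˡ 1) n) (toℕ-↑ˡ i 1))))))
     (trans (cong h (trans (⊎ᶠ-↑ˡ (swap m 1) (id {A = Fin n}) (i ↑ˡ 1))
         (cong (_↑ˡ n) (copair-↑ˡ {m} {1} (1 ↑ʳ_) (_↑ˡ m) i))))
     (trans (cong suc (copair-↑ˡ {m} {n} (n ↑ʳ_) (_↑ˡ m) i))
         (sym (copair-↑ˡ {m} {suc n} (suc n ↑ʳ_) (_↑ˡ m) i)))))
  (λ { zero → trans (cong (h ∘ (swap m 1 ⊎ᶠ id))
      (cast-≡ (sym (+-assoc m 1 n)) (m ↑ʳ zero {n})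
      (trans (toℕ-↑ʳ m (zero {n})) (sym (trans (toℕ-↑ˡ (m ↑ʳ zero {0}) n) (toℕ-↑ʳ m (zero {0})))))))
       (trans (cong h (trans (⊎ᶠ-↑ˡ (swap m 1) (id {A = Fin n}) (m ↑ʳ zero))
           (cong (_↑ˡ n) (copair-↑ʳ {m} {1} (1 ↑ʳ_) (_↑ˡ m) zero))))
        (sym (copair-↑ʳ {m} {suc n} (suc n ↑ʳ_) (_↑ˡ m) zero)))
     ; (suc j) → trans (cong (h ∘ (swap m 1 ⊎ᶠ id))
         (cast-≡ (sym (+-assoc m 1 n)) (m ↑ʳ suc j)
         (trans (toℕ-↑ʳ m (suc j)) (sym (trans (toℕ-↑ʳ (m + 1) j) (+-assoc m 1 (toℕ j)))))))
       (trans (cong h (⊎ᶠ-↑ʳ (swap m 1) (id {A = Fin n}) j))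
           (trans (cong suc (copair-↑ʳ {m} {n} (n ↑ʳ_) (_↑ˡ m) j))
        (sym (copair-↑ʳ {m} {suc n} (suc n ↑ʳ_) (_↑ˡ m) (suc j))))) })
  where
  h : Fin (suc (m + n)) → Fin (suc (n + m))
  h = id {A = Fin 1} ⊎ᶠ swap m n

to1 : ∀ {n} → Fin n → Fin 1
to1 _ = zero

-- One identity serves both `μₙ`, whose clause is read forwards, and `δₙ`, whose clause is read
-- backwards.
fold-step : ∀ n → (to1 {2} ⊎ᶠ fold n) ∘ (id {A = Fin 1} ⊎ᶠ (swap n 1 ⊎ᶠ id {A = Fin n})) ∘ castᶠ
    (sym (cong suc (+-assoc n 1 n)))
          ≗ fold (suc n)
fold-step n zero    = refl
fold-step n (suc k) = sum-ext {n} {suc n} {f = λ k → lhs (suc k)} {λ k → fold (suc n) (suc k)}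
  (λ i → trans (cong h (cast-≡ (sym (cong suc (+-assoc n 1 n))) (suc (i ↑ˡ suc n)) (id
          (cong suc (trans (toℕ-↑ˡ i (suc n)) (sym (trans (toℕ-↑ˡ (i ↑ˡ 1) n) (toℕ-↑ˡ i 1))))))))
     (trans (cong (λ x → g (suc x)) (trans (⊎ᶠ-↑ˡ (swap n 1) (id {A = Fin n}) (i ↑ˡ 1))
         (cong (_↑ˡ n) (copair-↑ˡ {n} {1} (1 ↑ʳ_) (_↑ˡ n) i))))
     (trans (cong suc (copair-↑ˡ {n} {n} id id i)) (sym (copair-↑ˡ {suc n} {suc n} id id (suc i))))))
  (λ { zero → trans (cong h (cast-≡ (sym (cong suc (+-assoc n 1 n))) (suc (n ↑ʳ zero {n})) (id
          (cong suc (trans (toℕ-↑ʳ n (zero {n})) (sym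
              (trans (toℕ-↑ˡ (n ↑ʳ zero {0}) n) (toℕ-↑ʳ n (zero {0})))))))))
     (trans (cong (λ x → g (suc x)) (trans (⊎ᶠ-↑ˡ (swap n 1) (id {A = Fin n}) (n ↑ʳ zero))
         (cong (_↑ˡ n) (copair-↑ʳ {n} {1} (1 ↑ʳ_) (_↑ˡ n) zero))))
      (sym (copair-↑ʳ {suc n} {suc n} id id zero)))
     ; (suc j) → trans (cong h (cast-≡ (sym (cong suc (+-assoc n 1 n))) (suc (n ↑ʳ suc j)) (id
          (cong suc (trans (toℕ-↑ʳ n (suc j)) (sym (trans (toℕ-↑ʳ (n + 1) j) (+-assoc n 1 (toℕ j)))))))))
     (trans (cong (λ x → g (suc x)) (⊎ᶠ-↑ʳ (swap n 1) (id {A = Fin n}) j))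
     (trans (cong suc (copair-↑ʳ {n} {n} id id j)) (sym (copair-↑ʳ {suc n} {suc n} id id (suc j))))) }) k
  where
  g : Fin (2 + (n + n)) → Fin (suc n)
  g = to1 {2} ⊎ᶠ fold n
  h : Fin (suc ((n + 1) + n)) → Fin (suc n)
  h = g ∘ (id {A = Fin 1} ⊎ᶠ (swap n 1 ⊎ᶠ id {A = Fin n}))
  lhs : Fin (suc (n + suc n)) → Fin (suc n)
  lhs = h ∘ castᶠ (sym (cong suc (+-assoc n 1 n)))

-- c ↦ f: built without δ, ε and symbols, c denotes the cospan with legs f and id.
-- c ↤ f: dually, c denotes the cospan with legs id and f.

module _ {Sig : ℕ → ℕ → Set} where

  infix 4 _↦_ _↤_

  data _↦_ : ∀ {n m} → Term Sig n m → (Fin n → Fin m) → Set where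
    id0↦  : id0 ↦ id
    id1↦  : id1 ↦ id
    σ↦    : σ ↦ swap 1 1
    μ↦    : μ ↦ to1
    η↦    : η ↦ λ ()
    ⨾↦    : ∀ {n z m} {c : Term Sig n z} {d : Term Sig z m} {f g} → c ↦ f → d ↦ g → (c ⨾ d) ↦ g ∘ f
    ⊕↦    : ∀ {n m p q} {c : Term Sig n m} {d : Term Sig p q} {f g} → c ↦ f → d ↦ g → (c ⊕ d) ↦ (f ⊎ᶠ g)
    cast↦ : ∀ {n m n' m'} (p : n ≡ n') (q : m ≡ m') {c : Term Sig n m} {f} → c ↦ f
          → cast Sig p q c ↦ castᶠ q ∘ f ∘ castᶠ (sym p)
    -- The functions assembled by the other rules, such as `id ⊎ᶠ id`, agree with the intended ones
    -- only pointwise.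
    ext↦  : ∀ {n m} {c : Term Sig n m} {f g} → f ≗ g → c ↦ f → c ↦ g

  data _↤_ : ∀ {n m} → Term Sig n m → (Fin m → Fin n) → Set where
    id0↤  : id0 ↤ id
    id1↤  : id1 ↤ id
    σ↤    : σ ↤ swap 1 1
    δ↤    : δ ↤ to1
    ε↤    : ε ↤ λ ()
    ⨾↤    : ∀ {n z m} {c : Term Sig n z} {d : Term Sig z m} {f g} → c ↤ f → d ↤ g → (c ⨾ d) ↤ f ∘ g
    ⊕↤    : ∀ {n m p q} {c : Term Sig n m} {d : Term Sig p q} {f g} → c ↤ f → d ↤ g → (c ⊕ d) ↤ (f ⊎ᶠ g)
    cast↤ : ∀ {n m n' m'} (p : n ≡ n') (q : m ≡ m') {c : Term Sig n m} {f} → c ↤ f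
          → cast Sig p q c ↤ castᶠ p ∘ f ∘ castᶠ (sym q)
    ext↤  : ∀ {n m} {c : Term Sig n m} {f g} → f ≗ g → c ↤ f → c ↤ g

  idₙ↦ : ∀ n → idₙ Sig n ↦ id
  idₙ↦ zero    = id0↦
  idₙ↦ (suc n) = ext↦ (id⊎ᶠid 1 n) (⊕↦ id1↦ (idₙ↦ n))

  idₙ↤ : ∀ n → idₙ Sig n ↤ id
  idₙ↤ zero    = id0↤
  idₙ↤ (suc n) = ext↤ (id⊎ᶠid 1 n) (⊕↤ id1↤ (idₙ↤ n))

  ηₙ↦ : ∀ n → ηₙ Sig n ↦ λ ()
  ηₙ↦ zero    = ext↦ (λ ()) id0↦
  ηₙ↦ (suc n) = ext↦ (λ ()) (⊕↦ η↦ (ηₙ↦ n))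

  εₙ↤ : ∀ n → εₙ Sig n ↤ λ ()
  εₙ↤ zero    = ext↤ (λ ()) id0↤
  εₙ↤ (suc n) = ext↤ (λ ()) (⊕↤ ε↤ (εₙ↤ n))

  σ1↦ : ∀ n → σ1 Sig n ↦ swap 1 n
  σ1↦ zero    = ext↦ (λ { zero → refl }) id1↦
  σ1↦ (suc n) = ext↦ (swap-1suc n) (⨾↦ (⊕↦ σ↦ (idₙ↦ n)) (⊕↦ id1↦ (σ1↦ n)))

  σ1'↦ : ∀ n → σ1' Sig n ↦ swap n 1
  σ1'↦ zero    = ext↦ (λ { zero → refl }) id1↦
  σ1'↦ (suc n) = ext↦ (swap-suc1 n) (⨾↦ (⊕↦ id1↦ (σ1'↦ n)) (⊕↦ σ↦ (idₙ↦ n)))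

  σ1↤ : ∀ n → σ1 Sig n ↤ swap n 1
  σ1↤ zero    = ext↤ (λ { zero → refl }) id1↤
  σ1↤ (suc n) = ext↤ (swap-suc1 n) (⨾↤ (⊕↤ σ↤ (idₙ↤ n)) (⊕↤ id1↤ (σ1↤ n)))

  σnm↦ : ∀ n m → σnm Sig n m ↦ swap n m
  σnm↦ zero    m = ext↦ (λ k → toℕ-cong (sym (+-identityʳ m)) refl k) (cast↦ refl (sym (+-identityʳ m)) (idₙ↦ m))
    where
    toℕ-cong : ∀ (q : m ≡ m + 0) (r : m ≡ m) k → castᶠ q (castᶠ r k) ≡ k ↑ˡ 0
    toℕ-cong q r k = toℕ-injective (trans (toℕ-cast q (castᶠ r k))
      (trans (toℕ-cast r k) (sym (toℕ-↑ˡ k 0))))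
  σnm↦ (suc n) m = ext↦ (λ k → trans (cong
      (castᶠ (+-assoc m 1 n) ∘ (swap 1 m ⊎ᶠ id {A = Fin n}) ∘ (id {A = Fin 1} ⊎ᶠ swap n m))
      (cast-is-id refl k)) (swap-step n m k))
    (cast↦ refl (+-assoc m 1 n) (⨾↦ (⊕↦ id1↦ (σnm↦ n m)) (⊕↦ (σ1↦ m) (idₙ↦ n))))

  μₙ↦ : ∀ n → μₙ Sig n ↦ fold n
  μₙ↦ zero    = ext↦ (λ ()) id0↦
  μₙ↦ (suc n) = ext↦ (λ k → trans (cast-is-id refl _) (fold-step n k))
    (cast↦ (cong suc (+-assoc n 1 n)) refl (⨾↦ (⊕↦ id1↦ (⊕↦ (σ1'↦ n) (idₙ↦ n))) (⊕↦ μ↦ (μₙ↦ n))))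

  δₙ↤ : ∀ n → δₙ Sig n ↤ fold n
  δₙ↤ zero    = ext↤ (λ ()) id0↤
  δₙ↤ (suc n) = ext↤ (λ k → trans (cast-is-id refl _) (fold-step n k))
    (cast↤ refl (cong suc (+-assoc n 1 n)) (⨾↤ (⊕↤ δ↤ (δₙ↤ n)) (⊕↤ id1↤ (⊕↤ (σ1↤ n) (idₙ↤ n)))))

  private
    cast-swap-0 : ∀ m (p : m + 0 ≡ m) → castᶠ refl ∘ castᶠ p ≗ swap m 0
    cast-swap-0 m p = sum-ext {m} {0} (λ i → trans (cast-is-id refl _) (trans
      (toℕ-injective (trans (toℕ-cast p (i ↑ˡ 0)) (toℕ-↑ˡ i 0)))
      (sym (copair-↑ˡ {m} {0} {Fin m} (0 ↑ʳ_) (_↑ˡ m) i)))) (λ ())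

  σnm↤ : ∀ n m → σnm Sig n m ↤ swap m n
  σnm↤ zero    m = ext↤ (cast-swap-0 m (sym (sym (+-identityʳ m)))) (cast↤ refl (sym (+-identityʳ m)) (idₙ↤ m))
  σnm↤ (suc n) m = ext↤ (λ k → trans (cast-is-id refl _) (swap-stepᵒ n m k))
    (cast↤ refl (+-assoc m 1 n) (⨾↤ (⊕↤ id1↤ (σnm↤ n m)) (⊕↤ (σ1↤ m) (idₙ↤ n))))

module _ (Sig : ℕ → ℕ → Set) where
  open Wiring Sig

  -- Coherence for wirings: two terms derived for the same function reach the same canonical term,
  -- since `⟦_⟧` respects `⨾` and `⊕` and only generators have to be computed.
  ↦-sound : ∀ {n m} {c : Term Sig n m} {f} → c ↦ f → c ≈ ⟦ f ⟧
  ↦-sound id0↦ = ≈-refl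
  ↦-sound id1↦ = ≈-sym (≈-trans (⟦id⟧ 1) 𝟙1)
  -- The canonical term of the swap merges each wire into an output fed by `η`. The right unit law
  -- removes both merges and leaves one crossing.
  ↦-sound σ↦ = ≈-sym (
    1⊕ ⟦ swap 1 1 ∘ suc ⟧ ⨾ J (suc zero)
      ≈⟨ ⨾-cong (1⊕-cong (≈-trans (⨾-cong (1⊕-cong (⊕-cong ≈-refl (⊕-idʳ η))) (≈-refl {c = J {2} zero}))
          (≈-refl))) ≈-refl ⟩
    1⊕ (1⊕ (η ⊕ η) ⨾ (μ ⊕ 𝟙 1)) ⨾ ((σ ⊕ 𝟙 1) ⨾ 1⊕ (J zero))
      ≈⟨ ⨾-cong (1⊕-cong (≈-trans (⨾-cong (≈-sym (⊕-assoc _ _ _)) ≈-refl)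
          (≈-trans (≈-sym (interchange _ _ _ _)) (⊕-cong unitʳ (⨾-idʳ η))))) ≈-refl ⟩
    1⊕ (id1 ⊕ η) ⨾ ((σ ⊕ 𝟙 1) ⨾ 1⊕ (μ ⊕ id0))
      ≈⟨ ≈-trans (⨾-cong (≈-trans (≈-sym (⊕-assoc id1 id1 η)) (⊕-cong (≈-sym (1⊕-cong 𝟙1)) ≈-refl)) ≈-refl)
          (pull (≈-trans (split₂ σ η) (≈-trans (≈-sym (split₁ σ η))
          (⨾-cong (⊕-idʳ σ) (≈-trans (⊕-cong (1⊕-cong 𝟙1) ≈-refl) (⊕-assoc id1 id1 η))))) _) ⟩
    (σ ⨾ 1⊕ (id1 ⊕ η)) ⨾ 1⊕ (μ ⊕ id0)
      ≈⟨ ≈-trans (⨾-assoc _ _ _) (_ ⨾⟨ ≈-trans (≈-sym (1⊕-⨾ _ _))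
          (≈-trans (1⊕-cong (≈-trans (⨾-cong ≈-refl (⊕-idʳ μ)) unitʳ)) (≈-sym (1⊕-cong 𝟙1)))) ⟩
    σ ⨾ 𝟙 2 ≈⟨ ⨾-idʳ σ ⟩
    σ ∎)
    where
    unitʳ : ((id1 ⊕ η) ⨾ μ) ≈ id1
    unitʳ = ≈-trans (⨾-cong ≈-refl (≈-sym μ-comm)) (≈-trans (pull 1⊕η-σ μ) μ-unit)
  ↦-sound μ↦ = ≈-sym (
    1⊕ (1⊕ (η ⊕ id0) ⨾ (μ ⊕ id0)) ⨾ (μ ⊕ id0) ≈⟨ ⨾-cong (1⊕-cong (⟦id⟧ 1)) (⊕-idʳ μ) ⟩
    𝟙 2 ⨾ μ                                   ≈⟨ ⨾-idˡ μ ⟩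
    μ ∎)
  ↦-sound η↦ = ≈-sym (⊕-idʳ η)
  ↦-sound (⨾↦ p q) = ≈-trans (⨾-cong (↦-sound p) (↦-sound q)) (⟦⟧-⨾ _ _)
  ↦-sound (⊕↦ p q) = ≈-trans (⊕-cong (↦-sound p) (↦-sound q)) (⟦⟧-⊕ _ _)
  ↦-sound (cast↦ refl refl {f = f} p) = ≈-trans (↦-sound p)
    (⟦⟧-cong (λ k → sym (trans (cast-is-id refl _) (cong f (cast-is-id refl k)))))
  ↦-sound (ext↦ e p) = ≈-trans (↦-sound p) (⟦⟧-cong e)

-- Reversal of cospans

op : ∀ {Sig : ℕ → ℕ → Set} {n m} → Term Sig n m → Term (flip Sig) m n
op δ       = μ
op ε       = η
op μ       = δ
op η       = ε
op id0     = id0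
op id1     = id1
op σ       = σ
op (gen R) = gen R
op (c ⨾ d) = op d ⨾ op c
op (c ⊕ d) = op c ⊕ op d

module _ {Sig : ℕ → ℕ → Set} where
  op-cast : ∀ {n m n' m'} (p : n ≡ n') (q : m ≡ m') (c : Term Sig n m) → op (cast Sig p q c) ≡ cast (flip Sig)
      q p (op c)
  op-cast refl refl c = refl

  op-idₙ : ∀ n → op (idₙ Sig n) ≡ idₙ (flip Sig) n
  op-idₙ zero    = refl
  op-idₙ (suc n) = cong (id1 ⊕_) (op-idₙ n)

  op-↤ : ∀ {n m} {c : Term Sig n m} {f} → c ↤ f → op c ↦ f
  op-↤ id0↤ = id0↦
  op-↤ id1↤ = id1↦
  op-↤ σ↤ = σ↦
  op-↤ δ↤ = μ↦
  op-↤ ε↤ = η↦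
  op-↤ (⨾↤ p q) = ⨾↦ (op-↤ q) (op-↤ p)
  op-↤ (⊕↤ p q) = ⊕↦ (op-↤ p) (op-↤ q)
  op-↤ (cast↤ p q {c} r) rewrite op-cast p q c = cast↦ q p (op-↤ r)
  op-↤ (ext↤ e p) = ext↦ e (op-↤ p)

  -- Reversal does not turn the recursion of `σnm` into that of the opposite symmetry syntactically.
  -- Both terms are wirings of the permutation `swap m n`, which suffices.
  op-σnm : ∀ n m → Defs._≈_ (flip Sig) (op (σnm Sig n m)) (σnm (flip Sig) m n)
  op-σnm n m = ≈-trans (↦-sound (flip Sig) (op-↤ (σnm↤ n m))) (≈-sym (↦-sound (flip Sig) (σnm↦ m n)))

  -- The equations (E) are closed under reversal once arities and coarities of the symbols are
  -- exchanged. All rules have a literal mirror image up to symmetry, apart from the unit laws of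
  -- `⨾` and from `σ-nat`, where the structural terms have to be reversed by `op-idₙ` and `op-σnm`.
  op-cong : ∀ {n m n' m'} {c : Term Sig n m} {d : Term Sig n' m'} → Defs._≈_ Sig c d → Defs._≈_ (flip Sig)
      (op c) (op d)
  op-cong ≈-refl = ≈-refl
  op-cong (≈-sym p) = ≈-sym (op-cong p)
  op-cong (≈-trans p q) = ≈-trans (op-cong p) (op-cong q)
  op-cong (⨾-cong p q) = ⨾-cong (op-cong q) (op-cong p)
  op-cong (⊕-cong p q) = ⊕-cong (op-cong p) (op-cong q)
  op-cong (⨾-assoc c d e) = ≈-sym (⨾-assoc _ _ _)
  op-cong (⨾-idˡ {n} c) rewrite op-idₙ n = ⨾-idʳ _
  op-cong (⨾-idʳ {m = m} c) rewrite op-idₙ m = ⨾-idˡ _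
  op-cong (⊕-assoc c d e) = ⊕-assoc _ _ _
  op-cong (⊕-idˡ c) = ⊕-idˡ _
  op-cong (⊕-idʳ c) = ⊕-idʳ _
  op-cong (interchange c d c' d') = interchange _ _ _ _
  op-cong σ-inv = σ-inv
  op-cong (σ-nat {n} {m} {p} {q} c d) =
    ≈-trans (⨾-cong (op-σnm m q) ≈-refl) (≈-trans (≈-sym (σ-nat (op d) (op c)))
        (⨾-cong ≈-refl (≈-sym (op-σnm n p))))
  op-cong δ-assoc = μ-assoc
  op-cong δ-unit = μ-unit
  op-cong δ-comm = μ-comm
  op-cong μ-assoc = δ-assoc
  op-cong μ-unit = δ-unit
  op-cong μ-comm = δ-comm
  op-cong frob₁ = ≈-sym frob₂
  op-cong frob₂ = ≈-sym frob₁
  op-cong special = special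

-- Coequalizers of finite sets

record Coeq {z n : ℕ} (f g : Fin z → Fin n) : Set₁ where
  field
    size      : ℕ
    quot      : Fin n → Fin size
    sect      : Fin size → Fin n
    quot-eq   : ∀ k → quot (f k) ≡ quot (g k)
    quot-sect : ∀ y → quot (sect y) ≡ y
    -- The mediating map is given explicitly as `h ∘ sect`; its uniqueness comes from `quot-sect`.
    factor    : ∀ {B : Set} (h : Fin n → B) → (∀ k → h (f k) ≡ h (g k)) → ∀ x → h (sect (quot x)) ≡ h x
open Coeq

const₁ : ∀ {n} → Fin n → Fin 1 → Fin n
const₁ u _ = u

-- The clauses follow those of `J` and `K`. If exactly one point is 0, that point is removed and
-- sent to the other, so that `⟦ quot ⟧` is a single `J` up to an identity and `⟦ quot ⟧°` a single
-- `K`.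
merge : ∀ {n} (u v : Fin n) → Coeq (const₁ u) (const₁ v)
merge {suc n} zero zero = record
  { size = suc n ; quot = id ; sect = id ; quot-eq = λ _ → refl ; quot-sect = λ _ → refl ; factor = λ h p x →
      refl }
merge {suc n} zero (suc v) = record
  { size = n ; quot = λ { zero → v ; (suc x) → x } ; sect = suc ; quot-eq = λ _ → refl ; quot-sect = λ _ → refl
  ; factor = λ { h p zero → sym (p zero) ; h p (suc x) → refl } }
merge {suc n} (suc u) zero = record
  { size = n ; quot = λ { zero → u ; (suc x) → x } ; sect = suc ; quot-eq = λ _ → refl ; quot-sect = λ _ → refl
  ; factor = λ { h p zero → p zero ; h p (suc x) → refl } }
merge {suc n} (suc u) (suc v) = record
  { size = suc (size m) ; quot = lift 1 (quot m) ; sect = lift 1 (sect m)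
  ; quot-eq = λ k → cong suc (quot-eq m k)
  ; quot-sect = λ { zero → refl ; (suc y) → cong suc (quot-sect m y) }
  ; factor = λ { h p zero → refl ; h p (suc x) → factor m (h ∘ suc) p x } }
  where m = merge u v

-- The pair at index zero is glued last, after the quotient by the tail. This is the order in which
-- the induction of `beck-chevalley` meets the pairs, so its result is literally this quotient.
coeq : ∀ {z n} (f g : Fin z → Fin n) → Coeq f g
coeq {zero} {n} f g = record
  { size = n ; quot = id ; sect = id ; quot-eq = λ () ; quot-sect = λ _ → refl ; factor = λ h p x → refl }
coeq {suc z} f g = record
  { size = size m ; quot = quot m ∘ quot c ; sect = sect c ∘ sect m
  ; quot-eq = λ { zero → quot-eq m zero ; (suc k) → cong (quot m) (quot-eq c k) }
  ; quot-sect = λ y → trans (cong (quot m) (quot-sect c _)) (quot-sect m y)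
  ; factor = λ h p x → trans
      (factor m (h ∘ sect c) (λ _ → trans (factor c h (p ∘ suc) (f zero))
          (trans (p zero) (sym (factor c h (p ∘ suc) (g zero))))) (quot c x))
      (factor c h (p ∘ suc) x) }
  where
  c = coeq (f ∘ suc) (g ∘ suc)
  m = merge (quot c (f zero)) (quot c (g zero))

-- Converses of functions and the Frobenius law on many wires

module Frobenius (Sig : ℕ → ℕ → Set) where
  open Wiring Sig
  private
    module W = Wiring (flip Sig)

  K : ∀ {b} → Fin b → Term Sig b (suc b)
  K {suc b} zero    = δ ⊕ 𝟙 b
  K {suc b} (suc i) = 1⊕ (K i) ⨾ (σ ⊕ 𝟙 b)

  ⟦_⟧° : ∀ {a b} → (Fin a → Fin b) → Term Sig b a
  ⟦_⟧° {zero}  {b} f = εₙ Sig b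
  ⟦_⟧° {suc a} {b} f = K (f zero) ⨾ 1⊕ ⟦ f ∘ suc ⟧°

  op-ηₙ : ∀ b → op (ηₙ (flip Sig) b) ≡ εₙ Sig b
  op-ηₙ zero    = refl
  op-ηₙ (suc b) = cong (ε ⊕_) (op-ηₙ b)

  op-J : ∀ {b} (i : Fin b) → op (W.J i) ≡ K i
  op-J {suc b} zero    = cong (δ ⊕_) (op-idₙ b)
  op-J {suc b} (suc i) = cong₂ (λ c d → 1⊕ c ⨾ (σ ⊕ d)) (op-J i) (op-idₙ b)

  op-⟦⟧ : ∀ {a b} (f : Fin a → Fin b) → op W.⟦ f ⟧ ≡ ⟦ f ⟧°
  op-⟦⟧ {zero}  {b} f = op-ηₙ b
  op-⟦⟧ {suc a} {b} f = cong₂ (λ c d → c ⨾ 1⊕ d) (op-J (f zero)) (op-⟦⟧ (f ∘ suc))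

  -- Reversing twice stays over the same signature because `flip (flip Sig)` is `Sig` by definition;
  -- this lets laws proved over `flip Sig` return as laws over `Sig`.
  opᵂ : ∀ {n m n' m'} {c : Term (flip Sig) n m} {d : Term (flip Sig) n' m'} → c W.≈ d → op c ≈ op d
  opᵂ = op-cong {flip Sig}

  ⟦⟧°-cong : ∀ {a b} {f g : Fin a → Fin b} → f ≗ g → ⟦ f ⟧° ≈ ⟦ g ⟧°
  ⟦⟧°-cong {f = f} {g} p = ≡⇒≈ (trans (sym (op-⟦⟧ f)) (trans (cong op (W.⟦⟧-ext p)) (op-⟦⟧ g)))

  ⟦⟧°-⨾ : ∀ {a b c} (f : Fin a → Fin b) (g : Fin b → Fin c) → (⟦ g ⟧° ⨾ ⟦ f ⟧°) ≈ ⟦ g ∘ f ⟧°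
  ⟦⟧°-⨾ f g = subst₂ _≈_ (cong₂ _⨾_ (op-⟦⟧ g) (op-⟦⟧ f)) (op-⟦⟧ (g ∘ f)) (opᵂ (W.⟦⟧-⨾ f g))

  ⟦id⟧° : ∀ n → ⟦ id {A = Fin n} ⟧° ≈ 𝟙 n
  ⟦id⟧° n = subst₂ _≈_ (op-⟦⟧ id) (op-idₙ n) (opᵂ (W.⟦id⟧ n))

  ⟦⟧°-⊕ : ∀ {a b c d} (f : Fin a → Fin b) (g : Fin c → Fin d) → (⟦ f ⟧° ⊕ ⟦ g ⟧°) ≈ ⟦ f ⊎ᶠ g ⟧°
  ⟦⟧°-⊕ f g = subst₂ _≈_ (cong₂ _⊕_ (op-⟦⟧ f) (op-⟦⟧ g)) (op-⟦⟧ (f ⊎ᶠ g)) (opᵂ (W.⟦⟧-⊕ f g))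

  ⟦↑ʳ⟧° : ∀ b {c d} (g : Fin c → Fin d) → ⟦ (b ↑ʳ_) ∘ g ⟧° ≈ (εₙ Sig b ⊕ ⟦ g ⟧°)
  ⟦↑ʳ⟧° b g = subst₂ _≈_ (op-⟦⟧ ((b ↑ʳ_) ∘ g)) (cong₂ _⊕_ (op-ηₙ b) (op-⟦⟧ g)) (opᵂ (W.⟦↑ʳ⟧ b g))

  ⟦↑ˡ⟧° : ∀ {a b} (f : Fin a → Fin b) d → ⟦ (_↑ˡ d) ∘ f ⟧° ≈ (⟦ f ⟧° ⊕ εₙ Sig d)
  ⟦↑ˡ⟧° {a} {b} f d = ≈-trans (≡⇒≈ (sym (op-⟦⟧ ((_↑ˡ d) ∘ f)))) (≈-trans (opᵂ (W.⟦↑ˡ⟧ f d))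
    (⊕-cong (≡⇒≈ (op-⟦⟧ f)) (≡⇒≈ (op-ηₙ d))))

  ↤-sound : ∀ {n m} {c : Term Sig n m} {f} → c ↤ f → c ≈ ⟦ f ⟧°
  ↤-sound id0↤ = ≈-refl
  ↤-sound id1↤ = ≈-trans (opᵂ (↦-sound (flip Sig) id1↦)) (≡⇒≈ (op-⟦⟧ id))
  ↤-sound σ↤ = ≈-trans (opᵂ (↦-sound (flip Sig) σ↦)) (≡⇒≈ (op-⟦⟧ (swap 1 1)))
  ↤-sound δ↤ = ≈-trans (opᵂ (↦-sound (flip Sig) μ↦)) (≡⇒≈ (op-⟦⟧ to1))
  ↤-sound ε↤ = ≈-trans (opᵂ (↦-sound (flip Sig) η↦)) (≡⇒≈ (op-⟦⟧ {0} {1} (λ ())))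
  ↤-sound (⨾↤ p q) = ≈-trans (⨾-cong (↤-sound p) (↤-sound q)) (⟦⟧°-⨾ _ _)
  ↤-sound (⊕↤ p q) = ≈-trans (⊕-cong (↤-sound p) (↤-sound q)) (⟦⟧°-⊕ _ _)
  ↤-sound (cast↤ refl refl {f = f} p) = ≈-trans (↤-sound p)
    (⟦⟧°-cong (λ k → sym (trans (cast-is-id refl _) (cong f (cast-is-id refl k)))))
  ↤-sound (ext↤ e p) = ≈-trans (↤-sound p) (⟦⟧°-cong e)

  -- Merging a wire into wire i and copying it out again

  module _ (b : ℕ) where

    frobenius-⊕ : ((μ ⊕ 𝟙 b) ⨾ (δ ⊕ 𝟙 b)) ≈ ((δ ⊕ 𝟙 (suc b)) ⨾ 1⊕ (μ ⊕ 𝟙 b))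
    frobenius-⊕ = ≈-trans (≈-sym (⊕𝟙-⨾ μ δ b)) (≈-trans (⊕-cong (≈-sym frob₁) ≈-refl)
      (≈-trans (⊕𝟙-⨾ _ _ b) (⨾-cong (tail₂ δ b) (tail₁ μ b))))

    -- `K` puts the new copy in front. Here the copy in front stems from the second input, which
    -- commutativity of `δ` makes possible by exchanging the outputs in `frob₂`.
    frobenius-σ : (μ ⨾ δ) ≈ ((id1 ⊕ δ) ⨾ ((σ ⊕ id1) ⨾ (id1 ⊕ μ)))
    frobenius-σ =
      μ ⨾ δ                                                   ≈⟨ _ ⨾⟨ ≈-sym δ-comm ⟩
      μ ⨾ (δ ⨾ σ)                                             ≈⟨ ≈-trans (pull frob₂ σ) (⨾-assoc _ _ _) ⟩
      (id1 ⊕ δ) ⨾ ((μ ⊕ id1) ⨾ σ)                             ≈⟨ _ ⨾⟨ μ⊕1-σ ⟩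
      (id1 ⊕ δ) ⨾ ((id1 ⊕ σ) ⨾ ((σ ⊕ id1) ⨾ (id1 ⊕ μ)))       ≈⟨ pull
          (≈-trans (≈-sym (1⊕-⨾ δ σ)) (1⊕-cong δ-comm)) _ ⟩
      (id1 ⊕ δ) ⨾ ((σ ⊕ id1) ⨾ (id1 ⊕ μ)) ∎

    frobenius-σ-⊕ : ((μ ⊕ 𝟙 b) ⨾ (δ ⊕ 𝟙 b)) ≈ (1⊕ (δ ⊕ 𝟙 b) ⨾ ((σ ⊕ 𝟙 (suc b)) ⨾ 1⊕ (μ ⊕ 𝟙 b)))
    frobenius-σ-⊕ = ≈-trans (≈-sym (⊕𝟙-⨾ μ δ b)) (≈-trans (⊕-cong frobenius-σ ≈-refl)
      (≈-trans (front₃ _ _ _) (⨾-cong (tail₁ δ b) (⨾-cong (tail₂ σ b) (tail₁ μ b)))))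

    σ-δ⊕ : ((σ ⊕ 𝟙 b) ⨾ (δ ⊕ 𝟙 (suc b))) ≈ (1⊕ (δ ⊕ 𝟙 b) ⨾ ((σ ⊕ 𝟙 (suc b)) ⨾ 1⊕ (σ ⊕ 𝟙 b)))
    σ-δ⊕ = ≈-sym (
      1⊕ (δ ⊕ 𝟙 b) ⨾ ((σ ⊕ 𝟙 (suc b)) ⨾ 1⊕ (σ ⊕ 𝟙 b))
        ≈⟨ ⨾-cong (≈-sym (≈-trans (pull (σσ-id b) _) (⨾-idˡ _))) ≈-refl ⟩
      ((σ ⊕ 𝟙 b) ⨾ ((σ ⊕ 𝟙 b) ⨾ 1⊕ (δ ⊕ 𝟙 b))) ⨾ ((σ ⊕ 𝟙 (suc b)) ⨾ 1⊕ (σ ⊕ 𝟙 b))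
        ≈⟨ ≈-trans (⨾-assoc _ _ _) (_ ⨾⟨ ⨾-cong (≈-sym (δ⊕1-σσ-⊕ b)) ≈-refl) ⟩
      (σ ⊕ 𝟙 b) ⨾ (((δ ⊕ 𝟙 (suc b)) ⨾ (1⊕ (σ ⊕ 𝟙 b) ⨾ (σ ⊕ 𝟙 (suc b)))) ⨾ ((σ ⊕ 𝟙 (suc b)) ⨾ 1⊕ (σ ⊕ 𝟙 b)))
        ≈⟨ _ ⨾⟨ ≈-trans (⨾-assoc _ _ _) (_ ⨾⟨ ≈-trans (⨾-assoc _ _ _)
            (_ ⨾⟨ ≈-trans (pull (σσ-id (suc b)) _) (⨾-idˡ _))) ⟩
      (σ ⊕ 𝟙 b) ⨾ ((δ ⊕ 𝟙 (suc b)) ⨾ (1⊕ (σ ⊕ 𝟙 b) ⨾ 1⊕ (σ ⊕ 𝟙 b)))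
        ≈⟨ _ ⨾⟨ ≈-trans (_ ⨾⟨ ≈-trans (≈-sym (1⊕-⨾ _ _)) (1⊕-cong (σσ-id b))) (⨾-idʳ _) ⟩
      (σ ⊕ 𝟙 b) ⨾ (δ ⊕ 𝟙 (suc b)) ∎)

  -- Frobenius transported along the crossings that lead to wire `i`: a copy of the merged wire can
  -- be taken from the fresh wire before it is merged.
  J-K-diag : ∀ {b} (i : Fin b) → (J i ⨾ K i) ≈ ((δ ⊕ 𝟙 b) ⨾ 1⊕ (J i))
  J-K-diag {suc b} zero    = frobenius-⊕ b
  J-K-diag {suc b} (suc i) =
    ((σ ⊕ 𝟙 b) ⨾ 1⊕ (J i)) ⨾ (1⊕ (K i) ⨾ (σ ⊕ 𝟙 b))
      ≈⟨ ≈-trans (⨾-assoc _ _ _) (_ ⨾⟨ pull (≈-trans (≈-sym (1⊕-⨾ _ _))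
          (≈-trans (1⊕-cong (J-K-diag i)) (1⊕-⨾ _ _))) _) ⟩
    (σ ⊕ 𝟙 b) ⨾ ((1⊕ (δ ⊕ 𝟙 b) ⨾ 2 ▷ J i) ⨾ (σ ⊕ 𝟙 b))
      ≈⟨ _ ⨾⟨ ≈-trans (⨾-assoc _ _ _) (_ ⨾⟨ ≈-sym (slide σ (J i))) ⟩
    (σ ⊕ 𝟙 b) ⨾ (1⊕ (δ ⊕ 𝟙 b) ⨾ ((σ ⊕ 𝟙 (suc b)) ⨾ 2 ▷ J i))
      ≈⟨ pull (≈-sym (δ⊕1-σσ-⊕ b)) _ ⟩
    ((δ ⊕ 𝟙 (suc b)) ⨾ (1⊕ (σ ⊕ 𝟙 b) ⨾ (σ ⊕ 𝟙 (suc b)))) ⨾ ((σ ⊕ 𝟙 (suc b)) ⨾ 2 ▷ J i)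
      ≈⟨ ≈-trans (⨾-assoc _ _ _) (_ ⨾⟨ ≈-trans (⨾-assoc _ _ _)
          (_ ⨾⟨ ≈-trans (pull (σσ-id (suc b)) _) (⨾-idˡ _))) ⟩
    (δ ⊕ 𝟙 (suc b)) ⨾ (1⊕ (σ ⊕ 𝟙 b) ⨾ 2 ▷ J i)
      ≈⟨ _ ⨾⟨ ≈-sym (1⊕-⨾ _ _) ⟩
    (δ ⊕ 𝟙 (suc b)) ⨾ 1⊕ ((σ ⊕ 𝟙 b) ⨾ 1⊕ (J i)) ∎

  -- A copy of wire `j` can be taken before the fresh wire is merged into wire `i`. For distinct
  -- wires this is naturality of crossings; for equal ones it is the crossed Frobenius law.
  J-K : ∀ {b} (i j : Fin b) → (J i ⨾ K j) ≈ (1⊕ (K j) ⨾ ((σ ⊕ 𝟙 b) ⨾ 1⊕ (J i)))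
  J-K {suc b} zero    zero    = frobenius-σ-⊕ b
  J-K {suc b} zero    (suc j) =
    (μ ⊕ 𝟙 b) ⨾ (1⊕ (K j) ⨾ (σ ⊕ 𝟙 b))
      ≈⟨ extend (slide μ (K j)) _ ⟩
    2 ▷ K j ⨾ ((μ ⊕ 𝟙 (suc b)) ⨾ (σ ⊕ 𝟙 b))
      ≈⟨ _ ⨾⟨ μ⊕1-σ-⊕ b ⟩
    2 ▷ K j ⨾ (1⊕ (σ ⊕ 𝟙 b) ⨾ ((σ ⊕ 𝟙 (suc b)) ⨾ 1⊕ (μ ⊕ 𝟙 b)))
      ≈⟨ pull (≈-sym (1⊕-⨾ _ _)) _ ⟩
    1⊕ (1⊕ (K j) ⨾ (σ ⊕ 𝟙 b)) ⨾ ((σ ⊕ 𝟙 (suc b)) ⨾ 1⊕ (μ ⊕ 𝟙 b)) ∎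
  J-K {suc b} (suc i) zero    =
    ((σ ⊕ 𝟙 b) ⨾ 1⊕ (J i)) ⨾ (δ ⊕ 𝟙 b)
      ≈⟨ ≈-trans (⨾-assoc _ _ _) (_ ⨾⟨ ≈-sym (slide δ (J i))) ⟩
    (σ ⊕ 𝟙 b) ⨾ ((δ ⊕ 𝟙 (suc b)) ⨾ 2 ▷ J i)
      ≈⟨ pull (σ-δ⊕ b) _ ⟩
    (1⊕ (δ ⊕ 𝟙 b) ⨾ ((σ ⊕ 𝟙 (suc b)) ⨾ 1⊕ (σ ⊕ 𝟙 b))) ⨾ 2 ▷ J i
      ≈⟨ ≈-trans (⨾-assoc _ _ _) (_ ⨾⟨ ≈-trans (⨾-assoc _ _ _) (_ ⨾⟨ ≈-sym (1⊕-⨾ _ _))) ⟩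
    1⊕ (δ ⊕ 𝟙 b) ⨾ ((σ ⊕ 𝟙 (suc b)) ⨾ 1⊕ ((σ ⊕ 𝟙 b) ⨾ 1⊕ (J i))) ∎
  J-K {suc b} (suc i) (suc j) =
    ((σ ⊕ 𝟙 b) ⨾ 1⊕ (J i)) ⨾ (1⊕ (K j) ⨾ (σ ⊕ 𝟙 b))
      ≈⟨ ≈-trans (⨾-assoc _ _ _) (_ ⨾⟨ pull (≈-trans (≈-sym (1⊕-⨾ _ _))
          (≈-trans (1⊕-cong (J-K i j)) (≈-trans (1⊕-⨾ _ _) (_ ⨾⟨ 1⊕-⨾ _ _)))) _) ⟩
    (σ ⊕ 𝟙 b) ⨾ ((2 ▷ K j ⨾ (1⊕ (σ ⊕ 𝟙 b) ⨾ 2 ▷ J i)) ⨾ (σ ⊕ 𝟙 b))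
      ≈⟨ _ ⨾⟨ ≈-trans (⨾-assoc _ _ _) (_ ⨾⟨ ≈-trans (⨾-assoc _ _ _) (_ ⨾⟨ ≈-sym (slide σ (J i)))) ⟩
    (σ ⊕ 𝟙 b) ⨾ (2 ▷ K j ⨾ (1⊕ (σ ⊕ 𝟙 b) ⨾ ((σ ⊕ 𝟙 (suc b)) ⨾ 2 ▷ J i)))
      ≈⟨ extend (slide σ (K j)) _ ⟩
    2 ▷ K j ⨾ ((σ ⊕ 𝟙 (suc b)) ⨾ (1⊕ (σ ⊕ 𝟙 b) ⨾ ((σ ⊕ 𝟙 (suc b)) ⨾ 2 ▷ J i)))
      ≈⟨ _ ⨾⟨ ≈-trans (_ ⨾⟨ ≈-sym (⨾-assoc _ _ _)) (pull (yang-baxter-⊕ b) _) ⟩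
    2 ▷ K j ⨾ ((1⊕ (σ ⊕ 𝟙 b) ⨾ ((σ ⊕ 𝟙 (suc b)) ⨾ 1⊕ (σ ⊕ 𝟙 b))) ⨾ 2 ▷ J i)
      ≈⟨ _ ⨾⟨ ≈-trans (⨾-assoc _ _ _) (_ ⨾⟨ ≈-trans (⨾-assoc _ _ _) (_ ⨾⟨ ≈-sym (1⊕-⨾ _ _))) ⟩
    2 ▷ K j ⨾ (1⊕ (σ ⊕ 𝟙 b) ⨾ ((σ ⊕ 𝟙 (suc b)) ⨾ 1⊕ ((σ ⊕ 𝟙 b) ⨾ 1⊕ (J i))))
      ≈⟨ pull (≈-sym (1⊕-⨾ _ _)) _ ⟩
    1⊕ (1⊕ (K j) ⨾ (σ ⊕ 𝟙 b)) ⨾ ((σ ⊕ 𝟙 (suc b)) ⨾ 1⊕ ((σ ⊕ 𝟙 b) ⨾ 1⊕ (J i))) ∎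

  -- A copy of the image of `x` can be drawn from `x` itself before `g` acts. If `x` is the head,
  -- its own merge is passed by `J-K-diag`; otherwise the merge of the head is passed by `J-K`.
  ⟦⟧-K : ∀ {a b} (g : Fin a → Fin b) (x : Fin a) → (⟦ g ⟧ ⨾ K (g x)) ≈ (K x ⨾ 1⊕ ⟦ g ⟧)
  ⟦⟧-K {suc a} {b} g zero =
    (1⊕ ⟦ g ∘ suc ⟧ ⨾ J (g zero)) ⨾ K (g zero)
      ≈⟨ ≈-trans (⨾-assoc _ _ _) (_ ⨾⟨ J-K-diag (g zero)) ⟩
    1⊕ ⟦ g ∘ suc ⟧ ⨾ ((δ ⊕ 𝟙 b) ⨾ 1⊕ (J (g zero)))
      ≈⟨ extend (≈-sym (slide δ _)) _ ⟩
    (δ ⊕ 𝟙 a) ⨾ (2 ▷ ⟦ g ∘ suc ⟧ ⨾ 1⊕ (J (g zero)))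
      ≈⟨ _ ⨾⟨ ≈-sym (1⊕-⨾ _ _) ⟩
    (δ ⊕ 𝟙 a) ⨾ 1⊕ ⟦ g ⟧ ∎
  ⟦⟧-K {suc a} {b} g (suc x) =
    (1⊕ ⟦ g ∘ suc ⟧ ⨾ J (g zero)) ⨾ K (g (suc x))
      ≈⟨ ≈-trans (⨾-assoc _ _ _) (_ ⨾⟨ J-K (g zero) (g (suc x))) ⟩
    1⊕ ⟦ g ∘ suc ⟧ ⨾ (1⊕ (K (g (suc x))) ⨾ ((σ ⊕ 𝟙 b) ⨾ 1⊕ (J (g zero))))
      ≈⟨ pull (≈-trans (≈-sym (1⊕-⨾ _ _)) (≈-trans (1⊕-cong (⟦⟧-K (g ∘ suc) x)) (1⊕-⨾ _ _))) _ ⟩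
    (1⊕ (K x) ⨾ 2 ▷ ⟦ g ∘ suc ⟧) ⨾ ((σ ⊕ 𝟙 b) ⨾ 1⊕ (J (g zero)))
      ≈⟨ ≈-trans (⨾-assoc _ _ _) (_ ⨾⟨ ≈-trans (extend (≈-sym (slide σ _)) _) (_ ⨾⟨ ≈-sym (1⊕-⨾ _ _))) ⟩
    1⊕ (K x) ⨾ ((σ ⊕ 𝟙 a) ⨾ 1⊕ ⟦ g ⟧)
      ≈⟨ ≈-sym (⨾-assoc _ _ _) ⟩
    (1⊕ (K x) ⨾ (σ ⊕ 𝟙 a)) ⨾ 1⊕ ⟦ g ⟧ ∎

-- Mirrored laws, pushout squares and bijections

module FrobeniusDual (Sig : ℕ → ℕ → Set) where
  open Wiring Sig
  open Frobenius Sig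
  private
    module Fᵂ = Frobenius (flip Sig)

  op-K : ∀ {b} (i : Fin b) → op (Fᵂ.K i) ≡ J i
  op-K {suc b} zero    = cong (μ ⊕_) (op-idₙ b)
  op-K {suc b} (suc i) = cong₂ (λ c d → (σ ⊕ d) ⨾ 1⊕ c) (op-K i) (op-idₙ b)

  ⟦⟧°-J : ∀ {a b} (g : Fin a → Fin b) (x : Fin a) → (1⊕ ⟦ g ⟧° ⨾ J x) ≈ (J (g x) ⨾ ⟦ g ⟧°)
  ⟦⟧°-J g x = ≈-sym (subst₂ _≈_ (cong₂ _⨾_ (op-K (g x)) (op-⟦⟧ g)) (cong₂ (λ c d → 1⊕ d ⨾ c) (op-K x) (op-⟦⟧ g))
    (opᵂ (Fᵂ.⟦⟧-K g x)))

  J-K-diagᵒ : ∀ {b} (i : Fin b) → (J i ⨾ K i) ≈ (1⊕ (K i) ⨾ (μ ⊕ 𝟙 b))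
  J-K-diagᵒ {b} i = subst₂ _≈_ (cong₂ _⨾_ (op-K i) (op-J i)) (cong₂ (λ c d → 1⊕ c ⨾ (μ ⊕ d)) (op-J i) (op-idₙ b))
    (opᵂ (Fᵂ.J-K-diag i))

  ⟦lift⟧ : ∀ {a b} (f : Fin a → Fin b) → ⟦ lift 1 f ⟧ ≈ (1⊕ ⟦ f ⟧)
  ⟦lift⟧ f = ≈-sym (≈-trans (⊕-cong (↦-sound Sig id1↦) ≈-refl) (≈-trans (⟦⟧-⊕ id f)
    (⟦⟧-cong {f = id {A = Fin 1} ⊎ᶠ f} {lift 1 f} λ { zero → refl ; (suc x) → refl })))

  ⟦lift⟧° : ∀ {a b} (f : Fin a → Fin b) → ⟦ lift 1 f ⟧° ≈ (1⊕ ⟦ f ⟧°)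
  ⟦lift⟧° f = ≈-sym (≈-trans (⊕-cong (↤-sound id1↤) ≈-refl) (≈-trans (⟦⟧°-⊕ id f)
    (⟦⟧°-cong {f = id {A = Fin 1} ⊎ᶠ f} {lift 1 f} λ { zero → refl ; (suc x) → refl })))

  -- Copying from `u` and merging the copy into `v` connects the two wires, hence identifies them.
  -- Speciality is the case `u = v`, where gluing a vertex to itself changes nothing.
  K⨾J : ∀ {n} (u v : Fin n) → (K u ⨾ J v) ≈ (⟦ quot (merge u v) ⟧ ⨾ ⟦ quot (merge u v) ⟧°)
  K⨾J {suc n} zero zero =
    (δ ⊕ 𝟙 n) ⨾ (μ ⊕ 𝟙 n)                  ≈⟨ ≈-sym (⊕𝟙-⨾ δ μ n) ⟩
    (δ ⨾ μ) ⊕ 𝟙 n                          ≈⟨ ⊕-cong special ≈-refl ⟩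
    𝟙 (suc n)                              ≈⟨ ≈-sym (⨾-idˡ _) ⟩
    𝟙 (suc n) ⨾ 𝟙 (suc n)                  ≈⟨ ⨾-cong (≈-sym (⟦id⟧ (suc n))) (≈-sym (⟦id⟧° (suc n))) ⟩
    ⟦ id {A = Fin (suc n)} ⟧ ⨾ ⟦ id ⟧° ∎
  K⨾J {suc n} zero (suc v) =
    (δ ⊕ 𝟙 n) ⨾ ((σ ⊕ 𝟙 _) ⨾ 1⊕ (J v))     ≈⟨ pull (≈-trans (≈-sym (⊕𝟙-⨾ δ σ n)) (⊕-cong δ-comm ≈-refl)) _ ⟩
    (δ ⊕ 𝟙 n) ⨾ 1⊕ (J v)                   ≈⟨ ≈-sym (J-K-diag v) ⟩
    J v ⨾ K v                              ≈⟨ ≈-sym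
        (⨾-cong (≈-trans (⨾-cong (1⊕-cong (⟦id⟧ n)) ≈-refl) (⨾-idˡ (J v)))
                                                (≈-trans (⨾-cong ≈-refl (1⊕-cong (⟦id⟧° n))) (⨾-idʳ (K v)))) ⟩
    ⟦ quot (merge zero (suc v)) ⟧ ⨾ ⟦ quot (merge zero (suc v)) ⟧° ∎
  K⨾J {suc n} (suc u) zero =
    (1⊕ (K u) ⨾ (σ ⊕ 𝟙 n)) ⨾ (μ ⊕ 𝟙 n)     ≈⟨ ≈-trans (⨾-assoc _ _ _)
        (_ ⨾⟨ ≈-trans (≈-sym (⊕𝟙-⨾ σ μ n)) (⊕-cong μ-comm ≈-refl)) ⟩
    1⊕ (K u) ⨾ (μ ⊕ 𝟙 n)                   ≈⟨ ≈-sym (J-K-diagᵒ u) ⟩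
    J u ⨾ K u                              ≈⟨ ≈-sym
        (⨾-cong (≈-trans (⨾-cong (1⊕-cong (⟦id⟧ n)) ≈-refl) (⨾-idˡ (J u)))
                                                (≈-trans (⨾-cong ≈-refl (1⊕-cong (⟦id⟧° n))) (⨾-idʳ (K u)))) ⟩
    ⟦ quot (merge (suc u) zero) ⟧ ⨾ ⟦ quot (merge (suc u) zero) ⟧° ∎
  K⨾J {suc n} (suc u) (suc v) =
    (1⊕ (K u) ⨾ (σ ⊕ 𝟙 n)) ⨾ ((σ ⊕ 𝟙 n) ⨾ 1⊕ (J v))
      ≈⟨ ≈-trans (⨾-assoc _ _ _) (_ ⨾⟨ ≈-trans (pull (σσ-id n) _) (⨾-idˡ _)) ⟩
    1⊕ (K u) ⨾ 1⊕ (J v)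
      ≈⟨ ≈-trans (≈-sym (1⊕-⨾ _ _)) (≈-trans (1⊕-cong (K⨾J u v)) (1⊕-⨾ _ _)) ⟩
    1⊕ ⟦ quot (merge u v) ⟧ ⨾ 1⊕ ⟦ quot (merge u v) ⟧°
      ≈⟨ ≈-sym (⨾-cong (⟦lift⟧ (quot (merge u v))) (⟦lift⟧° (quot (merge u v)))) ⟩
    ⟦ quot (merge (suc u) (suc v)) ⟧ ⨾ ⟦ quot (merge (suc u) (suc v)) ⟧° ∎

  -- The induction hypothesis turns the tail into a cospan. The remaining `K (f zero)` passes its
  -- left leg by `⟦⟧-K` and the remaining `J (g zero)` its right leg by `⟦⟧°-J`, so they meet in the
  -- middle as `K u ⨾ J v`, which glues the last pair.
  beck-chevalley : ∀ {z a b} (f : Fin z → Fin a) (g : Fin z → Fin b)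
    → let q = quot (coeq ((_↑ˡ b) ∘ f) ((a ↑ʳ_) ∘ g)) in (⟦ f ⟧° ⨾ ⟦ g ⟧) ≈ (⟦ q ∘ (_↑ˡ b) ⟧ ⨾ ⟦ q ∘ (a ↑ʳ_) ⟧°)
  beck-chevalley {zero} {a} {b} f g = ≈-sym (
    ⟦ (_↑ˡ b) ∘ id {A = Fin a} ⟧ ⨾ ⟦ (a ↑ʳ_) ∘ id {A = Fin b} ⟧°
      ≈⟨ ⨾-cong (≈-trans (⟦↑ˡ⟧ id b) (⊕-cong (⟦id⟧ a) ≈-refl)) (≈-trans (⟦↑ʳ⟧° a id) (⊕-cong ≈-refl (⟦id⟧° b))) ⟩
    (𝟙 a ⊕ ηₙ Sig b) ⨾ (εₙ Sig a ⊕ 𝟙 b)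
      ≈⟨ ≈-trans (≈-sym (interchange _ _ _ _))
          (⊕-cong (≈-trans (⨾-idˡ _) (≈-sym (⨾-idʳ _))) (≈-trans (⨾-idʳ _) (≈-sym (⨾-idˡ _)))) ⟩
    (εₙ Sig a ⨾ id0) ⊕ (id0 ⨾ ηₙ Sig b)
      ≈⟨ ≈-trans (interchange _ _ _ _) (⨾-cong (⊕-idʳ _) (⊕-idˡ _)) ⟩
    εₙ Sig a ⨾ ηₙ Sig b ∎)
  beck-chevalley {suc z} {a} {b} f g =
    (K (f zero) ⨾ 1⊕ ⟦ f ∘ suc ⟧°) ⨾ (1⊕ ⟦ g ∘ suc ⟧ ⨾ J (g zero))
      ≈⟨ ≈-trans (⨾-assoc _ _ _) (_ ⨾⟨ pull (≈-trans (≈-sym (1⊕-⨾ _ _))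
          (≈-trans (1⊕-cong (beck-chevalley (f ∘ suc) (g ∘ suc))) (1⊕-⨾ _ _))) _) ⟩
    K (f zero) ⨾ ((1⊕ ⟦ q ∘ (_↑ˡ b) ⟧ ⨾ 1⊕ ⟦ q ∘ (a ↑ʳ_) ⟧°) ⨾ J (g zero))
      ≈⟨ _ ⨾⟨ ≈-trans (⨾-assoc _ _ _) (_ ⨾⟨ ⟦⟧°-J (q ∘ (a ↑ʳ_)) (g zero)) ⟩
    K (f zero) ⨾ (1⊕ ⟦ q ∘ (_↑ˡ b) ⟧ ⨾ (J v ⨾ ⟦ q ∘ (a ↑ʳ_) ⟧°))
      ≈⟨ extend (≈-sym (⟦⟧-K (q ∘ (_↑ˡ b)) (f zero))) _ ⟩
    ⟦ q ∘ (_↑ˡ b) ⟧ ⨾ (K u ⨾ (J v ⨾ ⟦ q ∘ (a ↑ʳ_) ⟧°))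
      ≈⟨ _ ⨾⟨ ≈-trans (pull (K⨾J u v) _) (⨾-assoc _ _ _) ⟩
    ⟦ q ∘ (_↑ˡ b) ⟧ ⨾ (⟦ m ⟧ ⨾ (⟦ m ⟧° ⨾ ⟦ q ∘ (a ↑ʳ_) ⟧°))
      ≈⟨ ≈-trans (pull (⟦⟧-⨾ _ m) _) (_ ⨾⟨ ⟦⟧°-⨾ _ m) ⟩
    ⟦ m ∘ q ∘ (_↑ˡ b) ⟧ ⨾ ⟦ m ∘ q ∘ (a ↑ʳ_) ⟧° ∎
    where
    q = quot (coeq ((_↑ˡ b) ∘ f ∘ suc) ((a ↑ʳ_) ∘ g ∘ suc))
    u = q (f zero ↑ˡ b)
    v = q (a ↑ʳ g zero)
    m = quot (merge u v)

  -- Bijections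

  σ-εε : (σ ⨾ (ε ⊕ ε)) ≈ (ε ⊕ ε)
  σ-εε = ≈-trans (⨾-cong (≈-sym Σσ-11) ≈-refl) (≈-trans (≈-sym (σ-nat ε ε)) (⨾-idʳ _))

  1⊕-ε : ∀ {n m} (c : Term Sig n m) → (c ⨾ εₙ Sig m) ≈ εₙ Sig n → (1⊕ c ⨾ εₙ Sig (suc m)) ≈ εₙ Sig (suc n)
  1⊕-ε c p = ≈-trans (≈-sym (interchange _ _ _ _)) (⊕-cong (id1-idˡ ε) p)

  -- The bracketed term is the cycle that brings wire 0 to position `i`: `punchIn i` leaves position
  -- `i` free and `J i` fills it. Such a cycle is a product of crossings, and `ε ⊕ ε` absorbs each
  -- of them.
  cycle-ε : ∀ {n} (i : Fin (suc n)) → ((1⊕ ⟦ punchIn i ⟧ ⨾ J i) ⨾ εₙ Sig (suc n)) ≈ εₙ Sig (suc n)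
  cycle-ε {n} zero = ≈-trans (⨾-cong (⟦id⟧ (suc n)) ≈-refl) (⨾-idˡ _)
  cycle-ε {suc n} (suc i) =
    (1⊕ ⟦ punchIn (suc i) ⟧ ⨾ ((σ ⊕ 𝟙 (suc n)) ⨾ 1⊕ (J i))) ⨾ εₙ Sig (suc (suc n))
      ≈⟨ ⨾-cong (≈-trans (⨾-cong (1⊕-cong (≈-trans
          (⟦⟧-cong {f = punchIn (suc i)} {lift 1 (punchIn i)} (λ { zero → refl ; (suc _) → refl }))
          (⟦lift⟧ (punchIn i)))) ≈-refl)
           (≈-trans (extend (≈-sym (slide σ _)) _) (_ ⨾⟨ ≈-sym (1⊕-⨾ _ _)))) ≈-refl ⟩
    ((σ ⊕ 𝟙 n) ⨾ 1⊕ (1⊕ ⟦ punchIn i ⟧ ⨾ J i)) ⨾ εₙ Sig (suc (suc n))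
      ≈⟨ ≈-trans (⨾-assoc _ _ _) (_ ⨾⟨ ≈-trans (1⊕-ε _ (cycle-ε i)) (≈-sym (⊕-assoc ε ε (εₙ Sig n)))) ⟩
    (σ ⊕ 𝟙 n) ⨾ ((ε ⊕ ε) ⊕ εₙ Sig n)
      ≈⟨ ≈-trans (≈-sym (interchange _ _ _ _)) (≈-trans (⊕-cong σ-εε (⨾-idˡ _)) (⊕-assoc _ _ _)) ⟩
    εₙ Sig (suc (suc n)) ∎

  -- A permutation is one of the tail, `remove zero π`, followed by the cycle that puts the head
  -- into its place.
  permutation-ε : ∀ {n m} (π : Permutation n m) → (⟦ π ⟨$⟩ʳ_ ⟧ ⨾ εₙ Sig m) ≈ εₙ Sig n
  permutation-ε {zero}  {zero}  π = ⨾-idˡ _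
  permutation-ε {zero}  {suc m} π with () ← π ⟨$⟩ˡ zero
  permutation-ε {suc n} {zero}  π with () ← π ⟨$⟩ʳ zero
  permutation-ε {suc n} {suc m} π =
    (1⊕ ⟦ (π ⟨$⟩ʳ_) ∘ suc ⟧ ⨾ J i) ⨾ εₙ Sig (suc m)
      ≈⟨ ⨾-cong (⨾-cong (1⊕-cong (≈-trans (⟦⟧-cong (punchIn-permute π zero)) (≈-sym (⟦⟧-⨾ _ (punchIn i)))))
          ≈-refl) ≈-refl ⟩
    (1⊕ (⟦ remove zero π ⟨$⟩ʳ_ ⟧ ⨾ ⟦ punchIn i ⟧) ⨾ J i) ⨾ εₙ Sig (suc m)
      ≈⟨ ≈-trans (⨾-cong (push (1⊕-⨾ _ _) _) ≈-refl) (≈-trans (⨾-assoc _ _ _) (_ ⨾⟨ cycle-ε i)) ⟩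
    1⊕ ⟦ remove zero π ⟨$⟩ʳ_ ⟧ ⨾ εₙ Sig (suc m)
      ≈⟨ 1⊕-ε _ (permutation-ε (remove zero π)) ⟩
    εₙ Sig (suc n) ∎
    where
    i = π ⟨$⟩ʳ zero

  -- With `h = id` this says that `⟦ π ⟧°` inverts `⟦ π ⟧`; a general `h` allows induction on its
  -- domain. Bijectivity enters at the empty `h`, where all outputs are discarded; the step is
  -- `⟦⟧-K`.
  permutation-⟦⟧° : ∀ {n m} (π : Permutation n m) {k} (h : Fin k → Fin n) → (⟦ π ⟨$⟩ʳ_ ⟧ ⨾ ⟦ (π ⟨$⟩ʳ_) ∘ h ⟧°)
      ≈ ⟦ h ⟧°
  permutation-⟦⟧° π {zero}  h = permutation-ε π
  permutation-⟦⟧° π {suc k} h =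
    ⟦ π ⟨$⟩ʳ_ ⟧ ⨾ (K (π ⟨$⟩ʳ h zero) ⨾ 1⊕ ⟦ (π ⟨$⟩ʳ_) ∘ h ∘ suc ⟧°)  ≈⟨ extend (⟦⟧-K (π ⟨$⟩ʳ_) (h zero)) _ ⟩
    K (h zero) ⨾ (1⊕ ⟦ π ⟨$⟩ʳ_ ⟧ ⨾ 1⊕ ⟦ (π ⟨$⟩ʳ_) ∘ h ∘ suc ⟧°)      ≈⟨ _ ⨾⟨ ≈-trans (≈-sym (1⊕-⨾ _ _))
        (1⊕-cong (permutation-⟦⟧° π (h ∘ suc))) ⟩
    ⟦ h ⟧° ∎

-- Index identities for sums of three and four blocks

copair-cong : ∀ {a c} {B : Set} {f f' : Fin a → B} {g g' : Fin c → B} → f ≗ f' → g ≗ g'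
            → ∀ k → [ f , g ]′ (splitAt a k) ≡ [ f' , g' ]′ (splitAt a k)
copair-cong {a} p q k with splitAt a k
... | inj₁ i = p i
... | inj₂ j = q j

copair-eta : ∀ a c → copair {a} {c} (_↑ˡ c) (a ↑ʳ_) ≗ id
copair-eta a c = sum-ext {a} {c} (copair-↑ˡ (_↑ˡ c) (a ↑ʳ_)) (copair-↑ʳ (_↑ˡ c) (a ↑ʳ_))

copair-assoc : ∀ {a b c d} (f : Fin a → Fin d) (g : Fin b → Fin d) (h : Fin c → Fin d)
             → copair f (copair g h) ∘ castᶠ (+-assoc a b c) ≗ copair (copair f g) h
copair-assoc {a} {b} {c} f g h = sum-ext {a + b} {c}
  (sum-ext {a} {b}
    (λ i → trans (cong (copair f (copair g h))
        (cast-to ((i ↑ˡ b) ↑ˡ c) (i ↑ˡ (b + c)) (trans (toℕ-↑ˡ (i ↑ˡ b) c)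
        (trans (toℕ-↑ˡ i b) (sym (toℕ-↑ˡ i (b + c)))))))
      (trans (copair-↑ˡ f (copair g h) i) (sym (trans (copair-↑ˡ (copair f g) h (i ↑ˡ b)) (copair-↑ˡ f g i)))))
    (λ j → trans (cong (copair f (copair g h))
        (cast-to ((a ↑ʳ j) ↑ˡ c) (a ↑ʳ (j ↑ˡ c))
        (trans (toℕ-↑ˡ (a ↑ʳ j) c) (trans (toℕ-↑ʳ a j)
        (sym (trans (toℕ-↑ʳ a (j ↑ˡ c)) (cong (a +_) (toℕ-↑ˡ j c))))))))
      (trans (copair-↑ʳ f (copair g h) (j ↑ˡ c))
          (trans (copair-↑ˡ g h j) (sym (trans (copair-↑ˡ (copair f g) h (a ↑ʳ j)) (copair-↑ʳ f g j)))))))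
  (λ k → trans (cong (copair f (copair g h))
      (cast-to ((a + b) ↑ʳ k) (a ↑ʳ (b ↑ʳ k)) (trans (toℕ-↑ʳ (a + b) k)
      (trans (+-assoc a b (toℕ k)) (sym (trans (toℕ-↑ʳ a (b ↑ʳ k)) (cong (a +_) (toℕ-↑ʳ b k))))))))
      (trans (copair-↑ʳ f (copair g h) (b ↑ʳ k)) (trans (copair-↑ʳ g h k) (sym (copair-↑ʳ (copair f g) h k)))))
  where
  cast-to : ∀ (x : Fin (a + b + c)) (y : Fin (a + (b + c))) → toℕ x ≡ toℕ y → castᶠ (+-assoc a b c) x ≡ y
  cast-to x y p = toℕ-injective (trans (toℕ-cast (+-assoc a b c) x) p)

fold-natural : ∀ {a b} (f : Fin a → Fin b) → f ∘ fold a ≗ fold b ∘ (f ⊎ᶠ f)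
fold-natural f k = trans (copair-∘ f id id k) (sym (copair-⊎ᶠ id id f f k))

fold-swap : ∀ a → fold a ∘ swap a a ≗ fold a
fold-swap a k = trans (copair-∘ (fold a) (a ↑ʳ_) (_↑ˡ a) k)
  (copair-cong {a} {a} (copair-↑ʳ {a} {a} id id) (copair-↑ˡ {a} {a} id id) k)

-- The middle-four interchange: after this shuffle, multiplication on `a + b` wires splits into
-- those on `a` and on `b` wires (`fold-exchange`).
exchange : ∀ a b c d → Fin ((a + b) + (c + d)) → Fin ((a + c) + (b + d))
exchange a b c d = copair left right
  where
  left : Fin (a + b) → Fin ((a + c) + (b + d))
  left  = _⊎ᶠ_ {a} {a + c} {b} {b + d} (_↑ˡ c) (_↑ˡ d)
  right : Fin (c + d) → Fin ((a + c) + (b + d))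
  right = _⊎ᶠ_ {c} {a + c} {d} {b + d} (a ↑ʳ_) (b ↑ʳ_)

fold-exchange : ∀ a b → (fold a ⊎ᶠ fold b) ∘ exchange a b a b ≗ fold (a + b)
fold-exchange a b k = trans (copair-∘ {a + b} (fold a ⊎ᶠ fold b) _ _ k)
  (copair-cong {a + b} {a + b}
    (λ k → trans (⊎ᶠ-∘ (fold a) (fold b) (_↑ˡ a) (_↑ˡ b) k)
      (trans (⊎ᶠ-cong (copair-↑ˡ {a} {a} id id) (copair-↑ˡ {b} {b} id id) k) (id⊎ᶠid a b k)))
    (λ k → trans (⊎ᶠ-∘ (fold a) (fold b) (a ↑ʳ_) (b ↑ʳ_) k)
      (trans (⊎ᶠ-cong (copair-↑ʳ {a} {a} id id) (copair-↑ʳ {b} {b} id id) k) (id⊎ᶠid a b k)))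
    k)

-- The casts preserve values, so the four summands can be compared through toℕ.
exchange-cast : ∀ a b c d (p : (a + b) + (c + d) ≡ a + ((b + c) + d)) (q : a + ((c + b) + d) ≡ (a + c) + (b + d))
              → castᶠ q ∘ (id {A = Fin a} ⊎ᶠ (swap b c ⊎ᶠ id {A = Fin d})) ∘ castᶠ p ≗ exchange a b c d
exchange-cast a b c d p q = sum-ext {a + b} {c + d}
  (λ k → trans (sum-ext {a} {b} {f = λ k → lhs (k ↑ˡ (c + d))} {left}
    (λ i → via ((i ↑ˡ b) ↑ˡ (c + d)) (i ↑ˡ ((b + c) + d)) (i ↑ˡ ((c + b) + d)) _
      (trans (toℕ-↑ˡ (i ↑ˡ b) (c + d)) (trans (toℕ-↑ˡ i b) (sym (toℕ-↑ˡ i _))))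
      (⊎ᶠ-↑ˡ id (swap b c ⊎ᶠ id {A = Fin d}) i)
      (trans (toℕ-↑ˡ i _) (sym (trans (cong toℕ (⊎ᶠ-↑ˡ (_↑ˡ c) (_↑ˡ d) i))
          (trans (toℕ-↑ˡ (i ↑ˡ c) (b + d)) (toℕ-↑ˡ i c))))))
    (λ j → via ((a ↑ʳ j) ↑ˡ (c + d)) (a ↑ʳ ((j ↑ˡ c) ↑ˡ d)) (a ↑ʳ ((c ↑ʳ j) ↑ˡ d)) _
      (trans (toℕ-↑ˡ (a ↑ʳ j) (c + d)) (trans (toℕ-↑ʳ a j)
          (sym (trans (toℕ-↑ʳ a _) (cong (a +_) (trans (toℕ-↑ˡ (j ↑ˡ c) d) (toℕ-↑ˡ j c)))))))
      (trans (⊎ᶠ-↑ʳ id (swap b c ⊎ᶠ id {A = Fin d}) ((j ↑ˡ c) ↑ˡ d)) (cong (a ↑ʳ_)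
        (trans (⊎ᶠ-↑ˡ (swap b c) (id {A = Fin d}) (j ↑ˡ c))
            (cong (_↑ˡ d) (copair-↑ˡ {b} {c} (c ↑ʳ_) (_↑ˡ b) j)))))
      (trans (trans (toℕ-↑ʳ a _) (cong (a +_) (trans (toℕ-↑ˡ (c ↑ʳ j) d) (toℕ-↑ʳ c j))))
        (sym (trans (cong toℕ (⊎ᶠ-↑ʳ (_↑ˡ c) (_↑ˡ d) j))
            (trans (toℕ-↑ʳ (a + c) (j ↑ˡ d)) (trans (cong (a + c +_) (toℕ-↑ˡ j d)) (+-assoc a c (toℕ j))))))))
    k) (sym (copair-↑ˡ left right k)))
  (λ k → trans (sum-ext {c} {d} {f = λ k → lhs ((a + b) ↑ʳ k)} {right}
    (λ i → via ((a + b) ↑ʳ (i ↑ˡ d)) (a ↑ʳ ((b ↑ʳ i) ↑ˡ d)) (a ↑ʳ ((i ↑ˡ b) ↑ˡ d)) _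
      (trans (toℕ-↑ʳ (a + b) (i ↑ˡ d)) (trans (cong (a + b +_) (toℕ-↑ˡ i d)) (trans (+-assoc a b (toℕ i))
        (sym (trans (toℕ-↑ʳ a _) (cong (a +_) (trans (toℕ-↑ˡ (b ↑ʳ i) d) (toℕ-↑ʳ b i))))))))
      (trans (⊎ᶠ-↑ʳ id (swap b c ⊎ᶠ id {A = Fin d}) ((b ↑ʳ i) ↑ˡ d)) (cong (a ↑ʳ_)
        (trans (⊎ᶠ-↑ˡ (swap b c) (id {A = Fin d}) (b ↑ʳ i))
            (cong (_↑ˡ d) (copair-↑ʳ {b} {c} (c ↑ʳ_) (_↑ˡ b) i)))))
      (trans (trans (toℕ-↑ʳ a _) (cong (a +_) (trans (toℕ-↑ˡ (i ↑ˡ b) d) (toℕ-↑ˡ i b))))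
        (sym (trans (cong toℕ (⊎ᶠ-↑ˡ (a ↑ʳ_) (b ↑ʳ_) i)) (trans (toℕ-↑ˡ (a ↑ʳ i) (b + d)) (toℕ-↑ʳ a i))))))
    (λ j → via ((a + b) ↑ʳ (c ↑ʳ j)) (a ↑ʳ ((b + c) ↑ʳ j)) (a ↑ʳ ((c + b) ↑ʳ j)) _
      (trans (toℕ-↑ʳ (a + b) (c ↑ʳ j)) (trans (cong (a + b +_) (toℕ-↑ʳ c j)) (trans (+-assoc a b (c + toℕ j))
        (trans (cong (a +_) (sym (+-assoc b c (toℕ j))))
            (sym (trans (toℕ-↑ʳ a _) (cong (a +_) (toℕ-↑ʳ (b + c) j))))))))
      (trans (⊎ᶠ-↑ʳ id (swap b c ⊎ᶠ id {A = Fin d}) ((b + c) ↑ʳ j))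
          (cong (a ↑ʳ_) (⊎ᶠ-↑ʳ (swap b c) (id {A = Fin d}) j)))
      (trans (trans (toℕ-↑ʳ a _) (cong (a +_) (trans (toℕ-↑ʳ (c + b) j) (+-assoc c b (toℕ j)))))
        (sym (trans (cong toℕ (⊎ᶠ-↑ʳ (a ↑ʳ_) (b ↑ʳ_) j))
            (trans (toℕ-↑ʳ (a + c) (b ↑ʳ j)) (trans (cong (a + c +_) (toℕ-↑ʳ b j)) (+-assoc a c (b + toℕ j))))))))
    k) (sym (copair-↑ʳ left right k)))
  where
  mid : Fin (a + ((b + c) + d)) → Fin (a + ((c + b) + d))
  mid = id {A = Fin a} ⊎ᶠ (swap b c ⊎ᶠ id {A = Fin d})
  lhs : Fin ((a + b) + (c + d)) → Fin ((a + c) + (b + d))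
  lhs = castᶠ q ∘ mid ∘ castᶠ p
  left : Fin (a + b) → Fin ((a + c) + (b + d))
  left  = _⊎ᶠ_ {a} {a + c} {b} {b + d} (_↑ˡ c) (_↑ˡ d)
  right : Fin (c + d) → Fin ((a + c) + (b + d))
  right = _⊎ᶠ_ {c} {a + c} {d} {b + d} (a ↑ʳ_) (b ↑ʳ_)
  via : ∀ x y z w → toℕ x ≡ toℕ y → mid y ≡ z → toℕ z ≡ toℕ w → lhs x ≡ w
  via x y z w e₁ e₂ e₃ = toℕ-injective (trans (toℕ-cast q _)
      (trans (cong toℕ (trans (cong mid (toℕ-injective (trans (toℕ-cast p x) e₁))) e₂)) e₃))

-- Composition of cospans and the interpretation of terms

module _ (Sig : ℕ → ℕ → Set) where

  mapHyp : ∀ {v} (H : Hyp Sig) → (Fin (nV H) → Fin v) → Hyp Sig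
  mapHyp {v} H f = record { nV = v ; nE = nE H ; edge = mapEdge Sig f ∘ edge H }

  glueing : ∀ {n z m} (c : Cospan Sig n z) (d : Cospan Sig z m)
          → Coeq ((_↑ˡ nV (apex d)) ∘ inr c) ((nV (apex c) ↑ʳ_) ∘ inl d)
  glueing c d = coeq _ _

  -- A pushout over a discrete hypergraph identifies vertices only: the vertices form a coequalizer
  -- on the disjoint union, and all edges of both apexes are kept.
  compose : ∀ {n z m} → Cospan Sig n z → Cospan Sig z m → Cospan Sig n m
  compose c d = record
    { apex = mapHyp (_⊎H_ Sig (apex c) (apex d)) q
    ; inl  = q ∘ (_↑ˡ nV (apex d)) ∘ inl c
    ; inr  = q ∘ (nV (apex c) ↑ʳ_) ∘ inr d
    }
    where q = quot (glueing c d)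

  -- All `m + n` vertices are distinct. Outputs precede inputs, in agreement with the wires of
  -- `bend`.
  genC : ∀ {n m} → Sig n m → Cospan Sig n m
  genC {n} {m} R = record
    { apex = record { nV = m + n ; nE = 1 ; edge = λ _ → n , m , R , tabulate (m ↑ʳ_) , tabulate (_↑ˡ n) }
    ; inl  = m ↑ʳ_
    ; inr  = _↑ˡ n
    }

  interpret : ∀ {n m} → Term Sig n m → Cospan Sig n m
  interpret δ       = δC Sig 1
  interpret ε       = εC Sig 1
  interpret μ       = μC Sig 1
  interpret η       = ηC Sig 1
  interpret id0     = idC Sig 0
  interpret id1     = idC Sig 1
  interpret σ       = swapC Sig 1 1
  interpret (gen R) = genC R
  interpret (c ⨾ d) = compose (interpret c) (interpret d)
  interpret (c ⊕ d) = _⊞_ Sig (interpret c) (interpret d)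

-- States, their multiplication and their action on wires

module States (Sig : ℕ → ℕ → Set) where
  open Wiring Sig
  open Frobenius Sig
  open FrobeniusDual Sig

  ⟦⟧-cast : ∀ {a a' b} (p : a ≡ a') (f : Fin a' → Fin b) {g : Fin a → Fin b} → f ∘ castᶠ p ≗ g → ⟦ f ⟧ ≈ ⟦ g ⟧
  ⟦⟧-cast refl f e = ⟦⟧-cong (λ k → trans (cong f (sym (cast-is-id refl k))) (e k))

  ⟦⟧°-cast : ∀ {a a' b} (p : a ≡ a') (f : Fin a' → Fin b) {g : Fin a → Fin b} → f ∘ castᶠ p ≗ g → ⟦ f ⟧° ≈ ⟦ g ⟧°
  ⟦⟧°-cast refl f e = ⟦⟧°-cong (λ k → trans (cong f (sym (cast-is-id refl k))) (e k))

  ∇ : ∀ n → Term Sig (n + n) n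
  ∇ n = ⟦ fold n ⟧

  Δ : ∀ n → Term Sig n (n + n)
  Δ n = ⟦ fold n ⟧°

  ∇-natural : ∀ {a b} (f : Fin a → Fin b) → (∇ a ⨾ ⟦ f ⟧) ≈ ((⟦ f ⟧ ⊕ ⟦ f ⟧) ⨾ ∇ b)
  ∇-natural {a} {b} f = ≈-trans (⟦⟧-⨾ (fold a) f) (≈-trans (⟦⟧-cong (fold-natural f))
    (≈-sym (≈-trans (⨾-cong (⟦⟧-⊕ f f) ≈-refl) (⟦⟧-⨾ (f ⊎ᶠ f) (fold b)))))

  ⟦copair⟧ : ∀ {a b c} (f : Fin a → Fin c) (g : Fin b → Fin c) → ⟦ copair f g ⟧ ≈ ((⟦ f ⟧ ⊕ ⟦ g ⟧) ⨾ ∇ c)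
  ⟦copair⟧ f g = ≈-sym (≈-trans (⨾-cong (⟦⟧-⊕ f g) ≈-refl)
      (≈-trans (⟦⟧-⨾ (f ⊎ᶠ g) (fold _)) (⟦⟧-cong (copair-⊎ᶠ id id f g))))

  ⟦copair⟧° : ∀ {a b c} (f : Fin a → Fin c) (g : Fin b → Fin c) → ⟦ copair f g ⟧° ≈ (Δ c ⨾ (⟦ f ⟧° ⊕ ⟦ g ⟧°))
  ⟦copair⟧° f g = ≈-sym (≈-trans (⨾-cong ≈-refl (⟦⟧°-⊕ f g))
      (≈-trans (⟦⟧°-⨾ (f ⊎ᶠ g) (fold _)) (⟦⟧°-cong (copair-⊎ᶠ id id f g))))

  ∇-assoc : ∀ n → ((∇ n ⊕ 𝟙 n) ⨾ ∇ n) ≈ ((𝟙 n ⊕ ∇ n) ⨾ ∇ n)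
  ∇-assoc n =
    (∇ n ⊕ 𝟙 n) ⨾ ∇ n                ≈⟨ ⨾-cong (⊕-cong ≈-refl (≈-sym (⟦id⟧ n))) ≈-refl ⟩
    (∇ n ⊕ ⟦ id ⟧) ⨾ ∇ n             ≈⟨ ≈-sym (⟦copair⟧ (fold n) id) ⟩
    ⟦ copair (fold n) id ⟧           ≈⟨ ≈-sym
        (⟦⟧-cast (+-assoc n n n) (copair id (fold n)) (copair-assoc id id id)) ⟩
    ⟦ copair id (fold n) ⟧           ≈⟨ ⟦copair⟧ id (fold n) ⟩
    (⟦ id ⟧ ⊕ ∇ n) ⨾ ∇ n             ≈⟨ ⨾-cong (⊕-cong (⟦id⟧ n) ≈-refl) ≈-refl ⟩
    (𝟙 n ⊕ ∇ n) ⨾ ∇ n ∎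

  ∇-unitˡ : ∀ n → ((ηₙ Sig n ⊕ 𝟙 n) ⨾ ∇ n) ≈ 𝟙 n
  ∇-unitˡ n = ≈-trans (⨾-cong (⊕-cong ≈-refl (≈-sym (⟦id⟧ n))) ≈-refl)
    (≈-trans (≈-sym (⟦copair⟧ {0} (λ ()) id)) (⟦id⟧ n))

  -- The projection formula. An arbitrary `h` makes induction on `k` possible: every additional wire
  -- contributes one `J`, which passes `⟦ f ⟧°` by `⟦⟧°-J`.
  reciprocity : ∀ {k a b} (f : Fin a → Fin b) (h : Fin k → Fin a)
              → ((𝟙 k ⊕ ⟦ f ⟧°) ⨾ ⟦ copair h id ⟧) ≈ (⟦ copair (f ∘ h) id ⟧ ⨾ ⟦ f ⟧°)
  reciprocity {zero} f h =
    (id0 ⊕ ⟦ f ⟧°) ⨾ ⟦ id ⟧   ≈⟨ ⨾-cong (⊕-idˡ _) (⟦id⟧ _) ⟩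
    ⟦ f ⟧° ⨾ 𝟙 _              ≈⟨ ≈-trans (⨾-idʳ _) (≈-sym (⨾-idˡ _)) ⟩
    𝟙 _ ⨾ ⟦ f ⟧°              ≈⟨ ⨾-cong (≈-sym (⟦id⟧ _)) ≈-refl ⟩
    ⟦ id ⟧ ⨾ ⟦ f ⟧° ∎
  reciprocity {suc k} f h =
    ((id1 ⊕ 𝟙 k) ⊕ ⟦ f ⟧°) ⨾ (1⊕ ⟦ copair h id ∘ suc ⟧ ⨾ J (h zero))
      ≈⟨ ≈-trans (⨾-cong (⊕-assoc _ _ _) ≈-refl) (pull (≈-sym (1⊕-⨾ _ _)) _) ⟩
    1⊕ ((𝟙 k ⊕ ⟦ f ⟧°) ⨾ ⟦ copair h id ∘ suc ⟧) ⨾ J (h zero)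
      ≈⟨ ⨾-cong (1⊕-cong (≈-trans (⨾-cong ≈-refl (⟦⟧-cong (copair-suc h id))) (reciprocity f (h ∘ suc)))) ≈-refl ⟩
    1⊕ (⟦ copair (f ∘ h ∘ suc) id ⟧ ⨾ ⟦ f ⟧°) ⨾ J (h zero)
      ≈⟨ ≈-trans (push (1⊕-⨾ _ _) _) (_ ⨾⟨ ⟦⟧°-J f (h zero)) ⟩
    1⊕ ⟦ copair (f ∘ h ∘ suc) id ⟧ ⨾ (J (f (h zero)) ⨾ ⟦ f ⟧°)
      ≈⟨ ≈-trans (≈-sym (⨾-assoc _ _ _)) (⨾-cong
          (⨾-cong (1⊕-cong (⟦⟧-cong (λ k → sym (copair-suc (f ∘ h) id k)))) ≈-refl) ≈-refl) ⟩
    ⟦ copair (f ∘ h) id ⟧ ⨾ ⟦ f ⟧° ∎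

  -- The commutative monoid of states on n wires

  infixl 6 _∗_
  _∗_ : ∀ {n} → Term Sig 0 n → Term Sig 0 n → Term Sig 0 n
  _∗_ {n} s t = (s ⊕ t) ⨾ ∇ n

  ∗-cong : ∀ {n} {s s' t t' : Term Sig 0 n} → s ≈ s' → t ≈ t' → (s ∗ t) ≈ (s' ∗ t')
  ∗-cong p q = ⨾-cong (⊕-cong p q) ≈-refl

  ⊕-as-⨾ : ∀ {n m k} (s : Term Sig 0 n) (c : Term Sig k m) → (s ⊕ c) ≈ (c ⨾ (s ⊕ 𝟙 m))
  ⊕-as-⨾ s c = ≈-sym (≈-trans (⨾-cong (≈-sym (⊕-idˡ c)) ≈-refl) (split₂ s c))

  ∗-identityˡ : ∀ {n} (s : Term Sig 0 n) → (ηₙ Sig n ∗ s) ≈ s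
  ∗-identityˡ {n} s = ≈-trans (⨾-cong (⊕-as-⨾ (ηₙ Sig n) s) ≈-refl)
    (≈-trans (⨾-assoc _ _ _) (≈-trans (⨾-cong ≈-refl (∇-unitˡ n)) (⨾-idʳ s)))

  ∗-comm : ∀ {n} (s t : Term Sig 0 n) → (s ∗ t) ≈ (t ∗ s)
  ∗-comm {n} s t =
    (s ⊕ t) ⨾ ∇ n                     ≈⟨ _ ⨾⟨ ≈-sym
        (≈-trans (⨾-cong (↦-sound Sig (σnm↦ n n)) ≈-refl)
        (≈-trans (⟦⟧-⨾ (swap n n) (fold n)) (⟦⟧-cong (fold-swap n)))) ⟩
    (s ⊕ t) ⨾ (σnm Sig n n ⨾ ∇ n)     ≈⟨ pull (σ-nat s t) _ ⟩
    (id0 ⨾ (t ⊕ s)) ⨾ ∇ n             ≈⟨ ⨾-cong (⨾-idˡ _) ≈-refl ⟩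
    (t ⊕ s) ⨾ ∇ n ∎

  -- The last factor may have inputs, so that the same law yields associativity of `_∗_` and, with
  -- `c = 𝟙 n`, multiplicativity of `M`.
  ∇-assoc-⊕ : ∀ {k n} (s t : Term Sig 0 n) (c : Term Sig k n) → (((s ∗ t) ⊕ c) ⨾ ∇ n) ≈
      ((s ⊕ ((t ⊕ c) ⨾ ∇ n)) ⨾ ∇ n)
  ∇-assoc-⊕ {k} {n} s t c =
    (((s ⊕ t) ⨾ ∇ n) ⊕ c) ⨾ ∇ n
      ≈⟨ ⨾-cong (≈-trans (⊕-cong ≈-refl (≈-sym (⨾-idʳ c))) (interchange _ _ _ _)) ≈-refl ⟩
    (((s ⊕ t) ⊕ c) ⨾ (∇ n ⊕ 𝟙 n)) ⨾ ∇ n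
      ≈⟨ ≈-trans (⨾-assoc _ _ _) (⨾-cong (⊕-assoc s t c) (∇-assoc n)) ⟩
    (s ⊕ (t ⊕ c)) ⨾ ((𝟙 n ⊕ ∇ n) ⨾ ∇ n)
      ≈⟨ pull (≈-trans (≈-sym (interchange _ _ _ _)) (⊕-cong (⨾-idʳ s) ≈-refl)) _ ⟩
    (s ⊕ ((t ⊕ c) ⨾ ∇ n)) ⨾ ∇ n ∎

  StateMonoid : ℕ → CommutativeMonoid _ _
  StateMonoid n = record
    { Carrier = Term Sig 0 n ; _≈_ = λ s t → s ≈ t ; _∙_ = _∗_ ; ε = ηₙ Sig n
    ; isCommutativeMonoid = record
      { isMonoid = record
        { isSemigroup = record
          { isMagma = record
            { isEquivalence = record { refl = ≈-refl ; sym = ≈-sym ; trans = ≈-trans }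
            ; ∙-cong = ∗-cong }
          ; assoc = λ s t u → ∇-assoc-⊕ s t u }
        ; identity = ∗-identityˡ , λ s → ≈-trans (∗-comm s (ηₙ Sig n)) (∗-identityˡ s) }
      ; comm = ∗-comm } }

  module _ {n : ℕ} where
    open import Algebra.Properties.CommutativeMonoid.Sum (StateMonoid n) public
      using (sum; sum-permute; sum-cong-≋)

  ∗-⟦⟧ : ∀ {a b} (s t : Term Sig 0 a) (f : Fin a → Fin b) → ((s ∗ t) ⨾ ⟦ f ⟧) ≈ ((s ⨾ ⟦ f ⟧) ∗ (t ⨾ ⟦ f ⟧))
  ∗-⟦⟧ s t f = ≈-trans (⨾-assoc _ _ _) (≈-trans (_ ⨾⟨ ∇-natural f) (pull (≈-sym (interchange0 s t)) _))
    where
    interchange0 : ∀ {a b} {f : Term Sig a b} (s t : Term Sig 0 a) → ((s ⨾ f) ⊕ (t ⨾ f)) ≈ ((s ⊕ t) ⨾ (f ⊕ f))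
    interchange0 s t = interchange _ _ _ _

  sum-⟦⟧ : ∀ {k a b} (x : Fin k → Term Sig 0 a) (f : Fin a → Fin b) → (sum x ⨾ ⟦ f ⟧) ≈ sum (λ i → x i ⨾ ⟦ f ⟧)
  sum-⟦⟧ {zero}  x f = ηₙ-⟦⟧ f
  sum-⟦⟧ {suc k} x f = ≈-trans (∗-⟦⟧ _ _ f) (∗-cong ≈-refl (sum-⟦⟧ (x ∘ suc) f))

  sum-cong : ∀ {k a} {x y : Fin k → Term Sig 0 a} → (∀ i → x i ≈ y i) → sum x ≈ sum y
  sum-cong = sum-cong-≋

  sum-copair : ∀ {k l a} (x : Fin k → Term Sig 0 a) (y : Fin l → Term Sig 0 a)
             → sum (λ i → [ x , y ]′ (splitAt k i)) ≈ (sum x ∗ sum y)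
  sum-copair {zero}  x y = ≈-sym (∗-identityˡ _)
  sum-copair {suc k} {a = a} x y = ≈-trans (∗-cong ≈-refl (≈-trans (sum-cong lemma) (sum-copair (x ∘ suc) y)))
    (≈-sym (CommutativeMonoid.assoc (StateMonoid a) _ _ _))
    where
    lemma : ∀ i → [ x , y ]′ (splitAt (suc k) (suc i)) ≈ [ x ∘ suc , y ]′ (splitAt k i)
    lemma i with splitAt k i
    ... | inj₁ _ = ≈-refl
    ... | inj₂ _ = ≈-refl

  -- Multiplication by a state

  M : ∀ {n} → Term Sig 0 n → Term Sig n n
  M {n} s = (s ⊕ 𝟙 n) ⨾ ∇ n

  M-cong : ∀ {n} {s t : Term Sig 0 n} → s ≈ t → M s ≈ M t
  M-cong p = ⨾-cong (⊕-cong p ≈-refl) ≈-refl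

  ⨾-M : ∀ {k n} (c : Term Sig k n) (s : Term Sig 0 n) → (c ⨾ M s) ≈ ((s ⊕ c) ⨾ ∇ n)
  ⨾-M c s = pull (≈-sym (⊕-as-⨾ s c)) _

  M-∗ : ∀ {n} (s t : Term Sig 0 n) → (M s ⨾ M t) ≈ M (s ∗ t)
  M-∗ {n} s t = ≈-trans (⨾-M (M s) t) (≈-trans (≈-sym (∇-assoc-⊕ t s (𝟙 n))) (M-cong (∗-comm t s)))

  M-⟦⟧ : ∀ {a b} (s : Term Sig 0 a) (f : Fin a → Fin b) → (M s ⨾ ⟦ f ⟧) ≈ (⟦ f ⟧ ⨾ M (s ⨾ ⟦ f ⟧))
  M-⟦⟧ {a} {b} s f =
    ((s ⊕ 𝟙 a) ⨾ ∇ a) ⨾ ⟦ f ⟧                    ≈⟨ ≈-trans (⨾-assoc _ _ _) (_ ⨾⟨ ∇-natural f) ⟩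
    (s ⊕ 𝟙 a) ⨾ ((⟦ f ⟧ ⊕ ⟦ f ⟧) ⨾ ∇ b)          ≈⟨ pull
        (≈-trans (≈-sym (interchange _ _ _ _)) (⊕-cong ≈-refl (⨾-idˡ _))) _ ⟩
    ((s ⨾ ⟦ f ⟧) ⊕ ⟦ f ⟧) ⨾ ∇ b                  ≈⟨ ≈-sym (⨾-M ⟦ f ⟧ _) ⟩
    ⟦ f ⟧ ⨾ M (s ⨾ ⟦ f ⟧) ∎

  -- Converses do not distribute over `∇` as functions do. The projection formula takes the place of
  -- `∇-natural`, and the state is pushed along `f` on the way.
  ⟦⟧°-M : ∀ {a b} (s : Term Sig 0 a) (f : Fin a → Fin b) → (⟦ f ⟧° ⨾ M s) ≈ (M (s ⨾ ⟦ f ⟧) ⨾ ⟦ f ⟧°)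
  ⟦⟧°-M {a} {b} s f =
    ⟦ f ⟧° ⨾ M s                                   ≈⟨ ⨾-M ⟦ f ⟧° s ⟩
    (s ⊕ ⟦ f ⟧°) ⨾ ∇ a                             ≈⟨ ⨾-cong (≈-sym (split₁ s ⟦ f ⟧°)) ≈-refl ⟩
    ((s ⊕ 𝟙 b) ⨾ (𝟙 a ⊕ ⟦ f ⟧°)) ⨾ ∇ a             ≈⟨ ≈-trans (⨾-assoc _ _ _) (_ ⨾⟨ reciprocity f id) ⟩
    (s ⊕ 𝟙 b) ⨾ (⟦ copair f id ⟧ ⨾ ⟦ f ⟧°)         ≈⟨ _ ⨾⟨ ⨾-cong
        (≈-trans (⟦copair⟧ f id) (⨾-cong (⊕-cong ≈-refl (⟦id⟧ b)) ≈-refl)) ≈-refl ⟩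
    (s ⊕ 𝟙 b) ⨾ (((⟦ f ⟧ ⊕ 𝟙 b) ⨾ ∇ b) ⨾ ⟦ f ⟧°)   ≈⟨ ≈-trans (≈-sym (⨾-assoc _ _ _))
        (⨾-cong (pull (≈-sym (⊕𝟙-⨾ s ⟦ f ⟧ b)) _) ≈-refl) ⟩
    M (s ⨾ ⟦ f ⟧) ⨾ ⟦ f ⟧° ∎

  -- Bent symbols

  cap : ∀ n → Term Sig 0 (n + n)
  cap n = ηₙ Sig n ⨾ Δ n

  -- The name of `c` in the self-dual compact closed structure given by `cap`.
  bend : ∀ {n m} → Term Sig n m → Term Sig 0 (m + n)
  bend {n} c = cap n ⨾ (c ⊕ 𝟙 n)

  edgeState : ∀ {v} → Edge Sig (Fin v) → Term Sig 0 v
  edgeState (n , m , R , s , t) = bend (gen R) ⨾ ⟦ copair {m} (lookup t) (lookup s) ⟧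

  edgeState-map : ∀ {v w} (f : Fin v → Fin w) (e : Edge Sig (Fin v)) → edgeState (mapEdge Sig f e) ≈
      (edgeState e ⨾ ⟦ f ⟧)
  edgeState-map f (n , m , R , s , t) = ≈-trans (_ ⨾⟨ ⟦⟧-cong (λ k → trans
      (copair-cong {m} {n} (λ i → lookup-map i f t) (λ j → lookup-map j f s) k)
          (sym (copair-∘ {m} f (lookup t) (lookup s) k))))
    (≈-trans (_ ⨾⟨ ≈-sym (⟦⟧-⨾ (copair {m} (lookup t) (lookup s)) f)) (≈-sym (⨾-assoc _ _ _)))

  state : (H : Hyp Sig) → Term Sig 0 (nV H)
  state H = sum (edgeState ∘ edge H)

  state-map : ∀ {v} (H : Hyp Sig) (f : Fin (nV H) → Fin v) → state (mapHyp Sig H f) ≈ (state H ⨾ ⟦ f ⟧)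
  state-map H f = ≈-trans (sum-cong (λ e → edgeState-map f (edge H e))) (≈-sym (sum-⟦⟧ (edgeState ∘ edge H) f))

  readback : ∀ {n m} → Cospan Sig n m → Term Sig n m
  readback c = (⟦ inl c ⟧ ⨾ M (state (apex c))) ⨾ ⟦ inr c ⟧°

  state-⊎ : ∀ (H H' : Hyp Sig) → state (_⊎H_ Sig H H') ≈ (state H ⊕ state H')
  state-⊎ H H' =
    state (_⊎H_ Sig H H')
      ≈⟨ sum-cong lemma ⟩
    sum (λ k → [ (λ e → edgeState (edge H e) ⨾ ⟦ _↑ˡ b ⟧) , (λ e → edgeState (edge H' e) ⨾ ⟦ a ↑ʳ_ ⟧) ]′
        (splitAt (nE H) k))
      ≈⟨ sum-copair (λ e → edgeState (edge H e) ⨾ ⟦ _↑ˡ b ⟧) (λ e → edgeState (edge H' e) ⨾ ⟦ a ↑ʳ_ ⟧) ⟩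
    sum (λ e → edgeState (edge H e) ⨾ ⟦ _↑ˡ b ⟧) ∗ sum (λ e → edgeState (edge H' e) ⨾ ⟦ a ↑ʳ_ ⟧)
      ≈⟨ ∗-cong (≈-sym (sum-⟦⟧ (edgeState ∘ edge H) (_↑ˡ b))) (≈-sym (sum-⟦⟧ (edgeState ∘ edge H') (a ↑ʳ_))) ⟩
    (state H ⨾ ⟦ _↑ˡ b ⟧) ∗ (state H' ⨾ ⟦ a ↑ʳ_ ⟧)
      ≈⟨ ≈-trans (⨾-cong (interchange (state H) ι₁ (state H') ι₂) ≈-refl) (⨾-assoc _ _ _) ⟩
    (state H ⊕ state H') ⨾ ((ι₁ ⊕ ι₂) ⨾ ∇ (a + b))
      ≈⟨ _ ⨾⟨ ≈-trans (≈-sym (⟦copair⟧ (_↑ˡ b) (a ↑ʳ_))) (≈-trans (⟦⟧-cong (copair-eta a b)) (⟦id⟧ (a + b))) ⟩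
    (state H ⊕ state H') ⨾ 𝟙 (a + b)
      ≈⟨ ⨾-idʳ _ ⟩
    state H ⊕ state H' ∎
    where
    a = nV H
    b = nV H'
    ι₁ : Term Sig a (a + b)
    ι₁ = ⟦ _↑ˡ b ⟧
    ι₂ : Term Sig b (a + b)
    ι₂ = ⟦ a ↑ʳ_ ⟧
    lemma : ∀ k → edgeState (edge (_⊎H_ Sig H H') k)
          ≈ [ (λ e → edgeState (edge H e) ⨾ ⟦ _↑ˡ b ⟧) , (λ e → edgeState (edge H' e) ⨾ ⟦ a ↑ʳ_ ⟧) ]′
              (splitAt (nE H) k)
    lemma k with splitAt (nE H) k
    ... | inj₁ e = edgeState-map _ (edge H e)
    ... | inj₂ e = edgeState-map _ (edge H' e)

-- Readback inverts interpretation

module Readback (Sig : ℕ → ℕ → Set) where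
  open Wiring Sig
  open Frobenius Sig
  open FrobeniusDual Sig
  open States Sig
  private
    module Fᵂ = Frobenius (flip Sig)
    module Sᵂ = States (flip Sig)

  -- The exchange as a term

  module _ (a b c d : ℕ) where
    private
      p : (a + b) + (c + d) ≡ a + ((b + c) + d)
      p = trans (+-assoc a b (c + d)) (cong (a +_) (sym (+-assoc b c d)))
      q : a + ((c + b) + d) ≡ (a + c) + (b + d)
      q = trans (cong (a +_) (+-assoc c b d)) (sym (+-assoc a c (b + d)))

    mid : Term Sig (a + ((b + c) + d)) (a + ((c + b) + d))
    mid = 𝟙 a ⊕ (σnm Sig b c ⊕ 𝟙 d)

    -- An explicit symmetry, since `σ-nat` then gives naturality against arbitrary terms. Its
    -- readings as a function and as a converse are recovered from derivations of `↦` and `↤`.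
    X : Term Sig ((a + b) + (c + d)) ((a + c) + (b + d))
    X = cast Sig (sym p) q mid

    X-mid : X ≈ mid
    X-mid = cast-≈ (sym p) q mid

    X-⟦⟧ : X ≈ ⟦ exchange a b c d ⟧
    X-⟦⟧ = ↦-sound Sig (ext↦ (exchange-cast a b c d (sym (sym p)) q)
      (cast↦ (sym p) q (⊕↦ (idₙ↦ a) (⊕↦ (σnm↦ b c) (idₙ↦ d)))))

    X-⟦⟧° : X ≈ ⟦ exchange a c b d ⟧°
    X-⟦⟧° = ↤-sound (ext↤ (exchange-cast a c b d (sym q) (sym p))
      (cast↤ (sym p) q (⊕↤ (idₙ↤ a) (⊕↤ (σnm↤ b c) (idₙ↤ d)))))

  module _ {a b c d a' b' c' d' : ℕ} (f : Term Sig a a') (g : Term Sig b b') (h : Term Sig c c')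
      (k : Term Sig d d') where
    X-natural : (((f ⊕ g) ⊕ (h ⊕ k)) ⨾ X a' b' c' d') ≈ (X a b c d ⨾ ((f ⊕ h) ⊕ (g ⊕ k)))
    X-natural =
      ((f ⊕ g) ⊕ (h ⊕ k)) ⨾ X a' b' c' d'
        ≈⟨ ⨾-cong (bracket f g h k) (X-mid a' b' c' d') ⟩
      (f ⊕ ((g ⊕ h) ⊕ k)) ⨾ mid a' b' c' d'
        ≈⟨ ≈-trans (≈-sym (interchange _ _ _ _)) (⊕-cong (≈-trans (⨾-idʳ f) (≈-sym (⨾-idˡ f)))
             (≈-trans (≈-sym (interchange _ _ _ _)) (≈-trans
                 (⊕-cong (σ-nat g h) (≈-trans (⨾-idʳ k) (≈-sym (⨾-idˡ k)))) (interchange _ _ _ _)))) ⟩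
      (𝟙 a ⨾ f) ⊕ ((σnm Sig b c ⊕ 𝟙 d) ⨾ ((h ⊕ g) ⊕ k))
        ≈⟨ interchange _ _ _ _ ⟩
      mid a b c d ⨾ (f ⊕ ((h ⊕ g) ⊕ k))
        ≈⟨ ⨾-cong (≈-sym (X-mid a b c d)) (≈-sym (bracket f h g k)) ⟩
      X a b c d ⨾ ((f ⊕ h) ⊕ (g ⊕ k)) ∎
      where
      bracket : ∀ {a b c d a' b' c' d'} (f : Term Sig a a') (g : Term Sig b b') (h : Term Sig c c')
          (k : Term Sig d d')
              → ((f ⊕ g) ⊕ (h ⊕ k)) ≈ (f ⊕ ((g ⊕ h) ⊕ k))
      bracket f g h k = ≈-trans (⊕-assoc f g (h ⊕ k)) (⊕-cong ≈-refl (≈-sym (⊕-assoc g h k)))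

  ∇-+ : ∀ a b → ∇ (a + b) ≈ (X a b a b ⨾ (∇ a ⊕ ∇ b))
  ∇-+ a b = ≈-sym (≈-trans (⨾-cong (X-⟦⟧ a b a b) (⟦⟧-⊕ (fold a) (fold b)))
    (≈-trans (⟦⟧-⨾ (exchange a b a b) (fold a ⊎ᶠ fold b)) (⟦⟧-cong (fold-exchange a b))))

  M-⊕ : ∀ {a b} (s : Term Sig 0 a) (t : Term Sig 0 b) → M (s ⊕ t) ≈ (M s ⊕ M t)
  M-⊕ {a} {b} s t =
    ((s ⊕ t) ⊕ 𝟙 (a + b)) ⨾ ∇ (a + b)
      ≈⟨ ⨾-cong (⊕-cong ≈-refl (≈-sym (𝟙-⊕ a b))) (∇-+ a b) ⟩
    ((s ⊕ t) ⊕ (𝟙 a ⊕ 𝟙 b)) ⨾ (X a b a b ⨾ (∇ a ⊕ ∇ b))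
      ≈⟨ ≈-trans (pull (X-natural s t (𝟙 a) (𝟙 b)) _) (⨾-assoc _ _ _) ⟩
    X 0 0 a b ⨾ (((s ⊕ 𝟙 a) ⊕ (t ⊕ 𝟙 b)) ⨾ (∇ a ⊕ ∇ b))
      -- States have no inputs: with the first two blocks empty, the exchange is the identity.
      ≈⟨ ⨾-cong (≈-trans (X-⟦⟧ 0 0 a b) (≈-trans (⟦⟧-cong {f = exchange 0 0 a b} {id} (copair-eta a b))
          (⟦id⟧ (a + b)))) ≈-refl ⟩
    𝟙 (a + b) ⨾ (((s ⊕ 𝟙 a) ⊕ (t ⊕ 𝟙 b)) ⨾ (∇ a ⊕ ∇ b))
      ≈⟨ ≈-trans (⨾-idˡ _) (≈-sym (interchange _ _ _ _)) ⟩
    M s ⊕ M t ∎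

  cap-⊕ : ∀ n → ((cap n ⊕ cap n) ⨾ X n n n n) ≈ cap (n + n)
  cap-⊕ n =
    ((ηₙ Sig n ⨾ Δ n) ⊕ (ηₙ Sig n ⨾ Δ n)) ⨾ X n n n n
      ≈⟨ ≈-trans (⨾-cong (interchange _ _ _ _) ≈-refl) (⨾-assoc _ _ _) ⟩
    (ηₙ Sig n ⊕ ηₙ Sig n) ⨾ ((Δ n ⊕ Δ n) ⨾ X n n n n)
      ≈⟨ ⨾-cong (ηₙ-⊕ n n) (≈-trans (⨾-cong (⟦⟧°-⊕ (fold n) (fold n)) (X-⟦⟧° n n n n))
           (≈-trans (⟦⟧°-⨾ (exchange n n n n) (fold n ⊎ᶠ fold n)) (⟦⟧°-cong (fold-exchange n n)))) ⟩
    cap (n + n) ∎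

  reciprocityᵒ : ∀ {k a b} (f : Fin a → Fin b) (h : Fin k → Fin a)
               → (⟦ copair h id ⟧° ⨾ (𝟙 k ⊕ ⟦ f ⟧)) ≈ (⟦ f ⟧ ⨾ ⟦ copair (f ∘ h) id ⟧°)
  reciprocityᵒ {k} f h = subst₂ _≈_
    (cong₂ _⨾_ (op-⟦⟧ (copair h id)) (cong₂ _⊕_ (op-idₙ k) (op-⟦⟧° f)))
    (cong₂ _⨾_ (op-⟦⟧° f) (op-⟦⟧ (copair (f ∘ h) id)))
    (opᵂ (Sᵂ.reciprocity f h))
    where
    op-⟦⟧° : ∀ {a b} (f : Fin a → Fin b) → op (Fᵂ.⟦ f ⟧°) ≡ ⟦ f ⟧
    op-⟦⟧° {zero}  {b} f = op-εₙ b
      where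
      op-εₙ : ∀ b → op (εₙ (flip Sig) b) ≡ ηₙ Sig b
      op-εₙ zero    = refl
      op-εₙ (suc b) = cong (η ⊕_) (op-εₙ b)
    op-⟦⟧° {suc a} f = cong₂ (λ c d → 1⊕ d ⨾ c) (op-K (f zero)) (op-⟦⟧° (f ∘ suc))

  -- Bending turns a function into its converse: `⟦ f ⟧°` is the transpose of `⟦ f ⟧` in the compact
  -- structure.
  cap-slide : ∀ {a b} (f : Fin b → Fin a) → (cap b ⨾ (𝟙 b ⊕ ⟦ f ⟧)) ≈ (cap a ⨾ (⟦ f ⟧° ⊕ 𝟙 a))
  cap-slide {a} {b} f =
    (ηₙ Sig b ⨾ Δ b) ⨾ (𝟙 b ⊕ ⟦ f ⟧)
      ≈⟨ ≈-trans (⨾-assoc _ _ _) (_ ⨾⟨ reciprocityᵒ f id) ⟩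
    ηₙ Sig b ⨾ (⟦ f ⟧ ⨾ ⟦ copair f id ⟧°)
      ≈⟨ pull (ηₙ-⟦⟧ f) _ ⟩
    ηₙ Sig a ⨾ ⟦ copair f id ⟧°
      ≈⟨ _ ⨾⟨ ≈-trans (⟦copair⟧° f id) (⨾-cong ≈-refl (⊕-cong ≈-refl (⟦id⟧° a))) ⟩
    ηₙ Sig a ⨾ (Δ a ⨾ (⟦ f ⟧° ⊕ 𝟙 a))
      ≈⟨ ≈-sym (⨾-assoc _ _ _) ⟩
    cap a ⨾ (⟦ f ⟧° ⊕ 𝟙 a) ∎

  -- The product of names is the name of the convolution. Outputs are multiplied directly, while the
  -- `∇ n` on the bent inputs becomes `Δ n` when slid round the cap. The right-hand side is the
  -- shape that the lax law for `δ` produces.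
  bend-∗ : ∀ {n m} (c d : Term Sig n m) → (bend c ∗ bend d) ≈ bend (Δ n ⨾ ((c ⊕ d) ⨾ ∇ m))
  bend-∗ {n} {m} c d =
    (bend c ⊕ bend d) ⨾ ∇ (m + n)
      ≈⟨ ⨾-cong (interchange _ _ _ _) (∇-+ m n) ⟩
    ((cap n ⊕ cap n) ⨾ ((c ⊕ 𝟙 n) ⊕ (d ⊕ 𝟙 n))) ⨾ (X m n m n ⨾ (∇ m ⊕ ∇ n))
      ≈⟨ ≈-trans (⨾-assoc _ _ _) (_ ⨾⟨ ≈-trans (pull (X-natural c (𝟙 n) d (𝟙 n)) _) (⨾-assoc _ _ _)) ⟩
    (cap n ⊕ cap n) ⨾ (X n n n n ⨾ (((c ⊕ d) ⊕ (𝟙 n ⊕ 𝟙 n)) ⨾ (∇ m ⊕ ∇ n)))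
      ≈⟨ pull (cap-⊕ n) _ ⟩
    cap (n + n) ⨾ (((c ⊕ d) ⊕ (𝟙 n ⊕ 𝟙 n)) ⨾ (∇ m ⊕ ∇ n))
      ≈⟨ _ ⨾⟨ ≈-trans (≈-sym (interchange _ _ _ _))
          (⊕-cong ≈-refl (≈-trans (⨾-cong (𝟙-⊕ n n) ≈-refl) (⨾-idˡ _))) ⟩
    cap (n + n) ⨾ (e ⊕ ∇ n)
      ≈⟨ _ ⨾⟨ ≈-sym (split₂ e (∇ n)) ⟩
    cap (n + n) ⨾ ((𝟙 (n + n) ⊕ ∇ n) ⨾ (e ⊕ 𝟙 n))
      ≈⟨ ≈-trans (pull (cap-slide (fold n)) _) (⨾-assoc _ _ _) ⟩
    cap n ⨾ ((Δ n ⊕ 𝟙 n) ⨾ (e ⊕ 𝟙 n))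
      ≈⟨ _ ⨾⟨ ≈-sym (⊕𝟙-⨾ _ _ n) ⟩
    bend (Δ n ⨾ e) ∎
    where
    e : Term Sig (n + n) m
    e = (c ⊕ d) ⨾ ∇ m

  -- Straightening a bent wire

  cup : ∀ n → Term Sig (n + n) 0
  cup n = ∇ n ⨾ εₙ Sig n

  -- The cast gives it the source `(k + n) + n`, the bracketing of the terms after which it is
  -- composed.
  ⊕cup : ∀ k n → Term Sig ((k + n) + n) k
  ⊕cup k n = cast Sig (sym (+-assoc k n n)) (+-identityʳ k) (𝟙 k ⊕ cup n)

  ⊕cup-≈ : ∀ k n → ⊕cup k n ≈ (𝟙 k ⊕ cup n)
  ⊕cup-≈ k n = cast-≈ (sym (+-assoc k n n)) (+-identityʳ k) (𝟙 k ⊕ cup n)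

  ⊕cup-natural : ∀ {k m} (c : Term Sig k m) n → (((c ⊕ 𝟙 n) ⊕ 𝟙 n) ⨾ ⊕cup m n) ≈ (⊕cup k n ⨾ c)
  ⊕cup-natural {k} {m} c n =
    ((c ⊕ 𝟙 n) ⊕ 𝟙 n) ⨾ ⊕cup m n
      ≈⟨ ⨾-cong (≈-trans (⊕-assoc _ _ _) (⊕-cong ≈-refl (𝟙-⊕ n n))) (⊕cup-≈ m n) ⟩
    (c ⊕ 𝟙 (n + n)) ⨾ (𝟙 m ⊕ cup n)
      ≈⟨ ≈-trans (split₁ c (cup n)) (≈-sym (split₂ c (cup n))) ⟩
    (𝟙 k ⊕ cup n) ⨾ (c ⊕ id0)
      ≈⟨ ⨾-cong (≈-sym (⊕cup-≈ k n)) (⊕-idʳ c) ⟩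
    ⊕cup k n ⨾ c ∎

  -- `reciprocityᵒ` moves the multiplication in front of the copying; afterwards the unit cancels
  -- `∇` and the counit cancels `Δ`.
  snake : ∀ n → ((cap n ⊕ 𝟙 n) ⨾ ⊕cup n n) ≈ 𝟙 n
  snake n =
    ((ηₙ Sig n ⨾ Δ n) ⊕ 𝟙 n) ⨾ ⊕cup n n
      ≈⟨ ⨾-cong (≈-trans (⊕𝟙-⨾ _ _ n) (⨾-cong ≈-refl Δ⊕𝟙)) (⊕cup-≈ n n) ⟩
    ((ηₙ Sig n ⊕ 𝟙 n) ⨾ ⟦ copair (_↑ˡ n) id ⟧°) ⨾ (𝟙 n ⊕ (∇ n ⨾ εₙ Sig n))
      ≈⟨ ≈-trans (⨾-assoc _ _ _) (_ ⨾⟨ ≈-trans (_ ⨾⟨ 𝟙⊕-⨾ n _ _) (pull (reciprocityᵒ (fold n) (_↑ˡ n)) _)) ⟩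
    (ηₙ Sig n ⊕ 𝟙 n) ⨾ ((∇ n ⨾ ⟦ copair (fold n ∘ (_↑ˡ n)) id ⟧°) ⨾ (𝟙 n ⊕ εₙ Sig n))
      ≈⟨ _ ⨾⟨ ⨾-cong (_ ⨾⟨ ⟦⟧°-cong (copair-cong {n} {n} (copair-↑ˡ {n} {n} id id) (λ _ → refl))) ≈-refl ⟩
    (ηₙ Sig n ⊕ 𝟙 n) ⨾ ((∇ n ⨾ Δ n) ⨾ (𝟙 n ⊕ εₙ Sig n))
      ≈⟨ ≈-trans (_ ⨾⟨ ⨾-assoc _ _ _) (pull (∇-unitˡ n) _) ⟩
    𝟙 n ⨾ (Δ n ⨾ (𝟙 n ⊕ εₙ Sig n))
      ≈⟨ ≈-trans (⨾-idˡ _) (⨾-cong ≈-refl (⊕-cong (≈-sym (⟦id⟧° n)) ≈-refl)) ⟩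
    Δ n ⨾ (⟦ id ⟧° ⊕ εₙ Sig n)
      ≈⟨ ⨾-cong ≈-refl (≈-sym (⟦↑ˡ⟧° id n)) ⟩
    Δ n ⨾ ⟦ _↑ˡ n ⟧°
      ≈⟨ ≈-trans (⟦⟧°-⨾ (_↑ˡ n) (fold n)) (≈-trans (⟦⟧°-cong (copair-↑ˡ {n} {n} id id)) (⟦id⟧° n)) ⟩
    𝟙 n ∎
    where
    Δ⊕𝟙 : (Δ n ⊕ 𝟙 n) ≈ ⟦ copair (_↑ˡ n) id ⟧°
    Δ⊕𝟙 =
      Δ n ⊕ 𝟙 n                          ≈⟨ ⊕-cong ≈-refl (≈-sym (⟦id⟧° n)) ⟩
      Δ n ⊕ ⟦ id ⟧°                      ≈⟨ ⟦⟧°-⊕ (fold n) id ⟩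
      ⟦ fold n ⊎ᶠ id ⟧°                  ≈⟨ ≈-sym
          (⟦⟧°-cast (+-assoc n n n) (copair (_↑ˡ n) (copair (_↑ˡ n) (n ↑ʳ_)))
                                              (λ k → trans (copair-assoc (_↑ˡ n) (_↑ˡ n) (n ↑ʳ_) k)
                                                (copair-cong {n + n} {n} (λ i → sym (copair-∘ (_↑ˡ n) id id
                                                    i)) (λ _ → refl) k))) ⟩
      ⟦ copair (_↑ˡ n) (copair (_↑ˡ n) (n ↑ʳ_)) ⟧°
        ≈⟨ ⟦⟧°-cong (copair-cong {n} {n + n} (λ _ → refl) (copair-eta n n)) ⟩
      ⟦ copair (_↑ˡ n) id ⟧° ∎

  -- Compatibility of readback with the structure

  -- The left leg merges the inputs with the bent wires of the symbol and the right leg discards the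
  -- result. Together they form a cup, which straightens the bend.
  readback-gen : ∀ {n m} (R : Sig n m) → readback (genC Sig R) ≈ gen R
  readback-gen {n} {m} R =
    (⟦ m ↑ʳ_ ⟧ ⨾ M (state (apex (genC Sig R)))) ⨾ ⟦ _↑ˡ n ⟧°
      ≈⟨ ⨾-cong (≈-trans (_ ⨾⟨ M-cong state-gen) (⨾-M ⟦ m ↑ʳ_ ⟧ r)) ≈-refl ⟩
    ((r ⊕ ⟦ m ↑ʳ_ ⟧) ⨾ ∇ (m + n)) ⨾ ⟦ _↑ˡ n ⟧°
      ≈⟨ ⨾-cong (≈-trans (⨾-cong (≈-sym (split₁ r ⟦ m ↑ʳ_ ⟧)) ≈-refl) (⨾-assoc _ _ _)) ≈-refl ⟩
    ((r ⊕ 𝟙 n) ⨾ ((𝟙 (m + n) ⊕ ⟦ m ↑ʳ_ ⟧) ⨾ ∇ (m + n))) ⨾ ⟦ _↑ˡ n ⟧°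
      ≈⟨ ≈-trans (⨾-assoc _ _ _) (_ ⨾⟨ join) ⟩
    (r ⊕ 𝟙 n) ⨾ ⊕cup m n
      ≈⟨ ≈-trans (⨾-cong (⊕𝟙-⨾ _ _ n) ≈-refl) (⨾-assoc _ _ _) ⟩
    (cap n ⊕ 𝟙 n) ⨾ (((gen R ⊕ 𝟙 n) ⊕ 𝟙 n) ⨾ ⊕cup m n)
      ≈⟨ _ ⨾⟨ ⊕cup-natural (gen R) n ⟩
    (cap n ⊕ 𝟙 n) ⨾ (⊕cup n n ⨾ gen R)
      ≈⟨ ≈-trans (pull (snake n) _) (⨾-idˡ _) ⟩
    gen R ∎
    where
    r : Term Sig 0 (m + n)
    r = bend (gen R)
    state-gen : state (apex (genC Sig R)) ≈ r
    state-gen = ≈-trans (∗-comm _ _) (≈-trans (∗-identityˡ _) (≈-trans (_ ⨾⟨ ≈-trans (⟦⟧-cong (λ k → trans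
      (copair-cong {m} {n} (lookup∘tabulate (_↑ˡ n)) (lookup∘tabulate (m ↑ʳ_)) k) (copair-eta m n k)))
          (⟦id⟧ (m + n))) (⨾-idʳ r)))
    join : (((𝟙 (m + n) ⊕ ⟦ m ↑ʳ_ ⟧) ⨾ ∇ (m + n)) ⨾ ⟦ _↑ˡ n ⟧°) ≈ ⊕cup m n
    join =
      ((𝟙 (m + n) ⊕ ⟦ m ↑ʳ_ ⟧) ⨾ ∇ (m + n)) ⨾ ⟦ _↑ˡ n ⟧°
        ≈⟨ ⨾-cong (≈-trans (⨾-cong (⊕-cong (≈-sym (⟦id⟧ (m + n))) ≈-refl) ≈-refl)
            (≈-trans (≈-sym (⟦copair⟧ id (m ↑ʳ_)))
             (≈-trans (⟦⟧-cong (copair-cong {m + n} {n} (λ k → sym (copair-eta m n k)) (λ _ → refl)))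
             (≈-trans (≈-sym (⟦⟧-cast (+-assoc m n n) (copair (_↑ˡ n) (copair (m ↑ʳ_) (m ↑ʳ_)))
                 (copair-assoc (_↑ˡ n) (m ↑ʳ_) (m ↑ʳ_))))
             (≈-trans (⟦⟧-cong (copair-cong {m} {n + n} (λ _ → refl) (λ k → sym (copair-∘ (m ↑ʳ_) id id k))))
               (≈-sym (≈-trans (⊕-cong (≈-sym (⟦id⟧ m)) ≈-refl) (⟦⟧-⊕ id (fold n)))))))))
             (≈-trans (⟦↑ˡ⟧° id n) (⊕-cong (⟦id⟧° m) ≈-refl)) ⟩
      (𝟙 m ⊕ ∇ n) ⨾ (𝟙 m ⊕ εₙ Sig n)
        ≈⟨ ≈-sym (𝟙⊕-⨾ m _ _) ⟩
      𝟙 m ⊕ cup n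
        ≈⟨ ≈-sym (⊕cup-≈ m n) ⟩
      ⊕cup m n ∎

  readback-⊞ : ∀ {n m p q} (c : Cospan Sig n m) (d : Cospan Sig p q) → readback (_⊞_ Sig c d) ≈
      (readback c ⊕ readback d)
  readback-⊞ c d =
    (⟦ inl c ⊎ᶠ inl d ⟧ ⨾ M (state (_⊎H_ Sig (apex c) (apex d)))) ⨾ ⟦ inr c ⊎ᶠ inr d ⟧°
      ≈⟨ ⨾-cong (⨾-cong (≈-sym (⟦⟧-⊕ (inl c) (inl d))) (≈-trans (M-cong (state-⊎ (apex c) (apex d))) (M-⊕ _ _)))
                (≈-sym (⟦⟧°-⊕ (inr c) (inr d))) ⟩
    ((⟦ inl c ⟧ ⊕ ⟦ inl d ⟧) ⨾ (M (state (apex c)) ⊕ M (state (apex d)))) ⨾ (⟦ inr c ⟧° ⊕ ⟦ inr d ⟧°)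
      ≈⟨ ≈-trans (⨾-cong (≈-sym (interchange _ _ _ _)) ≈-refl) (≈-sym (interchange _ _ _ _)) ⟩
    readback c ⊕ readback d ∎

  -- After Beck-Chevalley the state of `c` advances over the leg `p₁` by `M-⟦⟧` and that of `d`
  -- retreats over `p₂` by `⟦⟧°-M`. They meet on the vertices of the pushout, where their product is
  -- the state of the composite.
  readback-compose : ∀ {n z m} (c : Cospan Sig n z) (d : Cospan Sig z m) → readback (compose Sig c d) ≈
      (readback c ⨾ readback d)
  readback-compose c d = ≈-sym (
    ((⟦ inl c ⟧ ⨾ M s) ⨾ ⟦ inr c ⟧°) ⨾ ((⟦ inl d ⟧ ⨾ M t) ⨾ ⟦ inr d ⟧°)
      ≈⟨ ≈-trans (⨾-assoc _ _ _) (_ ⨾⟨ ≈-trans (_ ⨾⟨ ⨾-assoc _ _ _) (pull (beck-chevalley (inr c) (inl d)) _)) ⟩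
    (⟦ inl c ⟧ ⨾ M s) ⨾ ((⟦ p₁ ⟧ ⨾ ⟦ p₂ ⟧°) ⨾ (M t ⨾ ⟦ inr d ⟧°))
      ≈⟨ _ ⨾⟨ ≈-trans (⨾-assoc _ _ _) (_ ⨾⟨ ≈-trans (pull (⟦⟧°-M t p₂) _)
          (≈-trans (⨾-assoc _ _ _) (_ ⨾⟨ ⟦⟧°-⨾ (inr d) p₂))) ⟩
    (⟦ inl c ⟧ ⨾ M s) ⨾ (⟦ p₁ ⟧ ⨾ (M (t ⨾ ⟦ p₂ ⟧) ⨾ ⟦ p₂ ∘ inr d ⟧°))
      ≈⟨ ≈-trans (⨾-assoc _ _ _) (_ ⨾⟨ ≈-trans (pull (M-⟦⟧ s p₁) _) (⨾-assoc _ _ _)) ⟩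
    ⟦ inl c ⟧ ⨾ (⟦ p₁ ⟧ ⨾ (M (s ⨾ ⟦ p₁ ⟧) ⨾ (M (t ⨾ ⟦ p₂ ⟧) ⨾ ⟦ p₂ ∘ inr d ⟧°)))
      ≈⟨ ≈-trans (pull (⟦⟧-⨾ (inl c) p₁) _) (_ ⨾⟨ pull (≈-trans (M-∗ _ _) (M-cong (≈-sym merged))) _) ⟩
    ⟦ p₁ ∘ inl c ⟧ ⨾ (M (state (apex (compose Sig c d))) ⨾ ⟦ p₂ ∘ inr d ⟧°)
      ≈⟨ ≈-sym (⨾-assoc _ _ _) ⟩
    readback (compose Sig c d) ∎)
    where
    A = apex c
    B = apex d
    s = state A
    t = state B
    q = quot (glueing Sig c d)
    p₁ = q ∘ (_↑ˡ nV B)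
    p₂ = q ∘ (nV A ↑ʳ_)
    merged : state (apex (compose Sig c d)) ≈ ((s ⨾ ⟦ p₁ ⟧) ∗ (t ⨾ ⟦ p₂ ⟧))
    merged =
      state (mapHyp Sig (_⊎H_ Sig A B) q)
        ≈⟨ ≈-trans (state-map (_⊎H_ Sig A B) q) (⨾-cong (state-⊎ A B)
            (⟦⟧-cong (λ k → trans (cong q (sym (copair-eta (nV A) (nV B) k))) (copair-∘ {nV A} q _ _ k)))) ⟩
      (s ⊕ t) ⨾ ⟦ copair p₁ p₂ ⟧
        ≈⟨ _ ⨾⟨ ⟦copair⟧ p₁ p₂ ⟩
      (s ⊕ t) ⨾ ((⟦ p₁ ⟧ ⊕ ⟦ p₂ ⟧) ⨾ ∇ _)
        ≈⟨ pull (≈-sym (interchange _ _ _ _)) _ ⟩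
      (s ⨾ ⟦ p₁ ⟧) ∗ (t ⨾ ⟦ p₂ ⟧) ∎

  M-η : ∀ n → M (ηₙ Sig n) ≈ 𝟙 n
  M-η = ∇-unitˡ

  readback-interpret : ∀ {n m} (c : Term Sig n m) → readback (interpret Sig c) ≈ c
  readback-interpret δ = ≈-trans (⨾-cong (≈-trans (⨾-cong (⟦id⟧ 1) (M-η 1)) (⨾-idˡ _))
      (≈-sym (↤-sound (ext↤ {f = to1} {fold 1} (λ { zero → refl ; (suc zero) → refl }) δ↤)))) (⨾-idˡ δ)
  readback-interpret ε = ≈-trans (⨾-cong (≈-trans (⨾-cong (⟦id⟧ 1) (M-η 1)) (⨾-idˡ _)) (⊕-idʳ ε))
      (≈-trans (⨾-cong (≈-refl {c = 𝟙 1}) ≈-refl) (⨾-idˡ ε))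
  readback-interpret μ = ≈-trans (⨾-cong (≈-trans
      (⨾-cong (≈-sym (↦-sound Sig (ext↦ {f = to1} {fold 1} (λ { zero → refl ; (suc zero) → refl }) μ↦)))
      (M-η 1)) (⨾-idʳ μ)) (⟦id⟧° 1)) (⨾-idʳ μ)
  readback-interpret η = ≈-trans (⨾-cong (≈-trans (⨾-cong (⊕-idʳ η) (M-η 1)) (⨾-idʳ η)) (⟦id⟧° 1)) (⨾-idʳ η)
  readback-interpret id0 = ≈-trans (⨾-cong (≈-trans (⨾-cong (≈-refl {c = id0}) (M-η 0)) (⨾-idˡ id0))
      (⟦id⟧° 0)) (⨾-idˡ id0)
  readback-interpret id1 = ≈-trans (⨾-cong (≈-trans (⨾-cong (≈-trans (⟦id⟧ 1) 𝟙1) (M-η 1)) (⨾-idʳ id1))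
      (⟦id⟧° 1)) (⨾-idʳ id1)
  readback-interpret σ = ≈-trans (⨾-cong (≈-trans (⨾-cong (≈-sym (↦-sound Sig σ↦)) (M-η 2)) (⨾-idʳ σ))
      (⟦id⟧° 2)) (⨾-idʳ σ)
  readback-interpret (gen R) = readback-gen R
  readback-interpret (c ⨾ d) = ≈-trans (readback-compose (interpret Sig c) (interpret Sig d))
      (⨾-cong (readback-interpret c) (readback-interpret d))
  readback-interpret (c ⊕ d) = ≈-trans (readback-⊞ (interpret Sig c) (interpret Sig d))
      (⊕-cong (readback-interpret c) (readback-interpret d))

-- Readback, homomorphisms and isomorphisms

module Monotonicity (Sig : ℕ → ℕ → Set) where
  open Wiring Sig
  open Frobenius Sig
  open FrobeniusDual Sig
  open States Sig
  open Readback Sig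

  infix 4 _≤ₜ_
  _≤ₜ_ : ∀ {n m n' m'} → Term Sig n m → Term Sig n' m' → Set
  _≤ₜ_ = Defs._≤ₜ_ Sig

  ≤-refl : ∀ {n m} {c : Term Sig n m} → c ≤ₜ c
  ≤-refl = ≈⇒≤ ≈-refl

  infixr 2 _≤⟨_⟩_ _≈≤⟨_⟩_
  infix  3 _■
  _≤⟨_⟩_ : ∀ {n m n' m' n'' m''} (c : Term Sig n m) {d : Term Sig n' m'} {e : Term Sig n'' m''} → c ≤ₜ d → d
      ≤ₜ e → c ≤ₜ e
  c ≤⟨ p ⟩ q = ≤-trans p q

  _≈≤⟨_⟩_ : ∀ {n m n' m' n'' m''} (c : Term Sig n m) {d : Term Sig n' m'} {e : Term Sig n'' m''} → c ≈ d → d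
      ≤ₜ e → c ≤ₜ e
  c ≈≤⟨ p ⟩ q = ≤-trans (≈⇒≤ p) q

  _■ : ∀ {n m} (c : Term Sig n m) → c ≤ₜ c
  c ■ = ≤-refl

  J⨾K≤𝟙 : ∀ {b} (i : Fin b) → (J i ⨾ K i) ≤ₜ 𝟙 (suc b)
  J⨾K≤𝟙 {suc b} zero =
    (μ ⊕ 𝟙 b) ⨾ (δ ⊕ 𝟙 b)  ≈≤⟨ ≈-sym (⊕𝟙-⨾ μ δ b) ⟩
    (μ ⨾ δ) ⊕ 𝟙 b          ≤⟨ ⊕-mono I-μδ ≤-refl ⟩
    𝟙 2 ⊕ 𝟙 b              ≈≤⟨ 𝟙-⊕ 2 b ⟩
    𝟙 (suc (suc b)) ■
  J⨾K≤𝟙 {suc b} (suc i) =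
    ((σ ⊕ 𝟙 b) ⨾ 1⊕ (J i)) ⨾ (1⊕ (K i) ⨾ (σ ⊕ 𝟙 b))
      ≈≤⟨ ≈-trans (⨾-assoc _ _ _) (_ ⨾⟨ pull (≈-sym (1⊕-⨾ _ _)) _) ⟩
    (σ ⊕ 𝟙 b) ⨾ (1⊕ (J i ⨾ K i) ⨾ (σ ⊕ 𝟙 b))
      ≤⟨ ⨾-mono ≤-refl (⨾-mono (⊕-mono ≤-refl (J⨾K≤𝟙 i)) ≤-refl) ⟩
    (σ ⊕ 𝟙 b) ⨾ (𝟙 (suc (suc b)) ⨾ (σ ⊕ 𝟙 b))
      ≈≤⟨ ≈-trans (_ ⨾⟨ ⨾-idˡ _) (σσ-id b) ⟩
    𝟙 (suc (suc b)) ■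

  ηₙ⨾εₙ≤id0 : ∀ n → (ηₙ Sig n ⨾ εₙ Sig n) ≤ₜ id0
  ηₙ⨾εₙ≤id0 zero    = ≈⇒≤ (⨾-idˡ id0)
  ηₙ⨾εₙ≤id0 (suc n) =
    (η ⊕ ηₙ Sig n) ⨾ (ε ⊕ εₙ Sig n)  ≈≤⟨ ≈-sym (interchange _ _ _ _) ⟩
    (η ⨾ ε) ⊕ (ηₙ Sig n ⨾ εₙ Sig n)  ≤⟨ ⊕-mono I-ηε (ηₙ⨾εₙ≤id0 n) ⟩
    id0 ⊕ id0                        ≈≤⟨ ⊕-idˡ id0 ⟩
    id0 ■

  ⟦⟧⨾⟦⟧°≤𝟙 : ∀ {a b} (f : Fin a → Fin b) → (⟦ f ⟧ ⨾ ⟦ f ⟧°) ≤ₜ 𝟙 a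
  ⟦⟧⨾⟦⟧°≤𝟙 {zero}  {b} f = ηₙ⨾εₙ≤id0 b
  ⟦⟧⨾⟦⟧°≤𝟙 {suc a} {b} f =
    (1⊕ ⟦ f ∘ suc ⟧ ⨾ J (f zero)) ⨾ (K (f zero) ⨾ 1⊕ ⟦ f ∘ suc ⟧°)
      ≈≤⟨ ≈-trans (⨾-assoc _ _ _) (_ ⨾⟨ ≈-sym (⨾-assoc _ _ _)) ⟩
    1⊕ ⟦ f ∘ suc ⟧ ⨾ ((J (f zero) ⨾ K (f zero)) ⨾ 1⊕ ⟦ f ∘ suc ⟧°)
      ≤⟨ ⨾-mono ≤-refl (⨾-mono (J⨾K≤𝟙 (f zero)) ≤-refl) ⟩
    1⊕ ⟦ f ∘ suc ⟧ ⨾ (𝟙 (suc b) ⨾ 1⊕ ⟦ f ∘ suc ⟧°)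
      ≈≤⟨ ≈-trans (_ ⨾⟨ ⨾-idˡ _) (≈-sym (1⊕-⨾ _ _)) ⟩
    1⊕ (⟦ f ∘ suc ⟧ ⨾ ⟦ f ∘ suc ⟧°)
      ≤⟨ ⊕-mono ≤-refl (⟦⟧⨾⟦⟧°≤𝟙 (f ∘ suc)) ⟩
    𝟙 (suc a) ■

  𝟙≤εₙ⨾ηₙ : ∀ n → 𝟙 n ≤ₜ (εₙ Sig n ⨾ ηₙ Sig n)
  𝟙≤εₙ⨾ηₙ zero    = ≈⇒≤ (≈-sym (⨾-idˡ id0))
  𝟙≤εₙ⨾ηₙ (suc n) = ≤-trans (⊕-mono I-εη (𝟙≤εₙ⨾ηₙ n)) (≈⇒≤ (interchange _ _ _ _))

  -- The states denoted by hypergraphs lie below the unit and are idempotent up to ≤.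

  record Shrinkable {n} (s : Term Sig 0 n) : Set where
    field
      discard   : s ≤ₜ ηₙ Sig n
      duplicate : s ≤ₜ (s ∗ s)
  open Shrinkable

  ∗-mono : ∀ {n} {s s' t t' : Term Sig 0 n} → s ≤ₜ s' → t ≤ₜ t' → (s ∗ t) ≤ₜ (s' ∗ t')
  ∗-mono p q = ⨾-mono (⊕-mono p q) ≤-refl

  K⨾J-diag : ∀ {b} (i : Fin b) → (K i ⨾ J i) ≈ 𝟙 b
  K⨾J-diag {suc b} zero    = ≈-trans (≈-sym (⊕𝟙-⨾ δ μ b)) (⊕-cong special ≈-refl)
  K⨾J-diag {suc b} (suc i) =
    (1⊕ (K i) ⨾ (σ ⊕ 𝟙 b)) ⨾ ((σ ⊕ 𝟙 b) ⨾ 1⊕ (J i))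
      ≈⟨ ≈-trans (⨾-assoc _ _ _) (_ ⨾⟨ ≈-trans (pull (σσ-id b) _) (⨾-idˡ _)) ⟩
    1⊕ (K i) ⨾ 1⊕ (J i)
      ≈⟨ ≈-trans (≈-sym (1⊕-⨾ _ _)) (1⊕-cong (K⨾J-diag i)) ⟩
    𝟙 (suc b) ∎

  -- Speciality on many wires: the arbitrary `h` provides an induction on `k`, and `h = id` is the
  -- case of interest.
  copair-id-split : ∀ {k n} (h : Fin k → Fin n) → (⟦ copair h id ⟧° ⨾ ⟦ copair h id ⟧) ≈ 𝟙 n
  copair-id-split {zero}  {n} h = ≈-trans (⨾-cong (⟦id⟧° n) (⟦id⟧ n)) (⨾-idˡ (𝟙 n))
  copair-id-split {suc k} {n} h =
    (K (h zero) ⨾ 1⊕ ⟦ copair h id ∘ suc ⟧°) ⨾ (1⊕ ⟦ copair h id ∘ suc ⟧ ⨾ J (h zero))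
      ≈⟨ ≈-trans (⨾-assoc _ _ _) (_ ⨾⟨ pull (≈-sym (1⊕-⨾ _ _)) _) ⟩
    K (h zero) ⨾ (1⊕ (⟦ copair h id ∘ suc ⟧° ⨾ ⟦ copair h id ∘ suc ⟧) ⨾ J (h zero))
      ≈⟨ _ ⨾⟨ ⨾-cong (1⊕-cong (≈-trans (⨾-cong (⟦⟧°-cong (copair-suc h id)) (⟦⟧-cong (copair-suc h id)))
          (copair-id-split (h ∘ suc)))) ≈-refl ⟩
    K (h zero) ⨾ (𝟙 (suc n) ⨾ J (h zero))
      ≈⟨ ≈-trans (_ ⨾⟨ ⨾-idˡ _) (K⨾J-diag (h zero)) ⟩
    𝟙 n ∎

  Δ∇ : ∀ n → (Δ n ⨾ ∇ n) ≈ 𝟙 n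
  Δ∇ n = copair-id-split id

  -- The lax laws concern a symbol followed by `εₙ` or `δₙ`, so these are first created on its
  -- outputs: from `𝟙 m ≤ₜ εₙ ⨾ ηₙ` for discarding, and from `Δ m ⨾ ∇ m ≈ 𝟙 m` for duplicating.
  bend-gen-shrinkable : ∀ {n m} (R : Sig n m) → Shrinkable (bend (gen R))
  bend-gen-shrinkable {n} {m} R = record { discard = discarded ; duplicate = duplicated }
    where
    discarded : bend (gen R) ≤ₜ ηₙ Sig (m + n)
    discarded =
      cap n ⨾ (gen R ⊕ 𝟙 n)
        ≈≤⟨ _ ⨾⟨ ⊕-cong (≈-sym (⨾-idʳ _)) ≈-refl ⟩
      cap n ⨾ ((gen R ⨾ 𝟙 m) ⊕ 𝟙 n)
        ≤⟨ ⨾-mono ≤-refl (⊕-mono (≤-trans (⨾-mono ≤-refl (𝟙≤εₙ⨾ηₙ m))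
            (≤-trans (≈⇒≤ (≈-sym (⨾-assoc _ _ _))) (⨾-mono (I-Rε R) ≤-refl))) ≤-refl) ⟩
      cap n ⨾ ((εₙ Sig n ⨾ ηₙ Sig m) ⊕ 𝟙 n)
        ≈≤⟨ ≈-trans (_ ⨾⟨ ⊕𝟙-⨾ _ _ n) (≈-trans (⨾-assoc _ _ _) (_ ⨾⟨ pull counit _)) ⟩
      ηₙ Sig n ⨾ (𝟙 n ⨾ (ηₙ Sig m ⊕ 𝟙 n))
        ≈≤⟨ ≈-trans (_ ⨾⟨ ⨾-idˡ _) (≈-trans (≈-sym (⊕-as-⨾ (ηₙ Sig m) (ηₙ Sig n))) (ηₙ-⊕ m n)) ⟩
      ηₙ Sig (m + n) ■
      where
      counit : (Δ n ⨾ (εₙ Sig n ⊕ 𝟙 n)) ≈ 𝟙 n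
      counit = ≈-trans (⨾-cong ≈-refl (⊕-cong ≈-refl (≈-sym (⟦id⟧° n))))
        (≈-trans (≈-sym (⟦copair⟧° {0} (λ ()) id)) (⟦id⟧° n))
    duplicated : bend (gen R) ≤ₜ (bend (gen R) ∗ bend (gen R))
    duplicated =
      bend (gen R)
        ≈≤⟨ _ ⨾⟨ ⊕-cong (≈-sym (≈-trans (_ ⨾⟨ Δ∇ m) (⨾-idʳ _))) ≈-refl ⟩
      bend (gen R ⨾ (Δ m ⨾ ∇ m))
        ≤⟨ ⨾-mono ≤-refl (⊕-mono (≤-trans (≈⇒≤ (pull (_ ⨾⟨ ≈-sym (↤-sound (δₙ↤ m))) (∇ m)))
             (≤-trans (⨾-mono (I-Rδ R) ≤-refl) (≈⇒≤ (≈-trans (⨾-assoc _ _ _)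
                 (⨾-cong (↤-sound (δₙ↤ n)) ≈-refl))))) ≤-refl) ⟩
      bend (Δ n ⨾ ((gen R ⊕ gen R) ⨾ ∇ m))
        ≈≤⟨ ≈-sym (bend-∗ (gen R) (gen R)) ⟩
      bend (gen R) ∗ bend (gen R) ■

  ⟦⟧-shrinkable : ∀ {a b} {s : Term Sig 0 a} (f : Fin a → Fin b) → Shrinkable s → Shrinkable (s ⨾ ⟦ f ⟧)
  ⟦⟧-shrinkable {s = s} f p = record
    { discard   = ≤-trans (⨾-mono (discard p) ≤-refl) (≈⇒≤ (ηₙ-⟦⟧ f))
    ; duplicate = ≤-trans (⨾-mono (duplicate p) ≤-refl) (≈⇒≤ (∗-⟦⟧ s s f)) }

  edgeState-shrinkable : ∀ {v} (e : Edge Sig (Fin v)) → Shrinkable (edgeState e)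
  edgeState-shrinkable (n , m , R , s , t) = ⟦⟧-shrinkable _ (bend-gen-shrinkable R)

  module _ {a : ℕ} where
    open CommutativeMonoid (StateMonoid a) using (commutativeSemigroup; identityˡ; identityʳ)
    open import Algebra.Properties.CommutativeSemigroup commutativeSemigroup using () renaming
        (interchange to medial)

    sum-discard : ∀ {k} (x : Fin k → Term Sig 0 a) → (∀ i → Shrinkable (x i)) → sum x ≤ₜ ηₙ Sig a
    sum-discard {zero}  x p = ≤-refl
    sum-discard {suc k} x p = ≤-trans (∗-mono (discard (p zero)) (sum-discard (x ∘ suc) (p ∘ suc)))
        (≈⇒≤ (identityˡ _))

    sum-duplicate : ∀ {k} (x : Fin k → Term Sig 0 a) → (∀ i → Shrinkable (x i)) → sum x ≤ₜ (sum x ∗ sum x)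
    sum-duplicate {zero}  x p = ≈⇒≤ (≈-sym (identityˡ _))
    sum-duplicate {suc k} x p = ≤-trans (∗-mono (duplicate (p zero)) (sum-duplicate (x ∘ suc) (p ∘ suc)))
        (≈⇒≤ (medial _ _ _ _))

    sum-project : ∀ {k} (x : Fin k → Term Sig 0 a) → (∀ i → Shrinkable (x i)) → ∀ i → sum x ≤ₜ x i
    sum-project {suc k} x p zero    = ≤-trans (∗-mono ≤-refl (sum-discard (x ∘ suc) (p ∘ suc)))
        (≈⇒≤ (identityʳ _))
    sum-project {suc k} x p (suc i) = ≤-trans (∗-mono (discard (p zero)) (sum-project (x ∘ suc) (p ∘ suc) i))
        (≈⇒≤ (identityˡ _))

    -- For shrinkable states `_∗_` behaves as a meet: `sum-project` makes it a lower bound of its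
    -- factors, and duplicating `s` once per factor makes it the greatest.
    below-sum : ∀ {k} {s : Term Sig 0 a} → Shrinkable s → (y : Fin k → Term Sig 0 a) → (∀ i → s ≤ₜ y i) → s ≤ₜ
        sum y
    below-sum {zero}  p y q = discard p
    below-sum {suc k} p y q = ≤-trans (duplicate p) (∗-mono (q zero) (below-sum p (y ∘ suc) (q ∘ suc)))

  edgeState-hom : ∀ {H H'} (h : HypHom Sig H H') e → edgeState (edge H' (fE h e)) ≈
      (edgeState (edge H e) ⨾ ⟦ fV h ⟧)
  edgeState-hom {H} h e = ≈-trans (≡⇒≈ (cong edgeState (comm h e))) (edgeState-map (fV h) (edge H e))

  -- The edge map may hit an edge several times or miss it. Duplication accounts for the former and
  -- discarding for the latter.
  state-hom : ∀ {H H'} → (h : HypHom Sig H H') → state H' ≤ₜ (state H ⨾ ⟦ fV h ⟧)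
  state-hom {H} {H'} h =
    state H'
      ≤⟨ below-sum (record { discard = sum-discard x p ; duplicate = sum-duplicate x p }) (x ∘ fE h)
          (λ e → sum-project x p (fE h e)) ⟩
    sum (x ∘ fE h)
      ≈≤⟨ ≈-trans (sum-cong (edgeState-hom h)) (≈-sym (sum-⟦⟧ (edgeState ∘ edge H) (fV h))) ⟩
    state H ⨾ ⟦ fV h ⟧ ■
    where
    x = edgeState ∘ edge H'
    p = λ e → edgeState-shrinkable (edge H' e)

  -- The legs of `b` factor through `h`, which leaves `⟦ h ⟧ ⨾ ⟦ h ⟧°` as the only trace of the
  -- morphism. That loop is below the identity for every `h` and equal to it for a bijection, so
  -- both results below start here.
  readback-along : ∀ {n m} {a b : Cospan Sig n m} (f : CospanMor Sig a b)
    → ((⟦ inl b ⟧ ⨾ M (state (apex a) ⨾ ⟦ fV (hom f) ⟧)) ⨾ ⟦ inr b ⟧°)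
      ≈ (⟦ inl a ⟧ ⨾ (M (state (apex a)) ⨾ ((⟦ fV (hom f) ⟧ ⨾ ⟦ fV (hom f) ⟧°) ⨾ ⟦ inr a ⟧°)))
  readback-along {a = a} {b} f =
    (⟦ inl b ⟧ ⨾ M (state (apex a) ⨾ ⟦ h ⟧)) ⨾ ⟦ inr b ⟧°
      ≈⟨ ⨾-cong (⨾-cong (≈-trans (⟦⟧-cong (λ k → sym (inlC f k))) (≈-sym (⟦⟧-⨾ (inl a) h))) ≈-refl)
                (≈-trans (⟦⟧°-cong (λ k → sym (inrC f k))) (≈-sym (⟦⟧°-⨾ (inr a) h))) ⟩
    ((⟦ inl a ⟧ ⨾ ⟦ h ⟧) ⨾ M (state (apex a) ⨾ ⟦ h ⟧)) ⨾ (⟦ h ⟧° ⨾ ⟦ inr a ⟧°)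
      ≈⟨ ≈-trans (⨾-cong (≈-trans (⨾-assoc _ _ _) (_ ⨾⟨ ≈-sym (M-⟦⟧ (state (apex a)) h))) ≈-refl)
          (⨾-assoc _ _ _) ⟩
    ⟦ inl a ⟧ ⨾ ((M (state (apex a)) ⨾ ⟦ h ⟧) ⨾ (⟦ h ⟧° ⨾ ⟦ inr a ⟧°))
      ≈⟨ _ ⨾⟨ ≈-trans (⨾-assoc _ _ _) (_ ⨾⟨ ≈-sym (⨾-assoc _ _ _)) ⟩
    ⟦ inl a ⟧ ⨾ (M (state (apex a)) ⨾ ((⟦ h ⟧ ⨾ ⟦ h ⟧°) ⨾ ⟦ inr a ⟧°)) ∎
    where h = fV (hom f)

  readback-mono : ∀ {n m} {a b : Cospan Sig n m} → CospanMor Sig b a → readback a ≤ₜ readback b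
  readback-mono {a = a} {b} f =
    (⟦ inl a ⟧ ⨾ M (state (apex a))) ⨾ ⟦ inr a ⟧°
      ≤⟨ ⨾-mono (⨾-mono ≤-refl (⨾-mono (⊕-mono (state-hom (hom f)) ≤-refl) ≤-refl)) ≤-refl ⟩
    (⟦ inl a ⟧ ⨾ M (state (apex b) ⨾ ⟦ fV (hom f) ⟧)) ⨾ ⟦ inr a ⟧°
      ≈≤⟨ readback-along f ⟩
    ⟦ inl b ⟧ ⨾ (M (state (apex b)) ⨾ ((⟦ fV (hom f) ⟧ ⨾ ⟦ fV (hom f) ⟧°) ⨾ ⟦ inr b ⟧°))
      ≤⟨ ⨾-mono ≤-refl (⨾-mono ≤-refl (⨾-mono (⟦⟧⨾⟦⟧°≤𝟙 (fV (hom f))) ≤-refl)) ⟩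
    ⟦ inl b ⟧ ⨾ (M (state (apex b)) ⨾ (𝟙 _ ⨾ ⟦ inr b ⟧°))
      ≈≤⟨ ≈-trans (_ ⨾⟨ (_ ⨾⟨ ⨾-idˡ _)) (≈-sym (⨾-assoc _ _ _)) ⟩
    readback b ■

  -- Monotonicity in both directions would yield only mutual `≤ₜ`. Instead, the vertex bijection
  -- cancels against its converse, and the edge bijection permutes the factors of the state.
  readback-cong : ∀ {n m} {a b : Cospan Sig n m} → _≅C_ Sig a b → readback a ≈ readback b
  readback-cong {a = a} {b} φ = ≈-sym (
    (⟦ inl b ⟧ ⨾ M (state (apex b))) ⨾ ⟦ inr b ⟧°
      ≈⟨ ⨾-cong (⨾-cong ≈-refl (M-cong state-iso)) ≈-refl ⟩
    (⟦ inl b ⟧ ⨾ M (state (apex a) ⨾ ⟦ h ⟧)) ⨾ ⟦ inr b ⟧°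
      ≈⟨ readback-along to ⟩
    ⟦ inl a ⟧ ⨾ (M (state (apex a)) ⨾ ((⟦ h ⟧ ⨾ ⟦ h ⟧°) ⨾ ⟦ inr a ⟧°))
      ≈⟨ _ ⨾⟨ (_ ⨾⟨ ≈-trans (⨾-cong (≈-trans (permutation-⟦⟧° πV id) (⟦id⟧° _)) ≈-refl) (⨾-idˡ _)) ⟩
    ⟦ inl a ⟧ ⨾ (M (state (apex a)) ⨾ ⟦ inr a ⟧°)
      ≈⟨ ≈-sym (⨾-assoc _ _ _) ⟩
    readback a ∎)
    where
    open _≅C_ φ
    h = fV (hom to)
    πV : Permutation (nV (apex a)) (nV (apex b))
    πV = permutation h (fV (hom from)) tofromV fromtoV
    πE : Permutation (nE (apex a)) (nE (apex b))
    πE = permutation (fE (hom to)) (fE (hom from)) tofromE fromtoE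
    state-iso : state (apex b) ≈ (state (apex a) ⨾ ⟦ h ⟧)
    state-iso = ≈-trans (sum-permute (edgeState ∘ edge (apex b)) πE)
      (≈-trans (sum-cong (edgeState-hom (hom to))) (≈-sym (sum-⟦⟧ (edgeState ∘ edge (apex a)) h)))

-- Hypergraphs, cospans and universal properties

module Cospans (Sig : ℕ → ℕ → Set) where

  private
    E : Set → Set
    E = Edge Sig

  map-E : ∀ {V W : Set} → (V → W) → E V → E W
  map-E = mapEdge Sig

  map-E-cong : ∀ {V W : Set} {f g : V → W} → (∀ v → f v ≡ g v) → ∀ e → map-E f e ≡ map-E g e
  map-E-cong p (n , m , R , s , t) = cong₂ (λ x y → n , m , R , x , y) (map-cong p s) (map-cong p t)

  map-E-∘ : ∀ {U V W : Set} (g : V → W) (f : U → V) e → map-E g (map-E f e) ≡ map-E (g ∘ f) e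
  map-E-∘ g f (n , m , R , s , t) = cong₂ (λ x y → n , m , R , x , y) (sym (map-∘ g f s)) (sym (map-∘ g f t))

  map-E-id : ∀ {V : Set} (e : E V) → map-E id e ≡ e
  map-E-id (n , m , R , s , t) = cong₂ (λ x y → n , m , R , x , y) (map-id s) (map-id t)

  infix 4 _⇒_ _≗ᴴ_ _≅_
  infixr 9 _∘ᴴ_

  _⇒_ : Hyp Sig → Hyp Sig → Set
  _⇒_ = HypHom Sig

  idᴴ : ∀ {A} → A ⇒ A
  idᴴ = record { fV = id ; fE = id ; comm = λ e → sym (map-E-id _) }

  _∘ᴴ_ : ∀ {A B C} → B ⇒ C → A ⇒ B → A ⇒ C
  g ∘ᴴ f = record
    { fV = fV g ∘ fV f ; fE = fE g ∘ fE f
    ; comm = λ e → trans (comm g (fE f e)) (trans (cong (map-E (fV g)) (comm f e)) (map-E-∘ (fV g) (fV f) _)) }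

  _≗ᴴ_ : ∀ {A B} → A ⇒ B → A ⇒ B → Set
  f ≗ᴴ g = (∀ v → fV f v ≡ fV g v) × (∀ e → fE f e ≡ fE g e)

  fromDisc : ∀ {k A} → (Fin k → Fin (nV A)) → disc Sig k ⇒ A
  fromDisc f = record { fV = f ; fE = λ () ; comm = λ () }

  _≅_ : ∀ {n m} → Cospan Sig n m → Cospan Sig n m → Set
  _≅_ = _≅C_ Sig

  Mor : ∀ {n m} → Cospan Sig n m → Cospan Sig n m → Set
  Mor = CospanMor Sig

  idᴹ : ∀ {n m} {c : Cospan Sig n m} → Mor c c
  idᴹ = record { hom = idᴴ ; inlC = λ _ → refl ; inrC = λ _ → refl }

  _∘ᴹ_ : ∀ {n m} {c d e : Cospan Sig n m} → Mor d e → Mor c d → Mor c e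
  g ∘ᴹ f = record
    { hom = hom g ∘ᴴ hom f
    ; inlC = λ k → trans (cong (fV (hom g)) (inlC f k)) (inlC g k)
    ; inrC = λ k → trans (cong (fV (hom g)) (inrC f k)) (inrC g k) }

  ≅-refl : ∀ {n m} {c : Cospan Sig n m} → c ≅ c
  ≅-refl = record { to = idᴹ ; from = idᴹ ; fromtoV = λ _ → refl ; fromtoE = λ _ → refl ; tofromV = λ _ → refl
      ; tofromE = λ _ → refl }

  ≅-sym : ∀ {n m} {c d : Cospan Sig n m} → c ≅ d → d ≅ c
  ≅-sym p = record { to = P.from ; from = P.to ; fromtoV = P.tofromV ; fromtoE = P.tofromE ; tofromV
      = P.fromtoV ; tofromE = P.fromtoE }
    where module P = _≅C_ p

  ≅-trans : ∀ {n m} {c d e : Cospan Sig n m} → c ≅ d → d ≅ e → c ≅ e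
  ≅-trans p q = record
    { to = Q.to ∘ᴹ P.to ; from = P.from ∘ᴹ Q.from
    ; fromtoV = λ v → trans (cong (fV (hom P.from)) (Q.fromtoV _)) (P.fromtoV v)
    ; fromtoE = λ v → trans (cong (fE (hom P.from)) (Q.fromtoE _)) (P.fromtoE v)
    ; tofromV = λ v → trans (cong (fV (hom Q.to)) (P.tofromV _)) (Q.tofromV v)
    ; tofromE = λ v → trans (cong (fE (hom Q.to)) (P.tofromE _)) (Q.tofromE v) }
    where
    module P = _≅C_ p
    module Q = _≅C_ q

  module _ {n m} {c d : Cospan Sig n m} where

    -- The inverse of a bijective homomorphism preserves edges automatically, so inverse functions
    -- without further proof suffice for an isomorphism.
    bijective⇒≅ : (f : Mor c d) (gV : Fin (nV (apex d)) → Fin (nV (apex c)))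
        (gE : Fin (nE (apex d)) → Fin (nE (apex c)))
      → (∀ v → gV (fV (hom f) v) ≡ v) → (∀ e → gE (fE (hom f) e) ≡ e)
      → (∀ v → fV (hom f) (gV v) ≡ v) → (∀ e → fE (hom f) (gE e) ≡ e) → c ≅ d
    bijective⇒≅ f gV gE gfV gfE fgV fgE = record
      { to = f
      ; from = record
        { hom = record
          { fV = gV ; fE = gE
          ; comm = λ e → sym (trans (cong (map-E gV)
              (trans (cong (edge (apex d)) (sym (fgE e))) (comm (hom f) (gE e))))
              (trans (map-E-∘ gV (fV (hom f)) _) (trans (map-E-cong gfV _) (map-E-id _)))) }
        ; inlC = λ k → trans (cong gV (sym (inlC f k))) (gfV _)
        ; inrC = λ k → trans (cong gV (sym (inrC f k))) (gfV _) }
      ; fromtoV = gfV ; fromtoE = gfE ; tofromV = fgV ; tofromE = fgE }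

  cospan : ∀ {n m} (A : Hyp Sig) → (Fin n → Fin (nV A)) → (Fin m → Fin (nV A)) → Cospan Sig n m
  cospan A l r = record { apex = A ; inl = l ; inr = r }

  ≅-ext : ∀ {n m v k} {x y : Fin k → E (Fin v)} {l l' : Fin n → Fin v} {r r' : Fin m → Fin v} → x ≗ y → l ≗ l'
      → r ≗ r'
        → cospan (record { nV = v ; nE = k ; edge = x }) l r ≅ cospan (record { nV = v ; nE = k ; edge = y })
            l' r'
  ≅-ext p q s = bijective⇒≅ (record { hom = record
      { fV = id ; fE = id ; comm = λ e → trans (sym (p e)) (sym (map-E-id _)) }
                                    ; inlC = q ; inrC = s })
    id id (λ _ → refl) (λ _ → refl) (λ _ → refl) (λ _ → refl)

  legs-ext : ∀ {n m} {A : Hyp Sig} {l l' : Fin n → Fin (nV A)} {r r' : Fin m → Fin (nV A)} → l ≗ l' → r ≗ r'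
           → cospan A l r ≅ cospan A l' r'
  legs-ext = ≅-ext (λ _ → refl)

  relegʳ : ∀ {n m k} (c : Cospan Sig n m) (f : Fin k → Fin m) → Cospan Sig n k
  relegʳ c f = cospan (apex c) (inl c) (inr c ∘ f)

  relegˡ : ∀ {n m k} (f : Fin k → Fin n) (c : Cospan Sig n m) → Cospan Sig k m
  relegˡ f c = cospan (apex c) (inl c ∘ f) (inr c)

  -- Composites

  compose-isComposite : ∀ {n z m} (c : Cospan Sig n z) (d : Cospan Sig z m) → IsComposite Sig c d
      (compose Sig c d)
  compose-isComposite c d = record
    { i = record { fV = q ∘ (_↑ˡ nV B) ; fE = _↑ˡ nE B
                 ; comm = λ e → trans (cong (map-E q) (copair-↑ˡ _ _ e)) (map-E-∘ q (_↑ˡ nV B) (edge A e)) }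
    ; j = record { fV = q ∘ (nV A ↑ʳ_) ; fE = nE A ↑ʳ_
                 ; comm = λ e → trans (cong (map-E q) (copair-↑ʳ {nE A} _ _ e))
                     (map-E-∘ q (nV A ↑ʳ_) (edge B e)) }
    ; glue = quot-eq G
    ; legˡ = λ _ → refl
    ; legʳ = λ _ → refl
    ; univ = λ Q a b g →
        let h : Fin (nV A + nV B) → Fin (nV Q)
            h = copair (fV a) (fV b)
            fac : ∀ x → h (sect G (q x)) ≡ h x
            fac = factor G h (λ k → trans (copair-↑ˡ (fV a) (fV b) (inr c k))
                (trans (g k) (sym (copair-↑ʳ (fV a) (fV b) (inl d k)))))
            hE : Fin (nE A + nE B) → Fin (nE Q)
            hE = copair (fE a) (fE b)
            facˡ : ∀ v → h (sect G (q (v ↑ˡ nV B))) ≡ fV a v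
            facˡ v = trans (fac _) (copair-↑ˡ (fV a) (fV b) v)
            facʳ : ∀ v → h (sect G (q (nV A ↑ʳ v))) ≡ fV b v
            facʳ v = trans (fac _) (copair-↑ʳ (fV a) (fV b) v)
        in record { fV = h ∘ sect G ; fE = hE ; comm = sum-ext {nE A} {nE B}
             (λ e → trans (cong (edge Q) (copair-↑ˡ (fE a) (fE b) e)) (trans (comm a e) (sym (
                trans (cong (map-E (h ∘ sect G)) (trans (cong (map-E q) (copair-↑ˡ _ _ e))
                    (map-E-∘ q (_↑ˡ nV B) (edge A e))))
                      (trans (map-E-∘ _ _ (edge A e)) (map-E-cong facˡ (edge A e)))))))
             (λ e → trans (cong (edge Q) (copair-↑ʳ (fE a) (fE b) e)) (trans (comm b e) (sym (
                trans (cong (map-E (h ∘ sect G)) (trans (cong (map-E q) (copair-↑ʳ {nE A} _ _ e))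
                    (map-E-∘ q (nV A ↑ʳ_) (edge B e))))
                      (trans (map-E-∘ _ _ (edge B e)) (map-E-cong facʳ (edge B e))))))) }
           , (facˡ , copair-↑ˡ (fE a) (fE b)) , (facʳ , copair-↑ʳ (fE a) (fE b))
    ; uniq = λ Q u u' iV iE jV jE →
        (λ v → subst (λ w → fV u w ≡ fV u' w) (quot-sect G v)
            (sum-ext {nV A} {nV B} {f = fV u ∘ q} {fV u' ∘ q} iV jV (sect G v)))
      , sum-ext {nE A} {nE B} iE jE
    }
    where
    A = apex c
    B = apex d
    G = glueing Sig c d
    q = quot G

  module _ {n z m} {c c' : Cospan Sig n z} {d d' : Cospan Sig z m} {r r' : Cospan Sig n m}
           (I : IsComposite Sig c d r) (I' : IsComposite Sig c' d' r') where
    private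
      module I = IsComposite I
      module I' = IsComposite I'

    -- The morphism alone gives monotonicity of composition. Its compatibility with the injections
    -- is returned as well, since `composite-cong` needs it to recognise two induced morphisms as
    -- inverse.
    composite-mor : (α : Mor c c') (β : Mor d d')
      → Σ[ u ∈ Mor r r' ] (((hom u ∘ᴴ I.i) ≗ᴴ (I'.i ∘ᴴ hom α)) × ((hom u ∘ᴴ I.j) ≗ᴴ (I'.j ∘ᴴ hom β)))
    composite-mor α β with I.univ (apex r') (I'.i ∘ᴴ hom α) (I'.j ∘ᴴ hom β)
      (λ k → trans (cong (fV I'.i) (inrC α k)) (trans (I'.glue k) (cong (fV I'.j) (sym (inlC β k)))))
    ... | u , p , q = record
      { hom = u
      ; inlC = λ k → trans (cong (fV u) (I.legˡ k))
          (trans (proj₁ p _) (trans (cong (fV I'.i) (inlC α k)) (sym (I'.legˡ k))))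
      ; inrC = λ k → trans (cong (fV u) (I.legʳ k))
          (trans (proj₁ q _) (trans (cong (fV I'.j) (inrC β k)) (sym (I'.legʳ k))))
      } , p , q

  composite-cong : ∀ {n z m} {c c' : Cospan Sig n z} {d d' : Cospan Sig z m} {r r' : Cospan Sig n m}
    → IsComposite Sig c d r → IsComposite Sig c' d' r' → c ≅ c' → d ≅ d' → r ≅ r'
  composite-cong {r = r} {r'} I I' α β with composite-mor I I' (_≅C_.to α) (_≅C_.to β) | composite-mor I' I
      (_≅C_.from α) (_≅C_.from β)
  ... | u , (uiV , uiE) , (ujV , ujE) | v , (viV , viE) , (vjV , vjE) = record
    { to = u ; from = v
    ; fromtoV = proj₁ vu ; fromtoE = proj₂ vu ; tofromV = proj₁ uv ; tofromE = proj₂ uv }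
    where
    module α = _≅C_ α
    module β = _≅C_ β
    module I = IsComposite I
    module I' = IsComposite I'
    vu = I.uniq (apex r) (hom v ∘ᴴ hom u) idᴴ
      (λ x → trans (cong (fV (hom v)) (uiV x)) (trans (viV _) (cong (fV I.i) (α.fromtoV x))))
      (λ x → trans (cong (fE (hom v)) (uiE x)) (trans (viE _) (cong (fE I.i) (α.fromtoE x))))
      (λ x → trans (cong (fV (hom v)) (ujV x)) (trans (vjV _) (cong (fV I.j) (β.fromtoV x))))
      (λ x → trans (cong (fE (hom v)) (ujE x)) (trans (vjE _) (cong (fE I.j) (β.fromtoE x))))
    uv = I'.uniq (apex r') (hom u ∘ᴴ hom v) idᴴ
      (λ x → trans (cong (fV (hom u)) (viV x)) (trans (uiV _) (cong (fV I'.i) (α.tofromV x))))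
      (λ x → trans (cong (fE (hom u)) (viE x)) (trans (uiE _) (cong (fE I'.i) (α.tofromE x))))
      (λ x → trans (cong (fV (hom u)) (vjV x)) (trans (ujV _) (cong (fV I'.j) (β.tofromV x))))
      (λ x → trans (cong (fE (hom u)) (vjE x)) (trans (ujE _) (cong (fE I'.j) (β.tofromE x))))

  -- Pasting of pushouts: the apex of the left-bracketed composite also has the universal property
  -- of the right-bracketed one.
  composite-assoc : ∀ {n z w m} {c : Cospan Sig n z} {d : Cospan Sig z w} {e : Cospan Sig w m}
      {r : Cospan Sig n w}
    {s : Cospan Sig n m} {t : Cospan Sig z m}
    → IsComposite Sig c d r → IsComposite Sig r e s → IsComposite Sig d e t → IsComposite Sig c t s
  composite-assoc {c = c} {d} {e} {r} {s} {t} CD RE DE = record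
    { i = i
    ; j = j
    ; glue = λ k → trans (cong (fV RE.i) (CD.glue k))
        (trans (sym (proj₁ ji (inl d k))) (cong (fV j) (sym (DE.legˡ k))))
    ; legˡ = λ k → trans (RE.legˡ k) (cong (fV RE.i) (CD.legˡ k))
    ; legʳ = λ k → trans (RE.legʳ k) (trans (sym (proj₁ jj (inr e k))) (cong (fV j) (sym (DE.legʳ k))))
    ; univ = univ
    ; uniq = λ Q u u' iV iE jV jE →
        let riV , riE = CD.uniq Q (u ∘ᴴ RE.i) (u' ∘ᴴ RE.i) iV iE
              (λ v → trans (cong (fV u) (sym (proj₁ ji v))) (trans (jV _) (cong (fV u') (proj₁ ji v))))
              (λ v → trans (cong (fE u) (sym (proj₂ ji v))) (trans (jE _) (cong (fE u') (proj₂ ji v))))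
        in RE.uniq Q u u' riV riE
              (λ v → trans (cong (fV u) (sym (proj₁ jj v))) (trans (jV _) (cong (fV u') (proj₁ jj v))))
              (λ v → trans (cong (fE u) (sym (proj₂ jj v))) (trans (jE _) (cong (fE u') (proj₂ jj v))))
    }
    where
    module CD = IsComposite CD
    module RE = IsComposite RE
    module DE = IsComposite DE
    i : apex c ⇒ apex s
    i = RE.i ∘ᴴ CD.i
    along-t = DE.univ (apex s) (RE.i ∘ᴴ CD.j) RE.j
      (λ k → trans (cong (fV RE.i) (sym (CD.legʳ k))) (RE.glue k))
    j : apex t ⇒ apex s
    j = proj₁ along-t
    ji : (j ∘ᴴ DE.i) ≗ᴴ (RE.i ∘ᴴ CD.j)
    ji = proj₁ (proj₂ along-t)
    jj : (j ∘ᴴ DE.j) ≗ᴴ RE.j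
    jj = proj₂ (proj₂ along-t)
    univ : ∀ (Q : Hyp Sig) (a : apex c ⇒ Q) (b : apex t ⇒ Q) → (∀ k → fV a (inr c k) ≡ fV b (inl t k))
         → Σ[ u ∈ apex s ⇒ Q ] (Factors Sig i u a × Factors Sig j u b)
    univ Q a b g with CD.univ Q a (b ∘ᴴ DE.i) (λ k → trans (g k) (cong (fV b) (DE.legˡ k)))
    ... | x , xi , xj with RE.univ Q x (b ∘ᴴ DE.j)
             (λ k → trans (cong (fV x) (CD.legʳ k)) (trans (proj₁ xj _) (cong (fV b) (DE.glue k))))
    ... | u , ui , uj = u
        , ((λ v → trans (proj₁ ui _) (proj₁ xi v)) , (λ v → trans (proj₂ ui _) (proj₂ xi v)))
        , DE.uniq Q (u ∘ᴴ j) b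
            (λ v → trans (cong (fV u) (proj₁ ji v)) (trans (proj₁ ui _) (proj₁ xj v)))
            (λ v → trans (cong (fE u) (proj₂ ji v)) (trans (proj₂ ui _) (proj₂ xj v)))
            (λ v → trans (cong (fV u) (proj₁ jj v)) (proj₁ uj v))
            (λ v → trans (cong (fE u) (proj₂ jj v)) (proj₂ uj v))

  -- Disjoint unions

  infixr 7 _⊎_
  _⊎_ : Hyp Sig → Hyp Sig → Hyp Sig
  _⊎_ = _⊎H_ Sig

  ι₁ : ∀ {A B} → A ⇒ (A ⊎ B)
  ι₁ {A} {B} = record { fV = _↑ˡ nV B ; fE = _↑ˡ nE B ; comm = λ e → copair-↑ˡ _ _ e }

  ι₂ : ∀ {A B} → B ⇒ (A ⊎ B)
  ι₂ {A} {B} = record { fV = nV A ↑ʳ_ ; fE = nE A ↑ʳ_ ; comm = λ e → copair-↑ʳ {nE A} _ _ e }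

  [_,_]ᴴ : ∀ {A B Q} → A ⇒ Q → B ⇒ Q → (A ⊎ B) ⇒ Q
  [_,_]ᴴ {A} {B} {Q} a b = record
    { fV = copair (fV a) (fV b) ; fE = copair (fE a) (fE b)
    ; comm = sum-ext {nE A} {nE B}
        (λ e → trans (cong (edge Q) (copair-↑ˡ (fE a) (fE b) e))
            (trans (comm a e) (sym (trans (cong (map-E (copair (fV a) (fV b))) (copair-↑ˡ _ _ e))
          (trans (map-E-∘ _ _ (edge A e)) (map-E-cong (copair-↑ˡ (fV a) (fV b)) (edge A e)))))))
        (λ e → trans (cong (edge Q) (copair-↑ʳ (fE a) (fE b) e))
            (trans (comm b e) (sym (trans (cong (map-E (copair (fV a) (fV b))) (copair-↑ʳ {nE A} _ _ e))
          (trans (map-E-∘ _ _ (edge B e)) (map-E-cong (copair-↑ʳ (fV a) (fV b)) (edge B e))))))) }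

  infixr 7 _⊎ᴴ_
  _⊎ᴴ_ : ∀ {A B A' B'} → A ⇒ A' → B ⇒ B' → (A ⊎ B) ⇒ (A' ⊎ B')
  f ⊎ᴴ g = [ ι₁ ∘ᴴ f , ι₂ ∘ᴴ g ]ᴴ

  infixr 7 _⊕ᶜ_
  _⊕ᶜ_ : ∀ {n m p q} → Cospan Sig n m → Cospan Sig p q → Cospan Sig (n + p) (m + q)
  _⊕ᶜ_ = _⊞_ Sig

  ⊕ᶜ-mor : ∀ {n m p q} {c c' : Cospan Sig n m} {d d' : Cospan Sig p q} → Mor c c' → Mor d d' → Mor (c ⊕ᶜ d)
      (c' ⊕ᶜ d')
  ⊕ᶜ-mor {n} {m} {c = c} {c'} {d} {d'} f g = record
    { hom = hom f ⊎ᴴ hom g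
    ; inlC = λ k → trans (⊎ᶠ-∘ (fV (hom f)) (fV (hom g)) (inl c) (inl d) k) (⊎ᶠ-cong (inlC f) (inlC g) k)
    ; inrC = λ k → trans (⊎ᶠ-∘ (fV (hom f)) (fV (hom g)) (inr c) (inr d) k) (⊎ᶠ-cong (inrC f) (inrC g) k) }

  ⊕ᶜ-cong : ∀ {n m p q} {c c' : Cospan Sig n m} {d d' : Cospan Sig p q} → c ≅ c' → d ≅ d' → (c ⊕ᶜ d) ≅ (c' ⊕ᶜ d')
  ⊕ᶜ-cong {c = c} {c'} {d} {d'} p q = record
    { to = ⊕ᶜ-mor P.to Q.to ; from = ⊕ᶜ-mor P.from Q.from
    ; fromtoV = inverse (fV (hom P.from)) (fV (hom Q.from)) (fV (hom P.to)) (fV (hom Q.to)) P.fromtoV Q.fromtoV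
    ; fromtoE = inverse (fE (hom P.from)) (fE (hom Q.from)) (fE (hom P.to)) (fE (hom Q.to)) P.fromtoE Q.fromtoE
    ; tofromV = inverse (fV (hom P.to)) (fV (hom Q.to)) (fV (hom P.from)) (fV (hom Q.from)) P.tofromV Q.tofromV
    ; tofromE = inverse (fE (hom P.to)) (fE (hom Q.to)) (fE (hom P.from)) (fE (hom Q.from)) P.tofromE Q.tofromE }
    where
    module P = _≅C_ p
    module Q = _≅C_ q
    inverse : ∀ {a a' b b'} (f : Fin a' → Fin a) (g : Fin b' → Fin b) (f' : Fin a → Fin a') (g' : Fin b → Fin b')
      → (∀ x → f (f' x) ≡ x) → (∀ x → g (g' x) ≡ x) → ∀ x → (f ⊎ᶠ g) ((f' ⊎ᶠ g') x) ≡ x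
    inverse {a} {b = b} f g f' g' p q x = trans (⊎ᶠ-∘ f g f' g' x) (trans (⊎ᶠ-cong p q x) (id⊎ᶠid a b x))

  -- A coproduct of pushouts is a pushout of coproducts, both being colimits; `interchange` rests on
  -- this.
  composite-⊕ᶜ : ∀ {n z m n' z' m'} {c : Cospan Sig n z} {d : Cospan Sig z m} {r : Cospan Sig n m}
    {c' : Cospan Sig n' z'} {d' : Cospan Sig z' m'} {r' : Cospan Sig n' m'}
    → IsComposite Sig c d r → IsComposite Sig c' d' r' → IsComposite Sig (c ⊕ᶜ c') (d ⊕ᶜ d') (r ⊕ᶜ r')
  composite-⊕ᶜ {z = z} {z' = z'} {c = c} {d} {r} {c'} {d'} {r'} I I' = record
    { i = I.i ⊎ᴴ I'.i
    ; j = I.j ⊎ᴴ I'.j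
    ; glue = λ k → trans (⊎ᶠ-∘ (fV I.i) (fV I'.i) (inr c) (inr c') k) (trans (⊎ᶠ-cong I.glue I'.glue k)
        (sym (⊎ᶠ-∘ (fV I.j) (fV I'.j) (inl d) (inl d') k)))
    ; legˡ = λ k → trans (⊎ᶠ-cong I.legˡ I'.legˡ k) (sym (⊎ᶠ-∘ (fV I.i) (fV I'.i) (inl c) (inl c') k))
    ; legʳ = λ k → trans (⊎ᶠ-cong I.legʳ I'.legʳ k) (sym (⊎ᶠ-∘ (fV I.j) (fV I'.j) (inr d) (inr d') k))
    ; univ = univ
    ; uniq = λ Q u u' iV iE jV jE →
        let pV , pE = I.uniq Q (u ∘ᴴ ι₁) (u' ∘ᴴ ι₁) (atˡ (fV u) (fV u') (fV I.i) (fV I'.i) iV)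
                (atˡ (fE u) (fE u') (fE I.i) (fE I'.i) iE)
                                                  (atˡ (fV u) (fV u') (fV I.j) (fV I'.j) jV)
                                                      (atˡ (fE u) (fE u') (fE I.j) (fE I'.j) jE)
            qV , qE = I'.uniq Q (u ∘ᴴ ι₂) (u' ∘ᴴ ι₂) (atʳ (fV u) (fV u') (fV I.i) (fV I'.i) iV)
                (atʳ (fE u) (fE u') (fE I.i) (fE I'.i) iE)
                                                   (atʳ (fV u) (fV u') (fV I.j) (fV I'.j) jV)
                                                       (atʳ (fE u) (fE u') (fE I.j) (fE I'.j) jE)
        in sum-ext {nV (apex r)} {nV (apex r')} pV qV , sum-ext {nE (apex r)} {nE (apex r')} pE qE
    }
    where
    module I = IsComposite I
    module I' = IsComposite I'
    atˡ : ∀ {a b a' b' x} (u u' : Fin (a' + b') → Fin x) (f : Fin a → Fin a') (g : Fin b → Fin b')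
        → (∀ k → u ((f ⊎ᶠ g) k) ≡ u' ((f ⊎ᶠ g) k)) → ∀ k → u (f k ↑ˡ b') ≡ u' (f k ↑ˡ b')
    atˡ {b = b} u u' f g p k = subst (λ y → u y ≡ u' y) (⊎ᶠ-↑ˡ f g k) (p (k ↑ˡ b))
    atʳ : ∀ {a b a' b' x} (u u' : Fin (a' + b') → Fin x) (f : Fin a → Fin a') (g : Fin b → Fin b')
        → (∀ k → u ((f ⊎ᶠ g) k) ≡ u' ((f ⊎ᶠ g) k)) → ∀ k → u (a' ↑ʳ g k) ≡ u' (a' ↑ʳ g k)
    atʳ {a = a} u u' f g p k = subst (λ y → u y ≡ u' y) (⊎ᶠ-↑ʳ f g k) (p (a ↑ʳ k))
    factors : ∀ {a b a' b' x} (u : Fin a' → Fin x) (v : Fin b' → Fin x) (f : Fin a → Fin a')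
        (g : Fin b → Fin b') (h : Fin (a + b) → Fin x)
            → (∀ k → u (f k) ≡ h (k ↑ˡ b)) → (∀ k → v (g k) ≡ h (a ↑ʳ k)) → ∀ k → copair u v ((f ⊎ᶠ g) k) ≡ h k
    factors {a} {b} u v f g h p q = sum-ext {a} {b}
      (λ k → trans (copair-⊎ᶠ u v f g (k ↑ˡ b)) (trans (copair-↑ˡ (u ∘ f) (v ∘ g) k) (p k)))
      (λ k → trans (copair-⊎ᶠ u v f g (a ↑ʳ k)) (trans (copair-↑ʳ (u ∘ f) (v ∘ g) k) (q k)))
    univ : ∀ (Q : Hyp Sig) (a : apex (c ⊕ᶜ c') ⇒ Q) (b : apex (d ⊕ᶜ d') ⇒ Q)
         → (∀ k → fV a (inr (c ⊕ᶜ c') k) ≡ fV b (inl (d ⊕ᶜ d') k))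
         → Σ[ u ∈ apex (r ⊕ᶜ r') ⇒ Q ] (Factors Sig (I.i ⊎ᴴ I'.i) u a × Factors Sig (I.j ⊎ᴴ I'.j) u b)
    univ Q a b g
      with I.univ Q (a ∘ᴴ ι₁) (b ∘ᴴ ι₁) (λ k → trans (cong (fV a) (sym (⊎ᶠ-↑ˡ (inr c) (inr c') k)))
          (trans (g (k ↑ˡ z')) (cong (fV b) (⊎ᶠ-↑ˡ (inl d) (inl d') k))))
         | I'.univ Q (a ∘ᴴ ι₂) (b ∘ᴴ ι₂) (λ k → trans (cong (fV a) (sym (⊎ᶠ-↑ʳ (inr c) (inr c') k)))
             (trans (g (z ↑ʳ k)) (cong (fV b) (⊎ᶠ-↑ʳ (inl d) (inl d') k))))
    ... | x , (xiV , xiE) , (xjV , xjE) | y , (yiV , yiE) , (yjV , yjE) = [ x , y ]ᴴ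
        , (factors (fV x) (fV y) (fV I.i) (fV I'.i) (fV a) xiV yiV , factors (fE x) (fE y) (fE I.i) (fE I'.i)
            (fE a) xiE yiE)
        , (factors (fV x) (fV y) (fV I.j) (fV I'.j) (fV b) xjV yjV , factors (fE x) (fE y) (fE I.j) (fE I'.j)
            (fE b) xjE yjE)

  -- Functions as cospans

  funC : ∀ {n m} → (Fin n → Fin m) → Cospan Sig n m
  funC {m = m} f = cospan (disc Sig m) f id

  cofunC : ∀ {n m} → (Fin m → Fin n) → Cospan Sig n m
  cofunC {n} f = cospan (disc Sig n) id f

  -- An identity leg makes the pushout trivial: the apex of `c` already has the universal property,
  -- and soundness can bypass the chosen quotient.
  funC-composite : ∀ {n z m} (f : Fin n → Fin z) (c : Cospan Sig z m) → IsComposite Sig (funC f) c (relegˡ f c)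
  funC-composite f c = record
    { i = fromDisc (inl c) ; j = idᴴ ; glue = λ _ → refl ; legˡ = λ _ → refl ; legʳ = λ _ → refl
    ; univ = λ Q a b g → b , ((λ v → sym (g v)) , λ ()) , ((λ _ → refl) , (λ _ → refl))
    ; uniq = λ Q u u' iV iE jV jE → jV , jE }

  cofunC-composite : ∀ {n z m} (c : Cospan Sig n z) (f : Fin m → Fin z) → IsComposite Sig c (cofunC f)
      (relegʳ c f)
  cofunC-composite c f = record
    { i = idᴴ ; j = fromDisc (inr c) ; glue = λ _ → refl ; legˡ = λ _ → refl ; legʳ = λ _ → refl
    ; univ = λ Q a b g → a , ((λ _ → refl) , (λ _ → refl)) , (g , λ ())
    ; uniq = λ Q u u' iV iE jV jE → iV , iE }

  pushforward-composite : ∀ {n w} (A : Hyp Sig) (l : Fin n → Fin (nV A)) (f : Fin (nV A) → Fin w)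
    → IsComposite Sig (cospan A l id) (funC f) (cospan (mapHyp Sig A f) (f ∘ l) id)
  pushforward-composite A l f = record
    { i = record { fV = f ; fE = id ; comm = λ _ → refl }
    ; j = fromDisc id ; glue = λ _ → refl ; legˡ = λ _ → refl ; legʳ = λ _ → refl
    ; univ = λ Q a b g → record { fV = fV b ; fE = fE a
                                ; comm = λ e → trans (comm a e) (trans (map-E-cong g (edge A e))
                                    (sym (map-E-∘ (fV b) f (edge A e)))) }
                       , ((λ v → sym (g v)) , (λ _ → refl)) , ((λ _ → refl) , λ ())
    ; uniq = λ Q u u' iV iE jV jE → jV , iE }

Fin1-unique : (x y : Fin 1) → x ≡ y
Fin1-unique zero zero = refl

-- Associativity of sums of finite ordinals

module Associator (a b c : ℕ) where
  in₁ : Fin a → Fin (a + (b + c))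
  in₁ = _↑ˡ (b + c)
  in₂ : Fin b → Fin (a + (b + c))
  in₂ j = a ↑ʳ (j ↑ˡ c)
  in₃ : Fin c → Fin (a + (b + c))
  in₃ k = a ↑ʳ (b ↑ʳ k)
  in₁' : Fin a → Fin ((a + b) + c)
  in₁' i = (i ↑ˡ b) ↑ˡ c
  in₂' : Fin b → Fin ((a + b) + c)
  in₂' j = (a ↑ʳ j) ↑ˡ c
  in₃' : Fin c → Fin ((a + b) + c)
  in₃' = (a + b) ↑ʳ_

  -- Given by copairing, which is by definition the action of the homomorphism built from `[_,_]ᴴ`
  -- on vertices and on edges. Casts appear only when legs are compared.
  assocʳ : Fin ((a + b) + c) → Fin (a + (b + c))
  assocʳ = copair (copair in₁ in₂) in₃

  assocˡ : Fin (a + (b + c)) → Fin ((a + b) + c)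
  assocˡ = copair in₁' (copair in₂' in₃')

  assocʳ₁ : ∀ i → assocʳ (in₁' i) ≡ in₁ i
  assocʳ₁ i = trans (copair-↑ˡ (copair in₁ in₂) in₃ (i ↑ˡ b)) (copair-↑ˡ in₁ in₂ i)
  assocʳ₂ : ∀ j → assocʳ (in₂' j) ≡ in₂ j
  assocʳ₂ j = trans (copair-↑ˡ (copair in₁ in₂) in₃ (a ↑ʳ j)) (copair-↑ʳ in₁ in₂ j)
  assocʳ₃ : ∀ k → assocʳ (in₃' k) ≡ in₃ k
  assocʳ₃ k = copair-↑ʳ (copair in₁ in₂) in₃ k
  assocˡ₁ : ∀ i → assocˡ (in₁ i) ≡ in₁' i
  assocˡ₁ i = copair-↑ˡ in₁' (copair in₂' in₃') i
  assocˡ₂ : ∀ j → assocˡ (in₂ j) ≡ in₂' j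
  assocˡ₂ j = trans (copair-↑ʳ in₁' (copair in₂' in₃') (j ↑ˡ c)) (copair-↑ˡ in₂' in₃' j)
  assocˡ₃ : ∀ k → assocˡ (in₃ k) ≡ in₃' k
  assocˡ₃ k = trans (copair-↑ʳ in₁' (copair in₂' in₃') (b ↑ʳ k)) (copair-↑ʳ in₂' in₃' k)

  assocʳ-assocˡ : ∀ x → assocʳ (assocˡ x) ≡ x
  assocʳ-assocˡ = sum-ext {a} {b + c}
    (λ i → trans (cong assocʳ (assocˡ₁ i)) (assocʳ₁ i))
    (sum-ext {b} {c} {f = λ j → assocʳ (assocˡ (a ↑ʳ j))} {a ↑ʳ_}
      (λ j → trans (cong assocʳ (assocˡ₂ j)) (assocʳ₂ j))
      (λ k → trans (cong assocʳ (assocˡ₃ k)) (assocʳ₃ k)))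

  assocˡ-assocʳ : ∀ x → assocˡ (assocʳ x) ≡ x
  assocˡ-assocʳ = sum-ext {a + b} {c}
    (sum-ext {a} {b} {f = λ j → assocˡ (assocʳ (j ↑ˡ c))} {_↑ˡ c}
      (λ i → trans (cong assocˡ (assocʳ₁ i)) (assocˡ₁ i))
      (λ j → trans (cong assocˡ (assocʳ₂ j)) (assocˡ₂ j)))
    (λ k → trans (cong assocˡ (assocʳ₃ k)) (assocˡ₃ k))

  assocʳ-legs : ∀ {x y z} (f : Fin x → Fin a) (g : Fin y → Fin b) (h : Fin z → Fin c)
    → assocʳ ∘ ((f ⊎ᶠ g) ⊎ᶠ h) ≗ (f ⊎ᶠ (g ⊎ᶠ h)) ∘ castᶠ (+-assoc x y z)
  assocʳ-legs {x} {y} {z} f g h k =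
    trans (copair-⊎ᶠ (copair in₁ in₂) in₃ (f ⊎ᶠ g) h k)
    (trans (copair-cong {x + y} {z} (copair-⊎ᶠ in₁ in₂ f g) (λ _ → refl) k)
    (trans (sym (copair-assoc (in₁ ∘ f) (in₂ ∘ g) (in₃ ∘ h) k))
      (copair-cong {x} {y + z} (λ _ → refl) (λ j → sym (copair-∘ {y} {z} (a ↑ʳ_) _ _ j))
          (castᶠ (+-assoc x y z) k))))

open Associator using (assocʳ; assocˡ; assocʳ-assocˡ; assocˡ-assocʳ; assocʳ-legs)

-- Soundness of the interpretation in cospans

module Interpretation (Sig : ℕ → ℕ → Set) where
  open Cospans Sig

  interp : ∀ {n m} → Term Sig n m → Cospan Sig n m
  interp = interpret Sig

  compose-cong : ∀ {n z m} {c c' : Cospan Sig n z} {d d' : Cospan Sig z m} {r : Cospan Sig n m}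
    → c ≅ c' → d ≅ d' → IsComposite Sig c' d' r → compose Sig c d ≅ r
  compose-cong {c = c} {d = d} p q I = composite-cong (compose-isComposite c d) I p q

  -- At a composition the chosen coequalizer is not examined: `funC (g ∘ f)` is another composite of
  -- the same cospans, hence isomorphic to the chosen one.
  ↦-interp : ∀ {n m} {c : Term Sig n m} {f} → c ↦ f → interp c ≅ funC f
  ↦-interp id0↦ = ≅-refl
  ↦-interp id1↦ = ≅-refl
  ↦-interp σ↦ = ≅-refl
  ↦-interp μ↦ = legs-ext (λ k → Fin1-unique _ _) (λ _ → refl)
  ↦-interp η↦ = legs-ext (λ ()) (λ _ → refl)
  ↦-interp (⨾↦ {f = f} {g} p q) = compose-cong (↦-interp p) (↦-interp q) (funC-composite f (funC g))
  ↦-interp (⊕↦ {m = m} {q = q'} p q) = ≅-trans (⊕ᶜ-cong (↦-interp p) (↦-interp q))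
      (≅-ext (λ ()) (λ _ → refl) (id⊎ᶠid m q'))
  ↦-interp (cast↦ refl refl {f = f} p) = ≅-trans (↦-interp p)
    (legs-ext (λ k → sym (trans (cast-is-id refl _) (cong f (cast-is-id refl k)))) (λ _ → refl))
  ↦-interp (ext↦ e p) = ≅-trans (↦-interp p) (legs-ext e (λ _ → refl))

  ↤-interp : ∀ {n m} {c : Term Sig n m} {f} → c ↤ f → interp c ≅ cofunC f
  ↤-interp id0↤ = ≅-refl
  ↤-interp id1↤ = ≅-refl
  -- `swapC` has the identity as right leg and `cofunC` has it as left leg, so the vertices
  -- themselves must be swapped.
  ↤-interp σ↤ = bijective⇒≅ (record { hom = record { fV = swap 1 1 ; fE = λ () ; comm = λ () }
      ; inlC = λ { zero → refl ; (suc zero) → refl } ; inrC = λ _ → refl })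
    (swap 1 1) (λ ()) (λ { zero → refl ; (suc zero) → refl }) (λ ()) (λ { zero → refl ; (suc zero) → refl })
        (λ ())
  ↤-interp δ↤ = legs-ext (λ _ → refl) (λ k → Fin1-unique _ _)
  ↤-interp ε↤ = legs-ext (λ _ → refl) (λ ())
  ↤-interp (⨾↤ {f = f} {g} p q) = compose-cong (↤-interp p) (↤-interp q) (cofunC-composite (cofunC f) g)
  ↤-interp (⊕↤ {n} {p = p'} p q) = ≅-trans (⊕ᶜ-cong (↤-interp p) (↤-interp q))
      (≅-ext (λ ()) (id⊎ᶠid n p') (λ _ → refl))
  ↤-interp (cast↤ refl refl {f = f} p) = ≅-trans (↤-interp p)
    (legs-ext (λ _ → refl) (λ k → sym (trans (cast-is-id refl _) (cong f (cast-is-id refl k)))))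
  ↤-interp (ext↤ e p) = ≅-trans (↤-interp p) (legs-ext (λ _ → refl) e)

  -- Soundness

  castC : ∀ {n m n' m'} → n ≡ n' → m ≡ m' → Cospan Sig n m → Cospan Sig n' m'
  castC refl refl c = c

  -- The sort equations are variables here and can be matched with `refl`, which `+-assoc` and
  -- `+-identityʳ` at general arguments would not allow. The casts end up on the legs.
  castC-≅ : ∀ {n m n' m'} (p : n ≡ n') (q : m ≡ m') {A B : Hyp Sig} {l : Fin n → Fin (nV A)}
      {r : Fin m → Fin (nV A)}
    {l' : Fin n' → Fin (nV B)} {r' : Fin m' → Fin (nV B)} (h : A ⇒ B)
    → fV h ∘ l ≗ l' ∘ castᶠ p → fV h ∘ r ≗ r' ∘ castᶠ q
    → (gV : Fin (nV B) → Fin (nV A)) (gE : Fin (nE B) → Fin (nE A))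
    → (∀ v → gV (fV h v) ≡ v) → (∀ e → gE (fE h e) ≡ e) → (∀ v → fV h (gV v) ≡ v) → (∀ e → fE h (gE e) ≡ e)
    → castC p q (cospan A l r) ≅ cospan B l' r'
  castC-≅ refl refl {l' = l'} {r'} h pl pr = bijective⇒≅ (record { hom = h
    ; inlC = λ k → trans (pl k) (cong l' (cast-is-id refl k)) ; inrC = λ k → trans (pr k)
        (cong r' (cast-is-id refl k)) })

  ⊕ᶜ-assoc : ∀ {n m p q r s} (c : Cospan Sig n m) (d : Cospan Sig p q) (e : Cospan Sig r s)
    → castC (+-assoc n p r) (+-assoc m q s) ((c ⊕ᶜ d) ⊕ᶜ e) ≅ (c ⊕ᶜ (d ⊕ᶜ e))
  ⊕ᶜ-assoc {n} {m} {p} {q} {r} {s} c d e = castC-≅ (+-assoc n p r) (+-assoc m q s)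
    associator
    (assocʳ-legs (nV A) (nV B) (nV C) (inl c) (inl d) (inl e))
        (assocʳ-legs (nV A) (nV B) (nV C) (inr c) (inr d) (inr e))
    (assocˡ (nV A) (nV B) (nV C)) (assocˡ (nE A) (nE B) (nE C))
    (assocˡ-assocʳ (nV A) (nV B) (nV C)) (assocˡ-assocʳ (nE A) (nE B) (nE C))
    (assocʳ-assocˡ (nV A) (nV B) (nV C)) (assocʳ-assocˡ (nE A) (nE B) (nE C))
    where
    A = apex c
    B = apex d
    C = apex e
    inject₁ : A ⇒ (A ⊎ (B ⊎ C))
    inject₁ = ι₁ {A} {B ⊎ C}
    inject₂₃ : (B ⊎ C) ⇒ (A ⊎ (B ⊎ C))
    inject₂₃ = ι₂ {A} {B ⊎ C}
    associator : ((A ⊎ B) ⊎ C) ⇒ (A ⊎ (B ⊎ C))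
    associator = [_,_]ᴴ {A ⊎ B} {C} ([_,_]ᴴ {A} {B} inject₁ (inject₂₃ ∘ᴴ ι₁ {B} {C})) (inject₂₃ ∘ᴴ ι₂ {B} {C})

  ⊕ᶜ-idˡ : ∀ {n m} (c : Cospan Sig n m) → (idC Sig 0 ⊕ᶜ c) ≅ c
  ⊕ᶜ-idˡ c = ≅-ext (λ e → map-E-id (edge (apex c) e)) (λ _ → refl) (λ _ → refl)

  ⊕ᶜ-idʳ : ∀ {n m} (c : Cospan Sig n m) → castC (+-identityʳ n) (+-identityʳ m) (c ⊕ᶜ idC Sig 0) ≅ c
  ⊕ᶜ-idʳ {n} {m} c = castC-≅ (+-identityʳ n) (+-identityʳ m) {A = apex (c ⊕ᶜ idC Sig 0)} {apex c} [ idᴴ ,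
      fromDisc (λ ()) ]ᴴ
    (legs (inl c)) (legs (inr c)) (_↑ˡ 0) (_↑ˡ 0)
    (sum-ext {nV (apex c)} {0} (λ v → cong (_↑ˡ 0) (copair-↑ˡ {nV (apex c)} {0} id (λ ()) v)) (λ ()))
    (sum-ext {nE (apex c)} {0} (λ v → cong (_↑ˡ 0) (copair-↑ˡ {nE (apex c)} {0} id (λ ()) v)) (λ ()))
    (copair-↑ˡ {nV (apex c)} {0} id (λ ())) (copair-↑ˡ {nE (apex c)} {0} id (λ ()))
    where
    legs : ∀ {x} (f : Fin x → Fin (nV (apex c))) → copair {nV (apex c)} {0} id (λ ()) ∘ (f ⊎ᶠ id {A = Fin 0})
        ≗ f ∘ castᶠ (+-identityʳ x)
    legs {x} f = sum-ext {x} {0} (λ i → trans (copair-⊎ᶠ {c = 0} id (λ ()) f id (i ↑ˡ 0))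
        (trans (copair-↑ˡ {x} {0} f (λ ()) i)
      (cong f (sym (toℕ-injective (trans (toℕ-cast (+-identityʳ x) (i ↑ˡ 0)) (toℕ-↑ˡ i 0))))))) (λ ())

  swap-involutive : ∀ a b → swap b a ∘ swap a b ≗ id
  swap-involutive a b k = trans (copair-∘ (swap b a) (b ↑ʳ_) (_↑ˡ a) k)
    (trans (copair-cong {a} {b} (copair-↑ʳ {b} {a} _ _) (copair-↑ˡ {b} {a} _ _) k) (copair-eta a b k))

  swap-⊎ᶠ : ∀ {a b x y} (f : Fin x → Fin a) (g : Fin y → Fin b) → swap a b ∘ (f ⊎ᶠ g) ≗ (g ⊎ᶠ f) ∘ swap x y
  swap-⊎ᶠ {a} {b} {x} {y} f g k = trans (copair-⊎ᶠ (b ↑ʳ_) (_↑ˡ a) f g k)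
    (sym (trans (copair-∘ (g ⊎ᶠ f) (y ↑ʳ_) (_↑ˡ x) k) (copair-cong {x} {y} (⊎ᶠ-↑ʳ g f) (⊎ᶠ-↑ˡ g f) k)))

  ⊕ᶜ-comm : ∀ {n m p q} (c : Cospan Sig n m) (d : Cospan Sig p q)
    → relegʳ (c ⊕ᶜ d) (swap q m) ≅ relegˡ (swap n p) (d ⊕ᶜ c)
  ⊕ᶜ-comm {n} {m} {p} {q} c d = bijective⇒≅
    (record { hom = [ ι₂ {apex d} {apex c} , ι₁ {apex d} {apex c} ]ᴴ
            ; inlC = swap-⊎ᶠ (inl c) (inl d)
            ; inrC = λ k → trans (swap-⊎ᶠ (inr c) (inr d) (swap q m k))
                (cong (inr d ⊎ᶠ inr c) (swap-involutive q m k)) })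
    (swap (nV (apex d)) (nV (apex c))) (swap (nE (apex d)) (nE (apex c)))
    (swap-involutive (nV (apex c)) (nV (apex d))) (swap-involutive (nE (apex c)) (nE (apex d)))
    (swap-involutive (nV (apex d)) (nV (apex c))) (swap-involutive (nE (apex d)) (nE (apex c)))

  swapC-cofunC : ∀ n m → swapC Sig n m ≅ cofunC (swap m n)
  swapC-cofunC n m = bijective⇒≅ (record { hom = record { fV = swap m n ; fE = λ () ; comm = λ () }
      ; inlC = swap-involutive n m ; inrC = λ _ → refl })
    (swap n m) (λ ()) (swap-involutive m n) (λ ()) (swap-involutive n m) (λ ())

  interp-σ-nat : ∀ {n m p q} (c : Term Sig n m) (d : Term Sig p q)
    → interp ((c ⊕ d) ⨾ σnm Sig m q) ≅ interp (σnm Sig n p ⨾ (d ⊕ c))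
  interp-σ-nat {n} {m} {p} {q} c d = ≅-trans
    (compose-cong ≅-refl (≅-trans (↦-interp (σnm↦ m q)) (swapC-cofunC m q))
        (cofunC-composite (interp c ⊕ᶜ interp d) (swap q m)))
    (≅-trans (⊕ᶜ-comm (interp c) (interp d))
    (≅-sym (compose-cong (↦-interp (σnm↦ n p)) ≅-refl (funC-composite (swap n p) (interp d ⊕ᶜ interp c)))))

  ↦-unique : ∀ {n m} {c d : Term Sig n m} {f g} → c ↦ f → d ↦ g → f ≗ g → interp c ≅ interp d
  ↦-unique p q e = ≅-trans (↦-interp p) (≅-trans (legs-ext e (λ _ → refl)) (≅-sym (↦-interp q)))

  ↤-unique : ∀ {n m} {c d : Term Sig n m} {f g} → c ↤ f → d ↤ g → f ≗ g → interp c ≅ interp d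
  ↤-unique p q e = ≅-trans (↤-interp p) (≅-trans (legs-ext (λ _ → refl) e) (≅-sym (↤-interp q)))

  -- With one vertex and no edges there is no freedom left for the legs. Frobenius and speciality
  -- thus reduce to evaluating the size of the quotient on closed terms.
  point-≅ : ∀ {n m} (c d : Cospan Sig n m) → nV (apex c) ≡ 1 → nE (apex c) ≡ 0 → nV (apex d) ≡ 1 → nE (apex d)
      ≡ 0 → c ≅ d
  point-≅ record { apex = record { nV = .1 ; nE = .0 } } record { apex = record { nV = .1 ; nE = .0 } } refl
      refl refl refl =
    bijective⇒≅ (record { hom = fromDisc' ; inlC = λ _ → Fin1-unique _ _ ; inrC = λ _ → Fin1-unique _ _ })
      id (λ ()) (λ _ → refl) (λ ()) (λ _ → refl) (λ ())
    where
    fromDisc' : ∀ {x y : Fin 0 → Edge Sig (Fin 1)} → record { nV = 1 ; nE = 0 ; edge = x } ⇒ record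
        { nV = 1 ; nE = 0 ; edge = y }
    fromDisc' = record { fV = id ; fE = id ; comm = λ () }

  -- Intermediate terms of a derivation may have other sorts, so equality of sorts has to be proved
  -- in the same induction as the isomorphism.
  interp-cong : ∀ {n m n' m'} {c : Term Sig n m} {d : Term Sig n' m'} → Defs._≈_ Sig c d
    → Σ[ p ∈ n ≡ n' ] Σ[ q ∈ m ≡ m' ] (castC p q (interp c) ≅ interp d)
  interp-cong ≈-refl = refl , refl , ≅-refl
  interp-cong (≈-sym e) with interp-cong e
  ... | refl , refl , x = refl , refl , ≅-sym x
  interp-cong (≈-trans e e') with interp-cong e | interp-cong e'
  ... | refl , refl , x | refl , refl , y = refl , refl , ≅-trans x y
  interp-cong (⨾-cong {c' = c'} {d' = d'} e e') with interp-cong e | interp-cong e'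
  ... | refl , refl , x | refl , refl , y = refl , refl , compose-cong x y
      (compose-isComposite (interp c') (interp d'))
  interp-cong (⊕-cong e e') with interp-cong e | interp-cong e'
  ... | refl , refl , x | refl , refl , y = refl , refl , ⊕ᶜ-cong x y
  interp-cong (⨾-assoc c d e) = refl , refl , composite-cong
    (composite-assoc (compose-isComposite (interp c) (interp d))
        (compose-isComposite (interp (c ⨾ d)) (interp e)) (compose-isComposite (interp d) (interp e)))
    (compose-isComposite (interp c) (interp (d ⨾ e))) ≅-refl ≅-refl
  interp-cong (⨾-idˡ {n} c) = refl , refl , compose-cong (↦-interp (idₙ↦ n)) ≅-refl (funC-composite id (interp c))
  interp-cong (⨾-idʳ {m = m} c) = refl , refl , compose-cong ≅-refl (↤-interp (idₙ↤ m))
      (cofunC-composite (interp c) id)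
  interp-cong (⊕-assoc c d e) = _ , _ , ⊕ᶜ-assoc (interp c) (interp d) (interp e)
  interp-cong (⊕-idˡ c) = refl , refl , ⊕ᶜ-idˡ (interp c)
  interp-cong (⊕-idʳ c) = _ , _ , ⊕ᶜ-idʳ (interp c)
  interp-cong (interchange c d c' d') = refl , refl , composite-cong
    (composite-⊕ᶜ (compose-isComposite (interp c) (interp d)) (compose-isComposite (interp c') (interp d')))
    (compose-isComposite (interp c ⊕ᶜ interp c') (interp d ⊕ᶜ interp d')) ≅-refl ≅-refl
  interp-cong σ-inv = refl , refl , ↦-unique (⨾↦ σ↦ σ↦) (idₙ↦ 2) (λ { zero → refl ; (suc zero) → refl })
  interp-cong (σ-nat c d) = refl , refl , interp-σ-nat c d
  interp-cong δ-assoc = refl , refl , ↤-unique (⨾↤ δ↤ (⊕↤ δ↤ id1↤)) (⨾↤ δ↤ (⊕↤ id1↤ δ↤)) (λ _ → refl)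
  interp-cong δ-unit = refl , refl , ↤-unique (⨾↤ δ↤ (⊕↤ ε↤ id1↤)) id1↤ (λ _ → Fin1-unique _ _)
  interp-cong δ-comm = refl , refl , ↤-unique (⨾↤ δ↤ σ↤) δ↤ (λ _ → refl)
  interp-cong μ-assoc = refl , refl , ↦-unique (⨾↦ (⊕↦ μ↦ id1↦) μ↦) (⨾↦ (⊕↦ id1↦ μ↦) μ↦) (λ _ → refl)
  interp-cong μ-unit = refl , refl , ↦-unique (⨾↦ (⊕↦ η↦ id1↦) μ↦) id1↦ (λ _ → Fin1-unique _ _)
  interp-cong μ-comm = refl , refl , ↦-unique (⨾↦ σ↦ μ↦) μ↦ (λ _ → refl)
  interp-cong frob₁ = refl , refl , point-≅ (interp ((δ ⊕ id1) ⨾ (id1 ⊕ μ))) (interp (μ ⨾ δ)) refl refl refl refl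
  interp-cong frob₂ = refl , refl , point-≅ (interp (μ ⨾ δ)) (interp ((id1 ⊕ δ) ⨾ (μ ⊕ id1))) refl refl refl refl
  interp-cong special = refl , refl , point-≅ (interp (δ ⨾ μ)) (interp id1) refl refl refl refl

  -- No edge has to be preserved and all vertices have a single possible image. This covers `I-εη`,
  -- `I-δμ` and `I-μδ`.
  to-point : ∀ {n m} (c d : Cospan Sig n m) → nE (apex c) ≡ 0 → nV (apex d) ≡ 1 → Mor c d
  to-point record { apex = record { nE = .0 } } record { apex = record { nV = .1 } } refl refl =
    record { hom = record { fV = λ _ → zero ; fE = λ () ; comm = λ () } ; inlC = λ _ → Fin1-unique _ _ ; inrC
        = λ _ → Fin1-unique _ _ }

  -- The edge of `R` stays in the apex after its outputs are discarded; the witness is the inclusion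
  -- of its input vertices.
  interp-Rε : ∀ {n m} (R : Sig n m) → Mor (interp (εₙ Sig n)) (interp (gen R ⨾ εₙ Sig m))
  interp-Rε {n} {m} R = _≅C_.from (compose-cong {c = genC Sig R} ≅-refl (↤-interp (εₙ↤ m))
      (cofunC-composite (genC Sig R) (λ ())))
    ∘ᴹ (record { hom = fromDisc (m ↑ʳ_) ; inlC = λ _ → refl ; inrC = λ () }
    ∘ᴹ _≅C_.to (↤-interp (εₙ↤ n)))

  -- Two copies of the edge with shared inputs fold onto a single one; the fold map respects the
  -- gluing and is therefore induced on the pushout.
  interp-Rδ : ∀ {n m} (R : Sig n m) → Mor (interp (δₙ Sig n ⨾ (gen R ⊕ gen R))) (interp (gen R ⨾ δₙ Sig m))
  interp-Rδ {n} {m} R = _≅C_.from (compose-cong {c = genC Sig R} ≅-refl (↤-interp (δₙ↤ m))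
      (cofunC-composite (genC Sig R) (fold m)))
    ∘ᴹ (collapse ∘ᴹ _≅C_.to (compose-cong {d = g ⊕ᶜ g} (↤-interp (δₙ↤ n)) ≅-refl I))
    where
    g : Cospan Sig n m
    g = genC Sig R
    I : IsComposite Sig (cofunC (fold n)) (g ⊕ᶜ g) (compose Sig (cofunC (fold n)) (g ⊕ᶜ g))
    I = compose-isComposite (cofunC (fold n)) (g ⊕ᶜ g)
    module I = IsComposite I
    merged = I.univ (apex g) (fromDisc (m ↑ʳ_)) [ idᴴ , idᴴ ]ᴴ
      (λ k → trans (copair-∘ {n} {n} (m ↑ʳ_) id id k) (sym (copair-⊎ᶠ {n} {n} id id (m ↑ʳ_) (m ↑ʳ_) k)))
    collapse : Mor (compose Sig (cofunC (fold n)) (g ⊕ᶜ g)) (relegʳ g (fold m))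
    collapse = record
      { hom = proj₁ merged
      ; inlC = λ k → proj₁ (proj₁ (proj₂ merged)) k
      ; inrC = λ k → trans (proj₁ (proj₂ (proj₂ merged)) (inr (g ⊕ᶜ g) k))
          (trans (copair-⊎ᶠ {m} {m} id id (_↑ˡ n) (_↑ˡ n) k) (sym (copair-∘ {m} {m} (_↑ˡ n) id id k))) }

  interp-mono : ∀ {n m n' m'} {c : Term Sig n m} {d : Term Sig n' m'} → Defs._≤ₜ_ Sig c d
    → Σ[ p ∈ n ≡ n' ] Σ[ q ∈ m ≡ m' ] Mor (interp d) (castC p q (interp c))
  interp-mono (≈⇒≤ e) with interp-cong e
  ... | p , q , x = p , q , _≅C_.from x
  interp-mono (≤-trans e e') with interp-mono e | interp-mono e'
  ... | refl , refl , x | refl , refl , y = refl , refl , x ∘ᴹ y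
  interp-mono (⨾-mono {c = c} {c'} {d} {d'} e e') with interp-mono e | interp-mono e'
  ... | refl , refl , x | refl , refl , y = refl , refl , proj₁ (composite-mor
          (compose-isComposite (interp c') (interp d')) (compose-isComposite (interp c) (interp d)) x y)
  interp-mono (⊕-mono e e') with interp-mono e | interp-mono e'
  ... | refl , refl , x | refl , refl , y = refl , refl , ⊕ᶜ-mor x y
  interp-mono I-εη = refl , refl , to-point (interp (ε ⨾ η)) (interp id1) refl refl
  interp-mono I-ηε = refl , refl , record { hom = record { fV = λ () ; fE = λ () ; comm = λ () } ; inlC = λ ()
      ; inrC = λ () }
  interp-mono I-δμ = refl , refl , to-point (interp (δ ⨾ μ)) (interp id1) refl refl
  interp-mono I-μδ = refl , refl , to-point (interp (idₙ Sig 2)) (interp (μ ⨾ δ)) refl refl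
  interp-mono (I-Rδ R) = refl , refl , interp-Rδ R
  interp-mono (I-Rε R) = refl , refl , interp-Rε R

-- Every cospan is the interpretation of its readback

module Completeness (Sig : ℕ → ℕ → Set) where
  open Wiring Sig using (J; ⟦_⟧)
  open Frobenius Sig using (K; ⟦_⟧°)
  open States Sig
  open Cospans Sig
  open Interpretation Sig

  join : ∀ {b} → Fin b → Fin (suc b) → Fin b
  join i zero    = i
  join i (suc x) = x

  private
    join-suc : ∀ {b} (i : Fin b) → (id {A = Fin 1} ⊎ᶠ join i) ∘ (swap 1 1 ⊎ᶠ id {A = Fin b}) ≗ join (suc i)
    join-suc i zero          = refl
    join-suc i (suc zero)    = refl
    join-suc i (suc (suc x)) = refl

    join-zero : ∀ b → to1 {2} ⊎ᶠ id {A = Fin b} ≗ join zero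
    join-zero b zero          = refl
    join-zero b (suc zero)    = refl
    join-zero b (suc (suc x)) = refl

    join-head : ∀ {a b} (f : Fin (suc a) → Fin b) → join (f zero) ∘ (id {A = Fin 1} ⊎ᶠ (f ∘ suc)) ≗ f
    join-head f zero    = refl
    join-head f (suc x) = refl

  J↦ : ∀ {b} (i : Fin b) → J i ↦ join i
  J↦ {suc b} zero    = ext↦ (join-zero b) (⊕↦ μ↦ (idₙ↦ b))
  J↦ {suc b} (suc i) = ext↦ (join-suc i) (⨾↦ (⊕↦ σ↦ (idₙ↦ b)) (⊕↦ id1↦ (J↦ i)))

  K↤ : ∀ {b} (i : Fin b) → K i ↤ join i
  K↤ {suc b} zero    = ext↤ (join-zero b) (⊕↤ δ↤ (idₙ↤ b))
  K↤ {suc b} (suc i) = ext↤ (join-suc i) (⨾↤ (⊕↤ id1↤ (K↤ i)) (⊕↤ σ↤ (idₙ↤ b)))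

  ⟦⟧↦ : ∀ {a b} (f : Fin a → Fin b) → ⟦ f ⟧ ↦ f
  ⟦⟧↦ {zero}  {b} f = ext↦ (λ ()) (ηₙ↦ b)
  ⟦⟧↦ {suc a} {b} f = ext↦ (join-head f) (⨾↦ (⊕↦ id1↦ (⟦⟧↦ (f ∘ suc))) (J↦ (f zero)))

  ⟦⟧°↤ : ∀ {a b} (f : Fin a → Fin b) → ⟦ f ⟧° ↤ f
  ⟦⟧°↤ {zero}  {b} f = ext↤ (λ ()) (εₙ↤ b)
  ⟦⟧°↤ {suc a} {b} f = ext↤ (join-head f) (⨾↤ (K↤ (f zero)) (⊕↤ id1↤ (⟦⟧°↤ (f ∘ suc))))

  stateC : (A : Hyp Sig) → Cospan Sig 0 (nV A)
  stateC A = cospan A (λ ()) id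

  pushforward : ∀ {n v w k} (s : Term Sig n v) {x : Fin k → Edge Sig (Fin v)} {l : Fin n → Fin v}
      (f : Fin v → Fin w)
    → interp s ≅ cospan (record { nV = v ; nE = k ; edge = x }) l id
    → interp (s ⨾ ⟦ f ⟧) ≅ cospan (record { nV = w ; nE = k ; edge = map-E f ∘ x }) (f ∘ l) id
  pushforward {v = v} {k = k} s {x = x} {l} f p =
    compose-cong p (↦-interp (⟦⟧↦ f)) (pushforward-composite (record { nV = v ; nE = k ; edge = x }) l f)

  interp-cap : ∀ n → interp (cap n) ≅ cospan (disc Sig n) (λ ()) (fold n)
  interp-cap n = ≅-trans (compose-cong (↦-interp (ηₙ↦ n)) (↤-interp (⟦⟧°↤ (fold n)))
      (funC-composite (λ ()) (cofunC (fold n))))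
    (legs-ext (λ ()) (λ _ → refl))

  -- The cap glues the additional wires of `𝟙 n` onto the input vertices of the edge, so the pushout
  -- has no vertices beyond those of `genC R`, and inputs become visible on the right leg.
  interp-bend-gen : ∀ {n m} (R : Sig n m) → interp (bend (gen R)) ≅ stateC (apex (genC Sig R))
  interp-bend-gen {n} {m} R = compose-cong (interp-cap n) (⊕ᶜ-cong ≅-refl (↦-interp (idₙ↦ n))) I
    where
    A : Hyp Sig
    A = apex (genC Sig R)
    bent : Cospan Sig (n + n) (m + n)
    bent = genC Sig R ⊕ᶜ funC (id {A = Fin n})
    j : apex bent ⇒ A
    j = [ idᴴ , fromDisc (m ↑ʳ_) ]ᴴ
    I : IsComposite Sig (cospan (disc Sig n) (λ ()) (fold n)) bent (stateC A)
    I = record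
      { i = fromDisc (m ↑ʳ_)
      ; j = j
      ; glue = λ k → trans (copair-∘ {n} {n} (m ↑ʳ_) id id k) (sym (copair-⊎ᶠ {n} {n} id (m ↑ʳ_) (m ↑ʳ_) id k))
      ; legˡ = λ ()
      ; legʳ = λ k → sym (trans (copair-⊎ᶠ {m} {n} id (m ↑ʳ_) (_↑ˡ n) id k) (copair-eta m n k))
      ; univ = univ
      ; uniq = λ Q u u' iV iE jV jE →
            (λ v → subst (λ w → fV u w ≡ fV u' w) (copair-↑ˡ {m + n} {n} id (m ↑ʳ_) v) (jV (v ↑ˡ n)))
          , (λ e → subst (λ w → fE u w ≡ fE u' w) (copair-↑ˡ {1} {0} id (λ ()) e) (jE (e ↑ˡ 0)))
      }
      where
      univ : ∀ (Q : Hyp Sig) (a : disc Sig n ⇒ Q) (b : apex bent ⇒ Q) →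
          (∀ k → fV a (fold n k) ≡ fV b (inl bent k))
           → Σ[ u ∈ A ⇒ Q ] (Factors Sig (fromDisc (m ↑ʳ_)) u a × Factors Sig j u b)
      univ Q a b g = u , (onDisc , λ ())
          , sum-ext {m + n} {n} {f = fV u ∘ fV j} {fV b}
              (λ v → cong (fV u) (copair-↑ˡ {m + n} {n} id (m ↑ʳ_) v))
              (λ v → trans (cong (fV u) (copair-↑ʳ {m + n} {n} id (m ↑ʳ_) v)) (trans (onDisc v)
                 (trans (cong (fV a) (sym (copair-↑ʳ {n} {n} id id v)))
                     (trans (g (n ↑ʳ v)) (cong (fV b) (⊎ᶠ-↑ʳ {n} {m + n} {n} {n} (m ↑ʳ_) id v))))))
          , sum-ext {1} {0} (λ e → cong (fE u) (copair-↑ˡ {1} {0} id (λ ()) e)) (λ ())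
        where
        -- The part of `b` on the symbol determines everything: the cap identifies each additional
        -- wire with an input of the edge, and `g` makes `a` and `b` agree there.
        u : A ⇒ Q
        u = b ∘ᴴ ι₁ {A} {disc Sig n}
        onDisc : ∀ v → fV u (m ↑ʳ v) ≡ fV a v
        onDisc v = trans (cong (fV b) (sym (⊎ᶠ-↑ˡ {n} {m + n} {n} {n} (m ↑ʳ_) id v)))
            (trans (sym (g (v ↑ˡ n))) (cong (fV a) (copair-↑ˡ {n} {n} id id v)))

  interp-edgeState : ∀ {v} (e : Edge Sig (Fin v)) → interp (edgeState e) ≅ stateC
      (record { nV = v ; nE = 1 ; edge = λ _ → e })
  interp-edgeState (n , m , R , s , t) = ≅-trans (pushforward (bend (gen R)) f (interp-bend-gen R))
    (≅-ext (λ _ → cong₂ (λ x y → n , m , R , x , y)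
        (trans (sym (tabulate-∘ f (m ↑ʳ_))) (trans (tabulate-cong (copair-↑ʳ {m} {n} (lookup t) (lookup s)))
            (tabulate∘lookup s)))
        (trans (sym (tabulate-∘ f (_↑ˡ n))) (trans (tabulate-cong (copair-↑ˡ {m} {n} (lookup t) (lookup s)))
            (tabulate∘lookup t))))
      (λ ()) (λ _ → refl))
    where f = copair {m} {n} (lookup t) (lookup s)

  interp-sum : ∀ {v} k (x : Fin k → Edge Sig (Fin v)) → interp (sum (edgeState ∘ x)) ≅ stateC
      (record { nV = v ; nE = k ; edge = x })
  interp-sum {v} zero    x = ≅-trans (↦-interp (ηₙ↦ v)) (≅-ext (λ ()) (λ ()) (λ _ → refl))
  interp-sum {v} (suc k) x = ≅-trans
    (pushforward (edgeState (x zero) ⊕ sum (edgeState ∘ x ∘ suc)) {l = λ ()} (fold v)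
        (≅-trans (⊕ᶜ-cong (interp-edgeState (x zero)) (interp-sum k (x ∘ suc))) (legs-ext (λ ()) (id⊎ᶠid v v))))
    (≅-ext (λ { zero    → trans (map-E-∘ (fold v) (_↑ˡ v) (x zero))
        (trans (map-E-cong (copair-↑ˡ {v} {v} id id) (x zero)) (map-E-id (x zero)))
              ; (suc e) → trans (map-E-∘ (fold v) (v ↑ʳ_) (x (suc e)))
                  (trans (map-E-cong (copair-↑ʳ {v} {v} id id) (x (suc e))) (map-E-id (x (suc e)))) })
      (λ ()) (λ _ → refl))

  interp-M : (A : Hyp Sig) → interp (M (state A)) ≅ cospan A id id
  interp-M A = ≅-trans
    (pushforward (state A ⊕ idₙ Sig v) {l = v ↑ʳ_} (fold v)
        (≅-trans (⊕ᶜ-cong (interp-sum (nE A) (edge A)) (↦-interp (idₙ↦ v))) (legs-ext (λ _ → refl) (id⊎ᶠid v v))))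
    (bijective⇒≅ (record
        { hom = record
          -- The wires beside the state carry no edges, yet the edge set of the sum is
          -- `Fin (nE A + 0)`, which is not `Fin (nE A)` by definition.
          { fV = id ; fE = dropE
          ; comm = sum-ext {nE A} {0} (λ e → trans (cong (edge A) (copair-↑ˡ {nE A} {0} id (λ ()) e))
              (sym (trans (map-E-id _)
              (trans (cong (map-E (fold v)) (copair-↑ˡ {nE A} {0} _ _ e))
                  (trans (map-E-∘ (fold v) (_↑ˡ v) (edge A e))
                (trans (map-E-cong (copair-↑ˡ {v} {v} id id) (edge A e)) (map-E-id (edge A e)))))))) (λ ()) }
        ; inlC = copair-↑ʳ {v} {v} id id ; inrC = λ _ → refl })
      id (_↑ˡ 0) (λ _ → refl) (sum-ext {nE A} {0} (λ e → cong (_↑ˡ 0) (copair-↑ˡ {nE A} {0} id (λ ()) e)) (λ ()))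
      (λ _ → refl) (copair-↑ˡ {nE A} {0} id (λ ())))
    where
    v = nV A
    dropE : Fin (nE A + 0) → Fin (nE A)
    dropE = copair {nE A} {0} id (λ ())

  interp-readback : ∀ {n m} (a : Cospan Sig n m) → interp (readback a) ≅ a
  interp-readback a = compose-cong
    (compose-cong (↦-interp (⟦⟧↦ (inl a))) (interp-M (apex a)) (funC-composite (inl a) (cospan (apex a) id id)))
    (↤-interp (⟦⟧°↤ (inr a)))
    (cofunC-composite (cospan (apex a) (inl a) id) (inr a))

mainTheorem2 : (Sig : ℕ → ℕ → Set) → CBIso Sig
mainTheorem2 Sig = record
  { F = interp
  ; G = readback
  ; F-cong = homogeneous-cong
  ; F-mono = homogeneous-mono
  ; G-cong = readback-cong
  ; G-mono = readback-mono
  ; GF = readback-interpret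
  ; FG = interp-readback
  ; F-id = λ n → ↦-interp (idₙ↦ n)
  ; F-comp = λ c d → compose-isComposite (interp c) (interp d)
  ; F-⊕ = λ c d → ≅-refl
  ; F-σ = λ n m → ↦-interp (σnm↦ n m)
  ; F-μ = λ n → ↦-interp (μₙ↦ n)
  ; F-η = λ n → ≅-trans (↦-interp (ηₙ↦ n)) (legs-ext (λ ()) (λ _ → refl))
  ; F-δ = λ n → ↤-interp (δₙ↤ n)
  ; F-ε = λ n → ≅-trans (↤-interp (εₙ↤ n)) (legs-ext (λ _ → refl) (λ ()))
  }
  where
  open States Sig
  open Readback Sig
  open Monotonicity Sig
  open Cospans Sig
  open Interpretation Sig
  open Completeness Sig

  -- For terms of equal sorts the two sort equations are loops on natural numbers, so matching them
  -- with `refl` removes the cast.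
  homogeneous-cong : ∀ {n m} {c d : Term Sig n m} → Defs._≈_ Sig c d → interp c ≅ interp d
  homogeneous-cong e with interp-cong e
  ... | refl , refl , x = x

  homogeneous-mono : ∀ {n m} {c d : Term Sig n m} → Defs._≤ₜ_ Sig c d → Mor (interp d) (interp c)
  homogeneous-mono e with interp-mono e
  ... | refl , refl , x = x
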